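{- Let $\mathsf{A}_{15}^+$ be the lattice defined in the context, and let \[ \mathbf{a}=\tfrac14(-3,-3,-3,-3,1,1,1,1,1,1,1,1,1,1,1,1),\quad \mathbf{b}=\tfrac14(-3,-3,-3,1,-3,1,1,1,1,1,1,1,1,1,1,1), \] \[ \mathbf{c}=\tfrac14(-3,1,1,1,1,-3,-3,-3,1,1,1,1,1,1,1,1),\quad \mathbf{c}'=\tfrac14(1,1,1,-3,-3,-3,-3,1,1,1,1,1,1,1,1,1), \] all of which lie in $\mathsf{A}_{15}^+$. Then, up to the action of $\operatorname{Aut}(\mathsf{A}_{15}^+)$, there are precisely two sublattices of $\mathsf{A}_{15}^+$ having Gram matrix \[ \begin{pmatrix}3&2&0\\2&3&0\\0&0&3\end{pmatrix} \] with respect to some basis, and they are $\langle \mathbf{a},\mathbf{b},\mathbf{c}\rangle$ and $\langle \mathbf{a},\mathbf{b},\mathbf{c}'\rangle$. Moreover, the orthogonal complements $\langle \mathbf{a},\mathbf{b},\mathbf{c}\rangle^{\perp}$ and $\langle \mathbf{a},\mathbf{b},\mathbf{c}'\rangle^{\perp}$ in $\mathsf{A}_{15}^+$ are non-isometric, and each of them is a minimal non $2$-integrable lattice of rank $12$ and determinant $15$.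
   Context: A lattice means a positive definite integral $\mathbb{Z}$-lattice, i.e. a subgroup of some $\mathbb{R}^n$ generated by linearly independent vectors, with the standard inner product, on which all inner products are integers. The norm of a vector $\mathbf{x}$ is $(\mathbf{x},\mathbf{x})$. For a positive integer $n$, $\mathsf{A}_n=\{\mathbf{x}\in\mathbb{Z}^{n+1}: \sum_i x_i=0\}$. $\mathsf{A}_{15}^+$ is the lattice in $\mathbb{R}^{16}$ generated by $\mathsf{A}_{15}$ and the vector $[4]=\tfrac14(1,1,1,1,1,1,1,1,1,1,1,1,-3,-3,-3,-3)$; it is a unimodular lattice. $\operatorname{Aut}(\mathsf{A}_{15}^+)$ is its group of isometries (orthogonal linear maps of $\mathbb{R}^{16}$ mapping $\mathsf{A}_{15}^+$ onto itself). The orthogonal complement of a sublattice $M\subseteq L$ is $\{\mathbf{u}\in L:(\mathbf{u},\mathbf{v})=0\ \forall \mathbf{v}\in M\}$. For a positive integer $s$, a lattice $L$ is $s$-integrable if $\sqrt{s}\cdot L$ is isometric to a sublattice of $\mathbb{Z}^n$ for some $n$. A lattice $L$ is non $s$-minimal if there exist a lattice $M$ and a positive integer $m$ such that $\sqrt{s}\cdot L$ is isometric to a sublattice of $\sqrt{s}\cdot M\perp\mathbb{Z}^m$ not contained in $\sqrt{s}\cdot M$; otherwise $L$ is $s$-minimal. A minimal non $s$-integrable lattice is a lattice that is not $s$-integrable and is $s$-minimal. -}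

module Defs where

open import Data.Nat using (ℕ; zero; suc; _≥_)
open import Data.Integer using (ℤ; +_; -[1+_]; _+_; _*_; -_; _<_)
open import Data.Fin using (Fin; zero; suc; toℕ; punchIn)
open import Data.Vec using (Vec; []; _∷_; lookup)
open import Data.Product using (Σ; _×_; _,_)
open import Data.Sum using (_⊎_)
open import Relation.Binary.PropositionalEquality using (_≡_)
open import Relation.Nullary using (¬_)

-- Conventions.
-- A vector x ∈ (1/4)ℤ^16 ⊆ ℝ^16 is represented by  4x ∈ ℤ^16,  as a
-- function  Fin 16 → ℤ.  Hence the true inner product of two represented
-- vectors x, y is  dot x y / 16.  Equality of vectors is pointwise (_≈_).

sumF : ∀ {n} → (Fin n → ℤ) → ℤ
sumF {zero}  f = + 0
sumF {suc n} f = f zero + sumF (λ i → f (suc i))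

dot : ∀ {n} → (Fin n → ℤ) → (Fin n → ℤ) → ℤ
dot x y = sumF (λ i → x i * y i)

V : Set
V = Fin 16 → ℤ

_≈_ : ∀ {n} → (Fin n → ℤ) → (Fin n → ℤ) → Set
x ≈ y = ∀ i → x i ≡ y i

_+v_ : ∀ {n} → (Fin n → ℤ) → (Fin n → ℤ) → (Fin n → ℤ)
(x +v y) i = x i + y i

vec : Vec ℤ 16 → V
vec = lookup

Pred : Set₁
Pred = V → Set

-- A₁₅ = { x ∈ ℤ^16 : Σ xᵢ = 0 }  (unscaled integer vector)
InA15 : (Fin 16 → ℤ) → Set
InA15 y = sumF y ≡ + 0

m3 p1 : ℤ
m3 = -[1+ 2 ]
p1 = + 1

-- 4·[4] = (1,…,1,-3,-3,-3,-3)
g4 : V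
g4 = vec (p1 ∷ p1 ∷ p1 ∷ p1 ∷ p1 ∷ p1 ∷ p1 ∷ p1 ∷ p1 ∷ p1 ∷ p1 ∷ p1 ∷ m3 ∷ m3 ∷ m3 ∷ m3 ∷ [])

-- A₁₅⁺ = subgroup generated by A₁₅ and [4] = A₁₅ + ℤ·[4].
-- In the scaled representation:  x = 4y + k·(4[4])  with y ∈ A₁₅, k ∈ ℤ.
InA15p : Pred
InA15p x = Σ (Fin 16 → ℤ) λ y → Σ ℤ λ k →
  InA15 y × (∀ i → x i ≡ (+ 4) * y i + k * g4 i)

a b c c' : V
a  = vec (m3 ∷ m3 ∷ m3 ∷ m3 ∷ p1 ∷ p1 ∷ p1 ∷ p1 ∷ p1 ∷ p1 ∷ p1 ∷ p1 ∷ p1 ∷ p1 ∷ p1 ∷ p1 ∷ [])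
b  = vec (m3 ∷ m3 ∷ m3 ∷ p1 ∷ m3 ∷ p1 ∷ p1 ∷ p1 ∷ p1 ∷ p1 ∷ p1 ∷ p1 ∷ p1 ∷ p1 ∷ p1 ∷ p1 ∷ [])
c  = vec (m3 ∷ p1 ∷ p1 ∷ p1 ∷ p1 ∷ m3 ∷ m3 ∷ m3 ∷ p1 ∷ p1 ∷ p1 ∷ p1 ∷ p1 ∷ p1 ∷ p1 ∷ p1 ∷ [])
c' = vec (p1 ∷ p1 ∷ p1 ∷ m3 ∷ m3 ∷ m3 ∷ m3 ∷ p1 ∷ p1 ∷ p1 ∷ p1 ∷ p1 ∷ p1 ∷ p1 ∷ p1 ∷ p1 ∷ [])

abc abc' : Fin 3 → V
abc zero = a
abc (suc zero) = b
abc (suc (suc zero)) = c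
abc' zero = a
abc' (suc zero) = b
abc' (suc (suc zero)) = c'

G : Fin 3 → Fin 3 → ℤ
G zero zero = + 3
G zero (suc zero) = + 2
G (suc zero) zero = + 2
G (suc zero) (suc zero) = + 3
G (suc (suc zero)) (suc (suc zero)) = + 3
G _ _ = + 0

Span : ∀ {r} → (Fin r → V) → Pred
Span {r} v x = Σ (Fin r → ℤ) λ co → ∀ i → x i ≡ sumF (λ j → co j * v j i)

-- (v_i, v_j) = M i j  for all i j   (true inner product = dot/16)
HasGram : ∀ {r} → (Fin r → V) → (Fin r → Fin r → ℤ) → Set
HasGram v M = ∀ i j → dot (v i) (v j) ≡ (+ 16) * M i j

IsBasis : ∀ {r} → Pred → (Fin r → V) → Set
IsBasis {r} L B =
  (∀ i → L (B i)) ×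
  (∀ (co : Fin r → ℤ) → (∀ k → sumF (λ j → co j * B j k) ≡ + 0) → ∀ j → co j ≡ + 0) ×
  (∀ x → L x → Span B x)

sgnℕ : ℕ → ℤ
sgnℕ zero = + 1
sgnℕ (suc k) = - sgnℕ k

det : ∀ {n} → (Fin n → Fin n → ℤ) → ℤ
det {zero} M = + 1
det {suc n} M = sumF (λ j → sgnℕ (toℕ j) * (M zero j * det (λ r s → M (suc r) (punchIn j s))))

RankDet : Pred → ℕ → ℤ → Set
RankDet L r d = Σ (Fin r → V) λ B → Σ (Fin r → Fin r → ℤ) λ M →
  IsBasis L B × HasGram B M × det M ≡ d

AdditiveOn : ∀ {n} → Pred → (V → (Fin n → ℤ)) → Set
AdditiveOn L f = ∀ x y → L x → L y → f (x +v y) ≈ (f x +v f y)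

IsometryOnto : Pred → Pred → (V → V) → Set
IsometryOnto L L' f =
  (∀ x → L x → L' (f x)) ×
  AdditiveOn L f ×
  (∀ x y → L x → L y → dot (f x) (f y) ≡ dot x y) ×
  (∀ y → L' y → Σ V λ x → L x × f x ≈ y)

Isometric : Pred → Pred → Set
Isometric L L' = Σ (V → V) (IsometryOnto L L')

IsAut : (V → V) → Set
IsAut = IsometryOnto InA15p InA15p

AutEquiv : Pred → Pred → Set
AutEquiv S T = Σ (V → V) λ σ → IsAut σ ×
  (∀ x → S x → T (σ x)) × (∀ y → T y → Σ V λ x → S x × σ x ≈ y)

Perp : Pred → Pred
Perp S x = InA15p x × (∀ y → S y → dot x y ≡ + 0)

-- √s·L is isometric to a sublattice of ℤ^n
Integrable : ℕ → Pred → Set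
Integrable s L = Σ ℕ λ n → Σ (V → (Fin n → ℤ)) λ f →
  AdditiveOn L f ×
  (∀ x y → L x → L y → (+ 16) * dot (f x) (f y) ≡ (+ s) * dot x y)

bil : ∀ {k} → (Fin k → Fin k → ℤ) → (Fin k → ℤ) → (Fin k → ℤ) → ℤ
bil H p q = sumF (λ i → sumF (λ j → p i * (H i j * q j)))

IsLatticeGram : ∀ {k} → (Fin k → Fin k → ℤ) → Set
IsLatticeGram {k} H = (∀ i j → H i j ≡ H j i) ×
  (∀ (p : Fin k → ℤ) → (Σ (Fin k) λ i → ¬ (p i ≡ + 0)) → + 0 < bil H p p)

-- non s-minimal: √s·L embeds isometrically into √s·M ⊥ ℤ^m (m ≥ 1) with
-- image not contained in √s·M.  M is given by a Gram matrix H w.r.t. a basis;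
-- an element of √s·M ⊥ ℤ^m is (p , q), p = coordinates in √s·M, q ∈ ℤ^m.
NonMinimal : ℕ → Pred → Set
NonMinimal s L = Σ ℕ λ k → Σ (Fin k → Fin k → ℤ) λ H → IsLatticeGram H ×
  Σ ℕ λ m → m ≥ 1 × Σ (V → (Fin k → ℤ)) λ f₁ → Σ (V → (Fin m → ℤ)) λ f₂ →
  AdditiveOn L f₁ × AdditiveOn L f₂ ×
  (∀ x y → L x → L y →
     (+ 16) * ((+ s) * bil H (f₁ x) (f₁ y) + dot (f₂ x) (f₂ y)) ≡ (+ s) * dot x y) ×
  (Σ V λ x → L x × Σ (Fin m) λ i → ¬ (f₂ x i ≡ + 0))

Minimal : ℕ → Pred → Set
Minimal s L = ¬ NonMinimal s L

MinimalNonIntegrable : ℕ → Pred → Set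
MinimalNonIntegrable s L = ¬ Integrable s L × Minimal s L

{-# OPTIONS --safe #-}

-- A₁₅⁺ consists of the x ∈ ¼ ℤ¹⁶ with Σ x = 0 and all entries congruent modulo 1.  Completing squares shows that
-- its vectors of norm 2 are the eᵢ − eⱼ and its vectors of norm 3 the ± (¼ · 1 − 1ₛ) for 4-element sets S, and
-- (¼ · 1 − 1ₛ , ¼ · 1 − 1ₜ) = |S ∩ T| − 1.  So a triple with the given Gram matrix amounts to three 4-sets S, T, U
-- with |S ∩ T| = 3 and |S ∩ U| = |T ∩ U| = 1.  All such triples with the same |S ∩ T ∩ U| ∈ {0 , 1} are equivalent
-- under permutations of the coordinates.  The two complements have 64 and 80 roots.
--
-- Let L be one of the complements, and suppose 2 (x , y) = 2 A(x , y) + Σ φₖ(x) φₖ(y) with A integral and positive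
-- semidefinite.  Then N = ½ Σ φₖ φₖ is integral too.  If A(x , x) = 1, then A(x , -) is a nonzero dual vector of
-- norm at most 1, and likewise for N; but the dual of L has minimum 16/15.  As L has a connected basis of vectors of
-- norm 2 and 3, it follows that A = 0 or N = 0.  If A = 0, the φₖ are dual vectors of norm at most 2 with
-- Σ φₖ φₖ = 2 ( , ), and evaluating suitable quadratic forms on the 210 nonzero dual vectors of norm at most 2 shows
-- that this is impossible.

module Submission where

open import Defs
import Algebra.Properties.CommutativeMonoid.Sum as MonoidSum
open import Data.Bool using (Bool; true; false; T; if_then_else_; not; _∧_)
open import Data.Bool.ListAction using (all)
open import Data.Bool.Properties using (T-∧)
open import Data.Empty using (⊥; ⊥-elim)
open import Data.Fin using (Fin; zero; suc; #_; toℕ; punchIn)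
import Data.Fin as Fin
open import Data.Fin.Permutation using (Permutation; _⟨$⟩ʳ_)
import Data.Fin.Permutation as Perm
import Data.Fin.Properties as Fin
open import Data.Integer hiding (suc; sign)
open import Data.Integer.DivMod using (_%ℕ_; _/ℕ_; n%ℕd<d; a≡a%ℕn+[a/ℕn]*n)
open import Data.Integer.Properties
open import Data.Integer.Tactic.RingSolver using (solve-∀)
open import Data.List using (List; []; _∷_; _++_; allFin; cartesianProduct; filter; filterᵇ; length; map)
import Data.List as List
open import Data.List.Membership.Propositional using (_∈_)
open import Data.List.Membership.Propositional.Properties using (∈-allFin; ∈-cartesianProduct⁺; ∈-filter⁺; ∈-filter⁻; ∈-lookup)
open import Data.List.Relation.Unary.All using (All)
import Data.List.Relation.Unary.All as All
open import Data.List.Relation.Unary.All.Properties using (all⁺; all⁻; map⁺; map⁻)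
open import Data.List.Relation.Unary.AllPairs using (_∷_)
open import Data.List.Relation.Unary.Any using (here; there; index)
open import Data.List.Relation.Unary.Any.Properties using (lookup-index)
open import Data.List.Relation.Unary.Unique.Propositional using (Unique)
open import Data.List.Relation.Unary.Unique.Propositional.Properties using (allFin⁺; cartesianProduct⁺; filter⁺)
open import Data.Nat using (ℕ; zero; suc; z≤n; s≤s)
import Data.Nat as ℕ
import Data.Nat.Properties as ℕ
open import Data.Product using (Σ; _×_; _,_; proj₁; proj₂)
open import Data.Sum using (_⊎_; inj₁; inj₂)
open import Data.Unit using (⊤; tt)
open import Data.Vec using (Vec; []; _∷_; lookup; replicate; tabulate; tail; zipWith)
open import Data.Vec.Properties using (lookup∘tabulate)
open import Data.Vec.Relation.Unary.All using ([]; _∷_)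
open import Data.Vec.Relation.Unary.All.Properties using (lookup⁺)
open import Function using (Equivalence)
open import Relation.Binary.PropositionalEquality
open import Relation.Nullary using (¬_; Dec; yes; no; does; ¬?)
open import Relation.Nullary.Decidable using (_×-dec_; decidable-stable; from-yes)

-- Non-integrability and minimality are two uses of one statement, `rigid`: in every such
-- decomposition all φₖ vanish. For minimality A is the pull-back of `H`, for non-integrability A =
-- 0. The number of functionals is not bounded in advance, but each satisfies φₖ(t)² ≤ 2 (t , t), so
-- each lies in a finite set that can be enumerated by evaluation. For A = 0, asking for nonnegative
-- weights on the squares of these functionals is a linear program; the forms in `Ds` bring in
-- integrality. Each of them is nonnegative on the finite set, has total 6 over the φₖ, and takes
-- the value 7 at some ± (eᵢ - eⱼ). Real weights could give that functional up to 6/7, but as one of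
-- the φₖ it would count at least once, so it does not occur. On the functionals that remain, `Q` is
-- a Farkas certificate of infeasibility.

Vecℤ : ℕ → Set
Vecℤ n = Fin n → ℤ

Matℤ : ℕ → ℕ → Set
Matℤ m n = Fin m → Fin n → ℤ

-- Finite sums and bilinear forms

sumF-cong : ∀ {n} {f g : Vecℤ n} → f ≈ g → sumF f ≡ sumF g
sumF-cong {zero}  e = refl
sumF-cong {suc n} e = cong₂ _+_ (e zero) (sumF-cong (λ i → e (suc i)))

sumF-+ : ∀ {n} (f g : Vecℤ n) → sumF (λ i → f i + g i) ≡ sumF f + sumF g
sumF-+ {zero}  f g = refl
sumF-+ {suc n} f g rewrite sumF-+ (λ i → f (suc i)) (λ i → g (suc i)) =
  swap₄ (f zero) (g zero) _ _
  where
  swap₄ : ∀ p q r s → p + q + (r + s) ≡ p + r + (q + s)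
  swap₄ = solve-∀

sumF-*ˡ : ∀ {n} c (f : Vecℤ n) → sumF (λ i → c * f i) ≡ c * sumF f
sumF-*ˡ {zero}  c f = sym (*-zeroʳ c)
sumF-*ˡ {suc n} c f rewrite sumF-*ˡ c (λ i → f (suc i)) = sym (*-distribˡ-+ c _ _)

sumF-const : ∀ {n} c → sumF {n} (λ _ → c) ≡ (+ n) * c
sumF-const {zero}  c = sym (*-zeroˡ c)
sumF-const {suc n} c = trans (cong (λ z → c + z) (sumF-const {n} c)) (sym (suc-* (+ n) c))

sumF-0 : ∀ {n} → sumF {n} (λ _ → + 0) ≡ + 0
sumF-0 {n} = trans (sumF-const {n} (+ 0)) (*-zeroʳ (+ n))

sumF-neg : ∀ {n} (f : Vecℤ n) → sumF (λ i → - f i) ≡ - sumF f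
sumF-neg f = trans (sumF-cong (λ i → sym (-1*i≡-i (f i)))) (trans (sumF-*ˡ (- (+ 1)) f) (-1*i≡-i (sumF f)))

sumF-swap : ∀ {m n} (M : Matℤ m n) →
  sumF (λ i → sumF (λ j → M i j)) ≡ sumF (λ j → sumF (λ i → M i j))
sumF-swap {zero}  {n} M = sym (sumF-0 {n})
sumF-swap {suc m} {n} M =
  trans (cong (λ z → sumF (M zero) + z) (sumF-swap (λ i → M (suc i))))
        (sym (sumF-+ (M zero) (λ j → sumF (λ i → M (suc i) j))))

sumF-nonneg : ∀ {n} (f : Vecℤ n) → (∀ i → + 0 ≤ f i) → + 0 ≤ sumF f
sumF-nonneg {zero}  f h = ≤-refl
sumF-nonneg {suc n} f h = +-mono-≤ (h zero) (sumF-nonneg _ (λ i → h (suc i)))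

sumF-mono : ∀ {n} (f g : Vecℤ n) → (∀ i → f i ≤ g i) → sumF f ≤ sumF g
sumF-mono {zero}  f g h = ≤-refl
sumF-mono {suc n} f g h = +-mono-≤ (h zero) (sumF-mono _ _ (λ i → h (suc i)))

term≤sumF : ∀ {n} (f : Vecℤ n) → (∀ i → + 0 ≤ f i) → ∀ i → f i ≤ sumF f
term≤sumF {suc n} f h zero =
  ≤-trans (≤-reflexive (sym (+-identityʳ (f zero)))) (+-monoʳ-≤ (f zero) (sumF-nonneg _ (λ i → h (suc i))))
term≤sumF {suc n} f h (suc i) =
  ≤-trans (term≤sumF (λ i → f (suc i)) (λ i → h (suc i)) i)
          (≤-trans (≤-reflexive (sym (+-identityˡ _))) (+-monoˡ-≤ _ (h zero)))

sumF≡0⇒≡0 : ∀ {n} (f : Vecℤ n) → (∀ i → + 0 ≤ f i) → sumF f ≡ + 0 → ∀ i → f i ≡ + 0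
sumF≡0⇒≡0 f h e i = ≤-antisym (≤-trans (term≤sumF f h i) (≤-reflexive e)) (h i)

0≤i*i : ∀ i → + 0 ≤ i * i
0≤i*i (+ n)    = ≤-trans (+≤+ z≤n) (≤-reflexive (pos-* n n))
0≤i*i -[1+ n ] = +≤+ z≤n

i*i≡0⇒i≡0 : ∀ i → i * i ≡ + 0 → i ≡ + 0
i*i≡0⇒i≡0 i e with i*j≡0⇒i≡0∨j≡0 i e
... | inj₁ p = p
... | inj₂ p = p

comb : ∀ {r k} → Vecℤ r → Matℤ r k → Vecℤ k
comb t p c = sumF (λ i → t i * p i c)

dot-comm : ∀ {n} (x y : Vecℤ n) → dot x y ≡ dot y x
dot-comm x y = sumF-cong (λ i → *-comm (x i) (y i))

dot-congˡ : ∀ {n} {x x' : Vecℤ n} (y : Vecℤ n) → x ≈ x' → dot x y ≡ dot x' y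
dot-congˡ y e = sumF-cong (λ i → cong (_* y i) (e i))

dot-congʳ : ∀ {n} (x : Vecℤ n) {y y' : Vecℤ n} → y ≈ y' → dot x y ≡ dot x y'
dot-congʳ x e = sumF-cong (λ i → cong (x i *_) (e i))

dot-combʳ : ∀ {r n} (t : Vecℤ r) (p : Matℤ r n) x → dot x (comb t p) ≡ dot t (λ i → dot x (p i))
dot-combʳ t p x = begin
  sumF (λ c → x c * sumF (λ i → t i * p i c))
    ≡⟨ sumF-cong (λ c → sym (sumF-*ˡ (x c) (λ i → t i * p i c))) ⟩
  sumF (λ c → sumF (λ i → x c * (t i * p i c)))
    ≡⟨ sumF-swap (λ c i → x c * (t i * p i c)) ⟩
  sumF (λ i → sumF (λ c → x c * (t i * p i c)))
    ≡⟨ sumF-cong (λ i → trans (sumF-cong (λ c → lcomm (x c) (t i) (p i c))) (sumF-*ˡ (t i) (λ c → x c * p i c))) ⟩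
  sumF (λ i → t i * dot x (p i)) ∎
  where
  open ≡-Reasoning
  lcomm : ∀ x y z → x * (y * z) ≡ y * (x * z)
  lcomm = solve-∀

dot-combˡ : ∀ {r n} (t : Vecℤ r) (p : Matℤ r n) y → dot (comb t p) y ≡ dot t (λ i → dot (p i) y)
dot-combˡ t p y = trans (dot-comm (comb t p) y)
  (trans (dot-combʳ t p y) (dot-congʳ t (λ i → dot-comm y (p i))))

bil-dot : ∀ {k} (H : Matℤ k k) p q → bil H p q ≡ dot p (λ i → dot (H i) q)
bil-dot H p q = sumF-cong (λ i → sumF-*ˡ (p i) (λ j → H i j * q j))

bil-congᴹ : ∀ {k} {H K : Matℤ k k} (p q : Vecℤ k) → (∀ i j → H i j ≡ K i j) → bil H p q ≡ bil K p q
bil-congᴹ p q e = sumF-cong (λ i → sumF-cong (λ j → cong (λ h → p i * (h * q j)) (e i j)))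

bil-combˡ : ∀ {r k} (H : Matℤ k k) (t : Vecℤ r) (p : Matℤ r k) y →
  bil H (comb t p) y ≡ dot t (λ i → bil H (p i) y)
bil-combˡ H t p y = trans (bil-dot H (comb t p) y)
  (trans (dot-combˡ t p _) (dot-congʳ t (λ i → sym (bil-dot H (p i) y))))

bil-combʳ : ∀ {r k} (H : Matℤ k k) (t : Vecℤ r) (p : Matℤ r k) x →
  bil H x (comb t p) ≡ dot t (λ i → bil H x (p i))
bil-combʳ H t p x = begin
  bil H x (comb t p)                              ≡⟨ bil-dot H x (comb t p) ⟩
  dot x (λ i → dot (H i) (comb t p))              ≡⟨ dot-congʳ x (λ i → dot-combʳ t p (H i)) ⟩
  dot x (comb t (λ j i → dot (H i) (p j)))        ≡⟨ dot-combʳ t _ x ⟩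
  dot t (λ j → dot x (λ i → dot (H i) (p j)))     ≡⟨ dot-congʳ t (λ j → sym (bil-dot H x (p j))) ⟩
  dot t (λ j → bil H x (p j)) ∎
  where open ≡-Reasoning

bil-gram : ∀ {r k} (H : Matℤ k k) (p : Matℤ r k) (t u : Vecℤ r) →
  bil H (comb t p) (comb u p) ≡ bil (λ i j → bil H (p i) (p j)) t u
bil-gram H p t u = begin
  bil H (comb t p) (comb u p)                         ≡⟨ bil-combˡ H t p (comb u p) ⟩
  dot t (λ i → bil H (p i) (comb u p))                ≡⟨ dot-congʳ t (λ i → trans (bil-combʳ H u p (p i)) (dot-comm u _)) ⟩
  dot t (λ i → dot (λ j → bil H (p i) (p j)) u)       ≡⟨ sym (bil-dot (λ i j → bil H (p i) (p j)) t u) ⟩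
  bil (λ i j → bil H (p i) (p j)) t u ∎
  where open ≡-Reasoning

dot-gram : ∀ {r k} (p : Matℤ r k) (t u : Vecℤ r) →
  dot (comb t p) (comb u p) ≡ bil (λ i j → dot (p i) (p j)) t u
dot-gram p t u = begin
  dot (comb t p) (comb u p)                         ≡⟨ dot-combˡ t p (comb u p) ⟩
  dot t (λ i → dot (p i) (comb u p))                ≡⟨ dot-congʳ t (λ i → trans (dot-combʳ u p (p i)) (dot-comm u _)) ⟩
  dot t (λ i → dot (λ j → dot (p i) (p j)) u)       ≡⟨ sym (bil-dot (λ i j → dot (p i) (p j)) t u) ⟩
  bil (λ i j → dot (p i) (p j)) t u ∎
  where open ≡-Reasoning

bil-+ : ∀ {k} (H K : Matℤ k k) p q → bil (λ i j → H i j + K i j) p q ≡ bil H p q + bil K p q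
bil-+ H K p q = trans
  (sumF-cong (λ i → trans (sumF-cong (λ j → d (p i) (H i j) (K i j) (q j)))
    (sumF-+ (λ j → p i * (H i j * q j)) (λ j → p i * (K i j * q j)))))
  (sumF-+ (λ i → sumF (λ j → p i * (H i j * q j))) (λ i → sumF (λ j → p i * (K i j * q j))))
  where
  d : ∀ p h k q → p * ((h + k) * q) ≡ p * (h * q) + p * (k * q)
  d = solve-∀

bil-* : ∀ {k} c (H : Matℤ k k) p q → bil (λ i j → c * H i j) p q ≡ c * bil H p q
bil-* c H p q = trans
  (sumF-cong (λ i → trans (sumF-cong (λ j → d c (p i) (H i j) (q j)))
    (sumF-*ˡ c (λ j → p i * (H i j * q j)))))
  (sumF-*ˡ c (λ i → sumF (λ j → p i * (H i j * q j))))
  where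
  d : ∀ c p h q → p * ((c * h) * q) ≡ c * (p * (h * q))
  d = solve-∀

unit : ∀ {n} → Fin n → Vecℤ n
unit zero    zero    = + 1
unit zero    (suc j) = + 0
unit (suc i) zero    = + 0
unit (suc i) (suc j) = unit i j

dot-unitˡ : ∀ {n} (i : Fin n) (x : Vecℤ n) → dot (unit i) x ≡ x i
dot-unitˡ {suc n} zero x =
  trans (cong₂ _+_ (*-identityˡ (x zero)) (trans (sumF-cong (λ j → *-zeroˡ (x (suc j)))) (sumF-0 {n})))
        (+-identityʳ (x zero))
dot-unitˡ {suc n} (suc i) x = trans (cong₂ _+_ (*-zeroˡ (x zero)) (dot-unitˡ i (λ j → x (suc j)))) (+-identityˡ _)

dot-unitʳ : ∀ {n} (x : Vecℤ n) (i : Fin n) → dot x (unit i) ≡ x i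
dot-unitʳ x i = trans (dot-comm x (unit i)) (dot-unitˡ i x)

-- Semidefinite integral forms and indecomposability

Symmetric : ∀ {n} → Matℤ n n → Set
Symmetric A = ∀ i j → A i j ≡ A j i

PSD : ∀ {n} → Matℤ n n → Set
PSD A = ∀ t → + 0 ≤ bil A t t

bil-unit : ∀ {n} (A : Matℤ n n) i j → bil A (unit i) (unit j) ≡ A i j
bil-unit A i j = trans (bil-dot A (unit i) (unit j))
  (trans (dot-unitˡ i (λ k → dot (A k) (unit j))) (dot-unitʳ (A i) j))

nonneg-* : ∀ {x y} → + 0 ≤ x → + 0 ≤ y → + 0 ≤ x * y
nonneg-* {+ x} {+ y} _ _ = subst (+ 0 ≤_) (pos-* x y) (+≤+ z≤n)
nonneg-* {+ x} { -[1+ y ] } _ ()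
nonneg-* { -[1+ x ] } ()

-- The right-hand side is the value of `A` at t + c eᵢ. Suitable choices of c give Cauchy-Schwarz
-- and the vanishing of null rows.
psd-line : ∀ {n} {A : Matℤ n n} → Symmetric A → PSD A → ∀ i t c →
  + 0 ≤ bil A t t + (+ 2 * c * dot (A i) t + c * c * A i i)
psd-line {n} {A} A-sym A-psd i t c = subst (+ 0 ≤_) expand (A-psd (comb co p))
  where
  open ≡-Reasoning
  p : Fin 2 → Vecℤ n
  p zero    = t
  p (suc _) = unit i
  co : Vecℤ 2
  co zero    = + 1
  co (suc _) = c
  te : bil A t (unit i) ≡ dot (A i) t
  te = trans (bil-dot A t (unit i)) (trans (dot-congʳ t (λ j → trans (dot-unitʳ (A j) i) (A-sym j i))) (dot-comm t (A i)))
  et : bil A (unit i) t ≡ dot (A i) t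
  et = trans (bil-dot A (unit i) t) (dot-unitˡ i (λ j → dot (A j) t))
  arith : ∀ α β γ → (+ 1 * (α * + 1) + (+ 1 * (β * c) + + 0)) + ((c * (β * + 1) + (c * (γ * c) + + 0)) + + 0)
        ≡ α + (+ 2 * c * β + c * c * γ)
  arith = ring c
    where
    ring : ∀ c α β γ → (+ 1 * (α * + 1) + (+ 1 * (β * c) + + 0)) + ((c * (β * + 1) + (c * (γ * c) + + 0)) + + 0)
        ≡ α + (+ 2 * c * β + c * c * γ)
    ring = solve-∀
  expand : bil A (comb co p) (comb co p) ≡ bil A t t + (+ 2 * c * dot (A i) t + c * c * A i i)
  expand = begin
    bil A (comb co p) (comb co p)             ≡⟨ bil-gram A p co co ⟩
    bil (λ i j → bil A (p i) (p j)) co co     ≡⟨ bil-congᴹ {H = λ i j → bil A (p i) (p j)} {K = K} co co gram ⟩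
    bil K co co                               ≡⟨ arith (bil A t t) (dot (A i) t) (A i i) ⟩
    bil A t t + (+ 2 * c * dot (A i) t + c * c * A i i) ∎
    where
    K : Matℤ 2 2
    K zero    zero    = bil A t t
    K zero    (suc _) = dot (A i) t
    K (suc _) zero    = dot (A i) t
    K (suc _) (suc _) = A i i
    gram : ∀ r s → bil A (p r) (p s) ≡ K r s
    gram zero    zero    = refl
    gram zero    (suc _) = te
    gram (suc _) zero    = et
    gram (suc _) (suc _) = bil-unit A i i

psd-diag : ∀ {n} (A : Matℤ n n) → PSD A → ∀ i → + 0 ≤ A i i
psd-diag A A-psd i = subst (+ 0 ≤_) (bil-unit A i i) (A-psd (unit i))

-- Cauchy-Schwarz for eᵢ and t. As `A i i` is 1, the minimising c = - `dot (A i) t` is an integer,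
-- so no denominators have to be cleared.
psd-unit-row : ∀ {n} {A : Matℤ n n} → Symmetric A → PSD A → ∀ i → A i i ≡ + 1 →
  ∀ t → dot (A i) t * dot (A i) t ≤ bil A t t
psd-unit-row {A = A} A-sym A-psd i Aii t =
  0≤i-j⇒j≤i (subst (+ 0 ≤_) e (psd-line A-sym A-psd i t (- d)))
  where
  d = dot (A i) t
  ring : ∀ β d → β + (+ 2 * - d * d + - d * - d * + 1) ≡ β - d * d
  ring = solve-∀
  e : bil A t t + (+ 2 * - d * d + - d * - d * A i i) ≡ bil A t t - d * d
  e rewrite Aii = ring (bil A t t) d

0<i*i : ∀ {i} → i ≢ + 0 → + 1 ≤ i * i
0<i*i {i} i≢0 = i<j⇒suc[i]≤j (≤∧≢⇒< (0≤i*i i) (λ e → i≢0 (i*i≡0⇒i≡0 i (sym e))))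

-- On a null vector eᵢ, q(eⱼ + c eᵢ) = q(eⱼ) + 2c Aᵢⱼ is affine in c, hence constant.
psd-null-row : ∀ {n} {A : Matℤ n n} → Symmetric A → PSD A → ∀ i → A i i ≡ + 0 → ∀ j → A i j ≡ + 0
psd-null-row {A = A} A-sym A-psd i Aii j with A i j ≟ + 0
... | yes e = e
-- At c = -α (q + 1) the value is q - 2 α² (q + 1) ≤ -(q + 2), because α² ≥ 1.
... | no ne = ⊥-elim (<⇒≱ below (subst (+ 0 ≤_) e (psd-line A-sym A-psd i (unit j) (- (α * (q + + 1))))))
  where
  α = A i j
  q = A j j
  q≥0 : + 0 ≤ q
  q≥0 = psd-diag A A-psd j
  ring : ∀ q α c → q + (+ 2 * - (α * (q + + 1)) * α + c * + 0) ≡ (q - + 2 * (q + + 1)) - + 2 * ((α * α - + 1) * (q + + 1))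
  ring = solve-∀
  e : bil A (unit j) (unit j) + (+ 2 * - (α * (q + + 1)) * dot (A i) (unit j) + - (α * (q + + 1)) * - (α * (q + + 1)) * A i i)
    ≡ (q - + 2 * (q + + 1)) - + 2 * ((α * α - + 1) * (q + + 1))
  e rewrite bil-unit A j j | dot-unitʳ (A i) j | Aii = ring q α (- (α * (q + + 1)) * - (α * (q + + 1)))
  tail≥0 : + 0 ≤ + 2 * ((α * α - + 1) * (q + + 1))
  tail≥0 = nonneg-* {+ 2} (+≤+ z≤n) (nonneg-* (i≤j⇒0≤j-i (0<i*i ne)) (+-mono-≤ q≥0 (+≤+ {0} {1} z≤n)))
  ring₂ : ∀ q → q - + 2 * (q + + 1) ≡ - (q + + 2)
  ring₂ = solve-∀
  head<0 : q - + 2 * (q + + 1) < + 0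
  head<0 = subst (_< + 0) (sym (ring₂ q)) (neg-mono-< {+ 0} (+-mono-≤-< q≥0 (+<+ {0} {2} (s≤s z≤n))))
  below : (q - + 2 * (q + + 1)) - + 2 * ((α * α - + 1) * (q + + 1)) < + 0
  below = +-mono-<-≤ head<0 (neg-mono-≤ tail≥0)

-- A functional z has norm at most c in the dual lattice iff (z · t)² ≤ c (t , t) for all t.
DualMin>1 : ∀ {n} → Matℤ n n → Set
DualMin>1 {n} F = ∀ (z : Vecℤ n) → (∀ t → dot z t * dot z t ≤ bil F t t) → ∀ i → z i ≡ + 0

Connected : ∀ {n} → Matℤ n n → Set₁
Connected {n} F = ∀ (P : Fin n → Set) → (∀ i j → F i j ≢ + 0 → P i → P j) → ∀ i j → P i → P j

module _ {n} (F : Matℤ n n) (dual : DualMin>1 F)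
         (diag : ∀ i → F i i ≡ + 2 ⊎ F i i ≡ + 3) (conn : Connected F) (i₀ : Fin n) where

  private
    diag≢1 : ∀ {A N : Matℤ n n} → Symmetric A → PSD A → PSD N → (∀ i j → A i j + N i j ≡ F i j) →
      ∀ i → A i i ≢ + 1
    diag≢1 {A} {N} A-sym A-psd N-psd sum i Aii = 0≢1 (trans (sym (dual (A i) bound i)) Aii)
      where
      0≢1 : + 0 ≢ + 1
      0≢1 ()
      bound : ∀ t → dot (A i) t * dot (A i) t ≤ bil F t t
      bound t = ≤-trans (psd-unit-row A-sym A-psd i Aii t)
        (≤-trans (≤-trans (≤-reflexive (sym (+-identityʳ _))) (+-monoʳ-≤ (bil A t t) (N-psd t)))
                 (≤-reflexive (trans (sym (bil-+ A N t t)) (bil-congᴹ t t sum))))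

    -- With 1 excluded, two nonzero summands are both at least 2, and their sum exceeds 3.
    small-sum : ∀ {x y} → + 0 ≤ x → + 0 ≤ y → x ≢ + 1 → y ≢ + 1 → x + y ≡ + 2 ⊎ x + y ≡ + 3 → x ≡ + 0 ⊎ y ≡ + 0
    small-sum {+ 0} _ _ _ _ _ = inj₁ refl
    small-sum {+ 1} _ _ x≢1 _ _ = ⊥-elim (x≢1 refl)
    small-sum {+ suc (suc x)} {+ 0} _ _ _ _ _ = inj₂ refl
    small-sum {+ suc (suc x)} {+ 1} _ _ _ y≢1 _ = ⊥-elim (y≢1 refl)
    small-sum {+ suc (suc x)} {+ suc (suc y)} _ _ _ _ (inj₁ e) = ⊥-elim (big x y e)
      where
      big : ∀ x y → + suc (suc x) + + suc (suc y) ≢ + 2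
      big zero    y ()
      big (suc x) y ()
    small-sum {+ suc (suc x)} {+ suc (suc y)} _ _ _ _ (inj₂ e) = ⊥-elim (big x y e)
      where
      big : ∀ x y → + suc (suc x) + + suc (suc y) ≢ + 3
      big zero          y ()
      big (suc zero)    y ()
      big (suc (suc x)) y ()
    small-sum { -[1+ _ ] } () _ _ _ _

    -- If N j j were 0 at a neighbour j of i, the null rows of A at i and of N at j would give A i j
    -- = N i j = 0, against F i j ≢ 0. So the vanishing of A passes along every edge.
    spread : ∀ {A N : Matℤ n n} → Symmetric A → PSD A → Symmetric N → PSD N → (∀ i j → A i j + N i j ≡ F i j) →
      (∀ i → A i i ≡ + 0 ⊎ N i i ≡ + 0) → ∀ i j → A i i ≡ + 0 → A j j ≡ + 0
    spread {A} {N} A-sym A-psd N-sym N-psd sum alt = conn (λ i → A i i ≡ + 0) step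
      where
      step : ∀ i j → F i j ≢ + 0 → A i i ≡ + 0 → A j j ≡ + 0
      step i j Fij Aii with alt j
      ... | inj₁ Ajj = Ajj
      ... | inj₂ Njj = ⊥-elim (Fij (trans (sym (sum i j))
              (cong₂ _+_ (psd-null-row A-sym A-psd i Aii j)
                         (trans (N-sym i j) (psd-null-row N-sym N-psd j Njj i)))))

  indecomposable : ∀ {A N : Matℤ n n} → Symmetric A → PSD A → Symmetric N → PSD N →
    (∀ i j → A i j + N i j ≡ F i j) → (∀ i → A i i ≡ + 0) ⊎ (∀ i → N i i ≡ + 0)
  indecomposable {A} {N} A-sym A-psd N-sym N-psd sum = decide (alt i₀)
    where
    sum' : ∀ i j → N i j + A i j ≡ F i j
    sum' i j = trans (+-comm (N i j) (A i j)) (sum i j)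
    alt : ∀ i → A i i ≡ + 0 ⊎ N i i ≡ + 0
    alt i = small-sum (psd-diag A A-psd i) (psd-diag N N-psd i)
      (diag≢1 A-sym A-psd N-psd sum i) (diag≢1 N-sym N-psd A-psd sum' i)
      (subst (λ f → f ≡ + 2 ⊎ f ≡ + 3) (sym (sum i i)) (diag i))
    alt' : ∀ i → N i i ≡ + 0 ⊎ A i i ≡ + 0
    alt' i with alt i
    ... | inj₁ p = inj₂ p
    ... | inj₂ p = inj₁ p
    decide : A i₀ i₀ ≡ + 0 ⊎ N i₀ i₀ ≡ + 0 → (∀ i → A i i ≡ + 0) ⊎ (∀ i → N i i ≡ + 0)
    decide (inj₁ p) = inj₁ (λ i → spread A-sym A-psd N-sym N-psd sum alt i₀ i p)
    decide (inj₂ p) = inj₂ (λ i → spread N-sym N-psd A-sym A-psd sum' alt' i₀ i p)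

-- Gram matrices and dual norms in a form fit for evaluation

-- The enumeration below is evaluated during type checking, so its vectors are first-order data;
-- `vdot-dot` and `quad-bil` connect them with the functional vectors of the statement.
vdot : ∀ {n} → Vec ℤ n → Vec ℤ n → ℤ
vdot []       []       = + 0
vdot (x ∷ xs) (y ∷ ys) = x * y + vdot xs ys

vdot-dot : ∀ {n} (x y : Vec ℤ n) → vdot x y ≡ dot (lookup x) (lookup y)
vdot-dot []       []       = refl
vdot-dot (x ∷ xs) (y ∷ ys) = cong (λ z → x * y + z) (vdot-dot xs ys)

-- A symmetric matrix, given by its diagonal and the parts of its rows to the right of the diagonal.
data Gram : ℕ → Set where
  []  : Gram 0
  row : ∀ {n} → ℤ → Vec ℤ n → Gram n → Gram (suc n)

matrix : ∀ {n} → Gram n → Matℤ n n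
matrix (row a r G) zero    zero    = a
matrix (row a r G) zero    (suc j) = lookup r j
matrix (row a r G) (suc i) zero    = lookup r i
matrix (row a r G) (suc i) (suc j) = matrix G i j

matrix-sym : ∀ {n} (G : Gram n) → Symmetric (matrix G)
matrix-sym (row a r G) zero    zero    = refl
matrix-sym (row a r G) zero    (suc j) = refl
matrix-sym (row a r G) (suc i) zero    = refl
matrix-sym (row a r G) (suc i) (suc j) = matrix-sym G i j

quad : ∀ {n} → Gram n → Vec ℤ n → ℤ
quad []          []      = + 0
quad (row a r G) (x ∷ t) = x * (a * x + + 2 * vdot r t) + quad G t

quad-bil : ∀ {n} (G : Gram n) (t : Vec ℤ n) → quad G t ≡ bil (matrix G) (lookup t) (lookup t)
quad-bil []          []      = refl
quad-bil {suc n} (row a r G) (x ∷ t) = begin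
  x * (a * x + + 2 * vdot r t) + quad G t
    ≡⟨ cong₂ (λ d q → x * (a * x + + 2 * d) + q) (vdot-dot r t) (quad-bil G t) ⟩
  x * (a * x + + 2 * d) + bil M t' t'
    ≡⟨ ring x a d (bil M t' t') ⟩
  x * (a * x + d) + (x * d + bil M t' t')
    ≡⟨ cong₂ (λ u v → x * (a * x + d) + (u + v)) left (bil-dot M t' t') ⟩
  x * (a * x + d) + (sumF (λ i → t' i * (r' i * x)) + dot t' (λ i → dot (M i) t'))
    ≡⟨ cong (λ z → x * (a * x + d) + z) (sym (trans
         (sumF-cong (λ i → *-distribˡ-+ (t' i) (r' i * x) (dot (M i) t')))
         (sumF-+ (λ i → t' i * (r' i * x)) (λ i → t' i * dot (M i) t')))) ⟩
  x * (a * x + d) + sumF (λ i → t' i * (r' i * x + dot (M i) t'))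
    ≡⟨ sym (bil-dot (matrix (row a r G)) (lookup (x ∷ t)) (lookup (x ∷ t))) ⟩
  bil (matrix (row a r G)) (lookup (x ∷ t)) (lookup (x ∷ t)) ∎
  where
  open ≡-Reasoning
  t' r' : Vecℤ n
  t' = lookup t
  r' = lookup r
  M = matrix G
  d = dot r' t'
  ring : ∀ x a d b → x * (a * x + + 2 * d) + b ≡ x * (a * x + d) + (x * d + b)
  ring = solve-∀
  ring₂ : ∀ x r t → x * (r * t) ≡ t * (r * x)
  ring₂ = solve-∀
  left : x * d ≡ sumF (λ i → t' i * (r' i * x))
  left = trans (sym (sumF-*ˡ x (λ i → r' i * t' i))) (sumF-cong (λ i → ring₂ x (r' i) (t' i)))

mul : ∀ {n} → Gram n → Vec ℤ n → Vec ℤ n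
mul []          []      = []
mul (row a r G) (x ∷ t) = (a * x + vdot r t) ∷ zipWith (λ p q → x * p + q) r (mul G t)

axpy : ∀ {n} → ℤ → Vec ℤ n → Vec ℤ n → Vec ℤ n
axpy c = zipWith (λ p q → c * p + q)

vdot-axpyˡ : ∀ {n} c (u v z : Vec ℤ n) → vdot (axpy c u v) z ≡ c * vdot u z + vdot v z
vdot-axpyˡ c [] [] [] = sym (trans (+-identityʳ (c * + 0)) (*-zeroʳ c))
vdot-axpyˡ c (x ∷ u) (y ∷ v) (w ∷ z) rewrite vdot-axpyˡ c u v z = ring c x y w (vdot u z) (vdot v z)
  where
  ring : ∀ c x y w p q → (c * x + y) * w + (c * p + q) ≡ c * (x * w + p) + (y * w + q)
  ring = solve-∀

vdot-axpyʳ : ∀ {n} c (u v z : Vec ℤ n) → vdot z (axpy c u v) ≡ c * vdot z u + vdot z v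
vdot-axpyʳ c [] [] [] = sym (trans (+-identityʳ (c * + 0)) (*-zeroʳ c))
vdot-axpyʳ c (x ∷ u) (y ∷ v) (w ∷ z) rewrite vdot-axpyʳ c u v z = ring c x y w (vdot z u) (vdot z v)
  where
  ring : ∀ c x y w p q → w * (c * x + y) + (c * p + q) ≡ c * (w * x + p) + (w * y + q)
  ring = solve-∀

-- Polarisation: `vdot (mul G u) v` is the inner product of u and v.
quad-axpy : ∀ {n} (G : Gram n) c u v →
  quad G (axpy c u v) ≡ c * c * quad G u + (+ 2 * c * vdot (mul G u) v + quad G v)
quad-axpy [] c [] [] = sym (ring c)
  where
  ring : ∀ c → c * c * + 0 + (+ 2 * c * + 0 + + 0) ≡ + 0
  ring = solve-∀
quad-axpy (row a r G) c (x ∷ u) (y ∷ v)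
  rewrite vdot-axpyʳ c u v r | quad-axpy G c u v | vdot-axpyˡ x r (mul G u) v =
  ring a c x y (vdot r u) (vdot r v) (vdot (mul G u) v) (quad G u) (quad G v)
  where
  ring : ∀ a c x y p q m k l →
    (c * x + y) * (a * (c * x + y) + + 2 * (c * p + q)) + (c * c * k + (+ 2 * c * m + l))
    ≡ c * c * (x * (a * x + + 2 * p) + k) + (+ 2 * c * ((a * x + p) * y + (x * q + m)) + (y * (a * y + + 2 * q) + l))
  ring = solve-∀

-- Vectors gₙ₋₁, …, g₀ with weights mᵢ, where gᵢ lies in the span of the last i+1 basis vectors.
data Frame : ℕ → Set where
  []  : Frame 0
  row : ∀ {n} → ℤ → Vec ℤ (suc n) → Frame n → Frame (suc n)

-- Each gᵢ is orthogonal to the later basis vectors, hence to the later gⱼ.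
Orthogonal : ∀ {n} → ℤ → Gram n → Frame n → Set
Orthogonal K []          []          = ⊤
Orthogonal K (row a r G) (row m g f) =
  tail (mul (row a r G) g) ≡ replicate _ (+ 0) × m * quad (row a r G) g ≡ K × Orthogonal K G f

-- K times the vector representing the functional z, by its Fourier expansion in the frame.
represent : ∀ {n} → Frame n → Vec ℤ n → Vec ℤ n
represent []          []      = []
represent (row m g f) (x ∷ z) = axpy (m * vdot g (x ∷ z)) g (+ 0 ∷ represent f z)

-- For an orthogonal frame this is K times the norm of z in the dual lattice. The square belonging
-- to a row involves only the entries of z from that row on.
energy : ∀ {n} → Frame n → Vec ℤ n → ℤ
energy []          []      = + 0
energy (row m g f) (x ∷ z) = m * (vdot g (x ∷ z) * vdot g (x ∷ z)) + energy f z

vdot-represent : ∀ {n} (f : Frame n) z → vdot (represent f z) z ≡ energy f z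
vdot-represent []          []      = refl
vdot-represent (row m g f) (x ∷ z) = begin
  vdot (axpy (m * d) g (+ 0 ∷ represent f z)) (x ∷ z)  ≡⟨ vdot-axpyˡ (m * d) g (+ 0 ∷ represent f z) (x ∷ z) ⟩
  m * d * d + (+ 0 * x + vdot (represent f z) z)       ≡⟨ cong (λ e → m * d * d + (+ 0 * x + e)) (vdot-represent f z) ⟩
  m * d * d + (+ 0 * x + energy f z)                   ≡⟨ ring m d x (energy f z) ⟩
  m * (d * d) + energy f z ∎
  where
  open ≡-Reasoning
  d = vdot g (x ∷ z)
  ring : ∀ m d x e → m * d * d + (+ 0 * x + e) ≡ m * (d * d) + e
  ring = solve-∀

vdot-0ˡ : ∀ {n} (v : Vec ℤ n) → vdot (replicate n (+ 0)) v ≡ + 0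
vdot-0ˡ []      = refl
vdot-0ˡ (x ∷ v) = trans (cong₂ _+_ (*-zeroˡ x) (vdot-0ˡ v)) refl

quad-represent : ∀ {n} K (G : Gram n) (f : Frame n) → Orthogonal K G f → ∀ z →
  quad G (represent f z) ≡ K * energy f z
quad-represent K []          []          _                  []      = sym (*-zeroʳ K)
quad-represent K (row a r G) (row m g f) (orth , norm , os) (x ∷ z) = begin
  quad G⁺ (axpy (m * d) g (+ 0 ∷ t))
    ≡⟨ quad-axpy G⁺ (m * d) g (+ 0 ∷ t) ⟩
  m * d * (m * d) * quad G⁺ g + (+ 2 * (m * d) * vdot (mul G⁺ g) (+ 0 ∷ t) + quad G⁺ (+ 0 ∷ t))
    ≡⟨ cong₂ (λ p q → m * d * (m * d) * quad G⁺ g + (+ 2 * (m * d) * p + (+ 0 * (a * + 0 + + 2 * vdot r t) + q))) perp (quad-represent K G f os z) ⟩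
  m * d * (m * d) * quad G⁺ g + (+ 2 * (m * d) * + 0 + (+ 0 * (a * + 0 + + 2 * vdot r t) + K * energy f z))
    ≡⟨ ring₁ m d (quad G⁺ g) (a * + 0 + + 2 * vdot r t) (K * energy f z) ⟩
  m * quad G⁺ g * (m * (d * d)) + K * energy f z
    ≡⟨ cong (λ k → k * (m * (d * d)) + K * energy f z) norm ⟩
  K * (m * (d * d)) + K * energy f z
    ≡⟨ sym (*-distribˡ-+ K _ _) ⟩
  K * (m * (d * d) + energy f z) ∎
  where
  open ≡-Reasoning
  G⁺ = row a r G
  d = vdot g (x ∷ z)
  t = represent f z
  ring₁ : ∀ m d q s e → m * d * (m * d) * q + (+ 2 * (m * d) * + 0 + (+ 0 * s + e)) ≡ m * q * (m * (d * d)) + e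
  ring₁ = solve-∀
  vdot-tail : ∀ {n} (u : Vec ℤ (suc n)) v → vdot u (+ 0 ∷ v) ≡ vdot (tail u) v
  vdot-tail (y ∷ u) v = trans (cong (λ p → p + vdot u v) (*-zeroʳ y)) (+-identityˡ _)
  perp : vdot (mul G⁺ g) (+ 0 ∷ t) ≡ + 0
  perp = trans (vdot-tail (mul G⁺ g) t) (trans (cong (λ u → vdot u t) orth) (vdot-0ˡ t))

-- Enumeration of the short dual vectors

Bounded : ∀ {n} → ℤ → Gram n → Vec ℤ n → Set
Bounded c G z = ∀ t → vdot t z * vdot t z ≤ c * quad G t

bounded-tail : ∀ {n} c a r (G : Gram n) x z → Bounded c (row a r G) (x ∷ z) → Bounded c G z
bounded-tail c a r G x z b t = subst₂ _≤_ (cong₂ _*_ e e) (cong (c *_) (+-identityˡ (quad G t))) (b (+ 0 ∷ t))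
  where
  e : + 0 * x + vdot t z ≡ vdot t z
  e = +-identityˡ (vdot t z)

bounded-head : ∀ {n} c a r (G : Gram n) x z → Bounded c (row a r G) (x ∷ z) → x * x ≤ c * a
bounded-head {n} c a r G x z b = subst₂ _≤_ (cong₂ _*_ e e) (cong (c *_) q) (b (+ 1 ∷ replicate n (+ 0)))
  where
  e : + 1 * x + vdot (replicate n (+ 0)) z ≡ x
  e = trans (cong₂ _+_ (*-identityˡ x) (vdot-0ˡ z)) (+-identityʳ x)
  vdot-0ʳ : ∀ {n} (v : Vec ℤ n) → vdot v (replicate n (+ 0)) ≡ + 0
  vdot-0ʳ []      = refl
  vdot-0ʳ (x ∷ v) = trans (cong₂ _+_ (*-zeroʳ x) (vdot-0ʳ v)) refl
  quad-0 : ∀ {n} (G : Gram n) → quad G (replicate n (+ 0)) ≡ + 0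
  quad-0 []          = refl
  quad-0 (row a r G) = trans (cong₂ _+_ (*-zeroˡ (a * + 0 + + 2 * vdot r (replicate _ (+ 0)))) (quad-0 G)) refl
  ring : ∀ a → + 1 * (a * + 1 + + 2 * + 0) + + 0 ≡ a
  ring = solve-∀
  q : quad (row a r G) (+ 1 ∷ replicate n (+ 0)) ≡ a
  q = trans (cong₂ (λ u v → + 1 * (a * + 1 + + 2 * u) + v) (vdot-0ʳ r) (quad-0 G)) (ring a)

-- Bessel's inequality, obtained by testing z on the vector that represents it.
energy≤ : ∀ {n} c K (G : Gram n) (f : Frame n) → Orthogonal K G f → + 0 ≤ c * K → ∀ z → Bounded c G z →
  energy f z ≤ c * K
energy≤ c K G f os 0≤cK z b = ≮⇒≥ λ cK<E →
  <⇒≱ (*-monoʳ-<-pos E {{positive (≤-<-trans 0≤cK cK<E)}} cK<E) (subst₂ _≤_ e₁ e₂ (b (represent f z)))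
  where
  E = energy f z
  e₁ : vdot (represent f z) z * vdot (represent f z) z ≡ E * E
  e₁ = cong₂ _*_ (vdot-represent f z) (vdot-represent f z)
  e₂ : c * quad G (represent f z) ≡ c * K * E
  e₂ = trans (cong (c *_) (quad-represent K G f os z)) (sym (*-assoc c K E))

-- Testing a functional of norm at most 2 on a basis vector of norm a ≤ 3 gives x² ≤ 2 a ≤ 6, so |x|
-- ≤ 2.
range : List ℤ
range = -[1+ 1 ] ∷ -[1+ 0 ] ∷ + 0 ∷ + 1 ∷ + 2 ∷ []

∈-range : ∀ x → x * x ≤ + 8 → x ∈ range
∈-range (+ 0) _ = there (there (here refl))
∈-range (+ 1) _ = there (there (there (here refl)))
∈-range (+ 2) _ = there (there (there (there (here refl))))
∈-range (+ suc (suc (suc n))) (+≤+ le) = ⊥-elim (ℕ.<⇒≱ (ℕ.*-mono-≤ (3≤ n) (3≤ n)) le)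
  where
  3≤ : ∀ n → 3 ℕ.≤ suc (suc (suc n))
  3≤ n = s≤s (s≤s (s≤s z≤n))
∈-range -[1+ 0 ] _ = there (here refl)
∈-range -[1+ 1 ] _ = here refl
∈-range -[1+ suc (suc n) ] (+≤+ le) = ⊥-elim (ℕ.<⇒≱ (ℕ.*-mono-≤ (3≤ n) (3≤ n)) le)
  where
  3≤ : ∀ n → 3 ℕ.≤ suc (suc (suc n))
  3≤ n = s≤s (s≤s (s≤s z≤n))

sq : ℤ → ℤ
sq d = d * d

-- A cut branch counts as passed, since no functional to be checked has energy above B.
guard : ℤ → (ℤ → Bool) → ℤ → Bool
guard B k e = if e ≤ᵇ B then k e else true

-- Fincke-Pohst enumeration with a continuation: the last entries are chosen first, and e carries
-- the energy of the suffix z. Cutting at a suffix loses nothing, because every suffix of a bounded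
-- functional is bounded for the smaller Gram matrix (`bounded-tail`) and hence has energy at most
-- B.
search : ∀ {n} → ℤ → Frame n → (Vec ℤ n → ℤ → Bool) → Bool
search B []          k = k [] (+ 0)
search B (row m g f) k =
  search B f (λ z e → all (λ x → guard B (k (x ∷ z)) (m * sq (vdot g (x ∷ z)) + e)) range)

SmallDiagonal : ∀ {n} → Gram n → Set
SmallDiagonal []          = ⊤
SmallDiagonal (row a r G) = (a ≡ + 2 ⊎ a ≡ + 3) × SmallDiagonal G

smallDiagonal : ∀ {n} (G : Gram n) → SmallDiagonal G → ∀ i → matrix G i i ≡ + 2 ⊎ matrix G i i ≡ + 3
smallDiagonal (row a r G) (p , ps) zero    = p
smallDiagonal (row a r G) (p , ps) (suc i) = smallDiagonal G ps i

guard-sound : ∀ B k e → T (guard B k e) → e ≤ B → T (k e)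
guard-sound B k e t e≤B with e ≤ᵇ B | ≤⇒≤ᵇ e≤B
... | true | _ = t

search-sound : ∀ {n} K (G : Gram n) (f : Frame n) k → + 0 ≤ + 2 * K → Orthogonal K G f → SmallDiagonal G →
  T (search (+ 2 * K) f k) → ∀ z → Bounded (+ 2) G z → T (k z (energy f z))
search-sound K []          []          k _   _  _        t []      _ = t
search-sound K (row a r G) (row m g f) k pos os (d , ds) t (x ∷ z) b =
  guard-sound (+ 2 * K) (k (x ∷ z)) _
    (All.lookup (all⁺ test range (search-sound K G f _ pos (proj₂ (proj₂ os)) ds t z (bounded-tail (+ 2) a r G x z b)))
                (∈-range x (≤-trans (bounded-head (+ 2) a r G x z b) (2a≤8 d))))
    (energy≤ (+ 2) K (row a r G) (row m g f) os pos (x ∷ z) b)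
  where
  test : ℤ → Bool
  test y = guard (+ 2 * K) (k (y ∷ z)) (m * sq (vdot g (y ∷ z)) + energy f z)
  2a≤8 : a ≡ + 2 ⊎ a ≡ + 3 → + 2 * a ≤ + 8
  2a≤8 (inj₁ refl) = +≤+ (s≤s (s≤s (s≤s (s≤s z≤n))))
  2a≤8 (inj₂ refl) = +≤+ (s≤s (s≤s (s≤s (s≤s (s≤s (s≤s z≤n))))))

-- Certificates against sums of squares

Form : ℕ → Set
Form n = List (ℤ × Vec ℤ n × Vec ℤ n)

eval : ∀ {n} → Form n → Vec ℤ n → ℤ
eval []                z = + 0
eval ((c , u , v) ∷ Q) z = c * (vdot u z * vdot v z) + eval Q z

-- The pairing of a form on functionals with the Gram matrix. For every family with Σ φₖ φₖ = 2 ( ,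
-- ) the values of the form add up to twice this number (`sum-eval`).
trace : ∀ {n} → Gram n → Form n → ℤ
trace G []                = + 0
trace G ((c , u , v) ∷ Q) = c * bil (matrix G) (lookup u) (lookup v) + trace G Q

isZero : ∀ {n} → Vec ℤ n → Bool
isZero []          = true
isZero (+ 0 ∷ z)   = isZero z
isZero (_ ∷ z)     = false

isZero-sound : ∀ {n} (z : Vec ℤ n) → T (isZero z) → ∀ i → lookup z i ≡ + 0
isZero-sound (+ 0 ∷ z) t zero    = refl
isZero-sound (+ 0 ∷ z) t (suc i) = isZero-sound z t i
isZero-sound (+ suc _ ∷ z) ()
isZero-sound (-[1+ _ ] ∷ z) ()

verdict : ℤ → ℤ → List ℤ → Bool
verdict b q ds = all (+ 0 ≤ᵇ_) ds ∧ (if all (_≤ᵇ b) ds then q ≤ᵇ + 0 else true)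

leaf : ∀ {n} → ℤ → ℤ → List (Form n) → Form n → Vec ℤ n → ℤ → Bool
leaf K b Ds Q z e =
  (if e ≤ᵇ K then isZero z else true) ∧ verdict b (eval Q z) (map (λ D → eval D z) Ds)

-- Let φ₁, …, φₘ be functionals with Σ φₖ(x) φₖ(y) = 2 (x , y); each has norm at most 2.  The search runs over
-- all functionals of norm at most 2 and checks that 0 is the only one of norm at most 1, that every D in Ds is
-- nonnegative, and that Q is nonpositive where all D are at most bound.  As Σ D(φₖ) = 2 trace D = bound, every φₖ has
-- D(φₖ) ≤ bound, so Σ Q(φₖ) ≤ 0, against Σ Q(φₖ) = 2 trace Q > 0.
record Certificate {n} (G : Gram (suc n)) : Set₁ where
  field
    K          : ℤ
    K≥0        : + 0 ≤ K
    frame      : Frame (suc n)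
    orthogonal : Orthogonal K G frame
    diagonal   : SmallDiagonal G
    connected  : Connected (matrix G)
    bound      : ℤ
    Ds         : List (Form (suc n))
    Q          : Form (suc n)
    trace-Ds   : All (λ D → + 2 * trace G D ≡ bound) Ds
    trace-Q    : + 0 < + 2 * trace G Q
    searched   : T (search (+ 2 * K) frame (leaf K bound Ds Q))

T-if : ∀ b c → T (if b then c else true) → T b → T c
T-if true c t _ = t

module _ {n} (G : Gram (suc n)) (cert : Certificate G) where
  open Certificate cert

  private
    F = matrix G

    0≤2K : + 0 ≤ + 2 * K
    0≤2K = nonneg-* {+ 2} (+≤+ z≤n) K≥0

    visited : ∀ z → Bounded (+ 2) G z → T (leaf K bound Ds Q z (energy frame z))
    visited = search-sound K G frame (leaf K bound Ds Q) 0≤2K orthogonal diagonal searched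

    split : ∀ {x y} → T (x ∧ y) → T x × T y
    split = Equivalence.to T-∧

    values : Vec ℤ (suc n) → List ℤ
    values z = map (λ D → eval D z) Ds

    verdicts : ∀ z → Bounded (+ 2) G z →
      T (all (+ 0 ≤ᵇ_) (values z)) × T (if all (_≤ᵇ bound) (values z) then eval Q z ≤ᵇ + 0 else true)
    verdicts z bz = split (proj₂ (split {if energy frame z ≤ᵇ K then isZero z else true} (visited z bz)))

    forms-nonneg : ∀ z → Bounded (+ 2) G z → ∀ {D} → D ∈ Ds → + 0 ≤ eval D z
    forms-nonneg z bz D∈ = ≤ᵇ⇒≤ (All.lookup (map⁻ (all⁺ (+ 0 ≤ᵇ_) (values z) (proj₁ (verdicts z bz)))) D∈)

    Q-nonpos : ∀ z → Bounded (+ 2) G z → (∀ {D} → D ∈ Ds → eval D z ≤ bound) → eval Q z ≤ + 0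
    Q-nonpos z bz le = ≤ᵇ⇒≤ (T-if (all (_≤ᵇ bound) (values z)) _ (proj₂ (verdicts z bz))
      (all⁻ (_≤ᵇ bound) (map⁺ (All.tabulate (λ D∈ → ≤⇒≤ᵇ (le D∈))))))

    vec-bound : ∀ c (z : Vecℤ (suc n)) → (∀ t → dot z t * dot z t ≤ c * bil F t t) → Bounded c G (tabulate z)
    vec-bound c z h t = subst₂ _≤_ (cong₂ _*_ e e) (cong (c *_) (sym (quad-bil G t))) (h (lookup t))
      where
      e : dot z (lookup t) ≡ vdot t (tabulate z)
      e = sym (trans (vdot-dot t (tabulate z)) (trans (dot-comm (lookup t) (lookup (tabulate z)))
            (dot-congˡ (lookup t) (lookup∘tabulate z))))

    dualMin : DualMin>1 F
    dualMin z h i = trans (sym (lookup∘tabulate z i)) (isZero-sound z' (T-if (energy frame z' ≤ᵇ K) _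
        (proj₁ (split (visited z' (λ t → ≤-trans (b₁ t) (dbl t)))))
        (≤⇒≤ᵇ (subst (energy frame z' ≤_) (*-identityˡ K)
          (energy≤ (+ 1) K G frame orthogonal (subst (+ 0 ≤_) (sym (*-identityˡ K)) K≥0) z' b₁)))) i)
      where
      z' = tabulate z
      b₁ : Bounded (+ 1) G z'
      b₁ = vec-bound (+ 1) z (λ t → subst (_ ≤_) (sym (*-identityˡ (bil F t t))) (h t))
      dbl : ∀ t → + 1 * quad G t ≤ + 2 * quad G t
      -- Nonnegativity of `quad G t` is read off from the bound itself: it is at least the square of
      -- `vdot t z'`.
      dbl t = subst₂ _≤_ (+-identityʳ _) (ring (quad G t))
        (+-monoʳ-≤ (+ 1 * quad G t) (subst (+ 0 ≤_) (*-identityˡ (quad G t)) (≤-trans (0≤i*i (vdot t z')) (b₁ t))))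
        where
        ring : ∀ q → + 1 * q + q ≡ + 2 * q
        ring = solve-∀

  module _ {m} (φ : Matℤ m (suc n)) (star : ∀ i j → sumF (λ k → φ k i * φ k j) ≡ + 2 * F i j) where
    private
      star-bil : ∀ u v → sumF (λ k → dot u (φ k) * dot v (φ k)) ≡ + 2 * bil F u v
      star-bil u v = trans (dot-gram (λ i k → φ k i) u v) (trans (bil-congᴹ u v star) (bil-* (+ 2) F u v))

      z : Fin m → Vec ℤ (suc n)
      z k = tabulate (φ k)

      vdot-z : ∀ u k → vdot u (z k) ≡ dot (lookup u) (φ k)
      vdot-z u k = trans (vdot-dot u (z k)) (dot-congʳ (lookup u) (lookup∘tabulate (φ k)))

      -- φₖ(t)² is one term of Σ φₖ(t)² = 2 (t , t). This is what brings the unknown functionals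
      -- into the reach of the search.
      z-bounded : ∀ k → Bounded (+ 2) G (z k)
      z-bounded k = vec-bound (+ 2) (φ k) λ t → subst₂ _≤_ (cong₂ _*_ (dot-comm t (φ k)) (dot-comm t (φ k))) (star-bil t t)
        (term≤sumF (λ k → dot t (φ k) * dot t (φ k)) (λ k → 0≤i*i (dot t (φ k))) k)

      sum-eval : ∀ E → sumF (λ k → eval E (z k)) ≡ + 2 * trace G E
      sum-eval []                = sumF-0 {m}
      sum-eval ((c , u , v) ∷ E) = begin
        sumF (λ k → c * (vdot u (z k) * vdot v (z k)) + eval E (z k))
          ≡⟨ sumF-+ (λ k → c * (vdot u (z k) * vdot v (z k))) (λ k → eval E (z k)) ⟩
        sumF (λ k → c * (vdot u (z k) * vdot v (z k))) + sumF (λ k → eval E (z k))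
          ≡⟨ cong₂ _+_ (trans (sumF-*ˡ c (λ k → vdot u (z k) * vdot v (z k)))
               (cong (c *_) (trans (sumF-cong (λ k → cong₂ _*_ (vdot-z u k) (vdot-z v k))) (star-bil (lookup u) (lookup v)))))
               (sum-eval E) ⟩
        c * (+ 2 * bil F (lookup u) (lookup v)) + + 2 * trace G E
          ≡⟨ ring c (bil F (lookup u) (lookup v)) (trace G E) ⟩
        + 2 * (c * bil F (lookup u) (lookup v) + trace G E) ∎
        where
        open ≡-Reasoning
        ring : ∀ c q t → c * (+ 2 * q) + + 2 * t ≡ + 2 * (c * q + t)
        ring = solve-∀

      forms-bounded : ∀ k {D} → D ∈ Ds → eval D (z k) ≤ bound
      forms-bounded k {D} D∈ = ≤-trans
        (term≤sumF (λ k → eval D (z k)) (λ k → forms-nonneg (z k) (z-bounded k) D∈) k)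
        (≤-reflexive (trans (sum-eval D) (All.lookup trace-Ds D∈)))

    no-star : ⊥
    no-star = <⇒≱ trace-Q (subst₂ _≤_ (sum-eval Q) (sumF-0 {m})
      (sumF-mono (λ k → eval Q (z k)) (λ _ → + 0) (λ k → Q-nonpos (z k) (z-bounded k) (forms-bounded k))))

  -- If 2 (x , y) = 2 A(x , y) + Σ φₖ(x) φₖ(y) with A integral, then Σ φₖ φₖ is even, so half of it is an
  -- integral form N with A + N = F.
  rigid : ∀ {m} (A : Matℤ (suc n) (suc n)) → Symmetric A → PSD A → (φ : Matℤ m (suc n)) →
    (∀ i j → + 2 * A i j + sumF (λ k → φ k i * φ k j) ≡ + 2 * F i j) → ∀ k i → φ k i ≡ + 0
  rigid {m} A A-sym A-psd φ h =
    conclude (indecomposable F dualMin (smallDiagonal G diagonal) connected zero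
      A-sym A-psd N-sym N-psd (λ i j → ring (A i j) (F i j)))
    where
    ring : ∀ a f → a + (f - a) ≡ f
    ring = solve-∀
    N : Matℤ (suc n) (suc n)
    N i j = F i j - A i j
    N-sym : Symmetric N
    N-sym i j = cong₂ _-_ (matrix-sym G i j) (A-sym i j)
    2N : ∀ i j → + 2 * N i j ≡ sumF (λ k → φ k i * φ k j)
    2N i j = begin
      + 2 * (F i j - A i j)           ≡⟨ ring₂ (F i j) (A i j) ⟩
      + 2 * F i j - + 2 * A i j       ≡⟨ cong (λ x → x - + 2 * A i j) (sym (h i j)) ⟩
      + 2 * A i j + s - + 2 * A i j   ≡⟨ ring₃ (A i j) s ⟩
      s ∎
      where
      open ≡-Reasoning
      s = sumF (λ k → φ k i * φ k j)
      ring₂ : ∀ f a → + 2 * (f - a) ≡ + 2 * f - + 2 * a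
      ring₂ = solve-∀
      ring₃ : ∀ a s → + 2 * a + s - + 2 * a ≡ s
      ring₃ = solve-∀
    N-psd : PSD N
    N-psd t = *-cancelˡ-≤-pos (+ 0) (bil N t t) (+ 2) (subst (+ 0 ≤_)
      (trans (dot-gram (λ i k → φ k i) t t) (trans (bil-congᴹ t t (λ i j → sym (2N i j))) (bil-* (+ 2) N t t)))
      (sumF-nonneg _ (λ k → 0≤i*i (comb t (λ i k → φ k i) k))))
    conclude : (∀ i → A i i ≡ + 0) ⊎ (∀ i → N i i ≡ + 0) → ∀ k i → φ k i ≡ + 0
    conclude (inj₁ A0) = ⊥-elim (no-star φ λ i j → begin
      sumF (λ k → φ k i * φ k j)                 ≡⟨ sym (+-identityˡ _) ⟩
      + 0 + sumF (λ k → φ k i * φ k j)           ≡⟨ cong (λ x → + 2 * x + sumF (λ k → φ k i * φ k j)) (sym (psd-null-row A-sym A-psd i (A0 i) j)) ⟩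
      + 2 * A i j + sumF (λ k → φ k i * φ k j)   ≡⟨ h i j ⟩
      + 2 * F i j ∎)
      where open ≡-Reasoning
    conclude (inj₂ N0) k i = i*i≡0⇒i≡0 (φ k i) (sumF≡0⇒≡0 (λ k → φ k i * φ k i) (λ k → 0≤i*i (φ k i))
      (trans (sym (2N i i)) (cong (+ 2 *_) (N0 i))) k)

-- The two certificates

iter : ∀ {n} → (Fin n → Fin n) → ℕ → Fin n → Fin n
iter f zero    i = i
iter f (suc k) i = iter f k (f i)

-- Any two vertices are joined through the root of a spanning tree. In both uses the root is its own
-- parent, an admissible edge since its diagonal entry is nonzero, so one k serves vertices of every
-- depth.
connected-by-parents : ∀ {n} (F : Matℤ n n) → Symmetric F → (parent : Fin n → Fin n) (root : Fin n) (k : ℕ) →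
  (∀ i → F i (parent i) ≢ + 0) → (∀ i → iter parent k i ≡ root) → Connected F
connected-by-parents F F-sym parent root k edge reach P step i j Pi =
  down k j (subst P (sym (reach j)) (subst P (reach i) (up k i Pi)))
  where
  up : ∀ k i → P i → P (iter parent k i)
  up zero    i p = p
  up (suc k) i p = up k (parent i) (step i (parent i) (edge i) p)
  down : ∀ k i → P (iter parent k i) → P i
  down zero    i p = p
  down (suc k) i p = step (parent i) i (λ e → edge i (trans (F-sym i (parent i)) e)) (down k (parent i) p)

-- The roots form chains of type A₁ (number 0), A₂ (1, 2) and A₇ (5 to 11); the vectors 3 and 4 of
-- norm 3 link them.
gram₁ : Gram 12
gram₁ =
  row (+ 2) (+ 0 ∷ + 0 ∷ -[1+ 0 ] ∷ + 0 ∷ + 0 ∷ + 0 ∷ + 0 ∷ + 0 ∷ + 0 ∷ + 0 ∷ + 0 ∷ []) (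
  row (+ 2) (-[1+ 0 ] ∷ + 0 ∷ + 0 ∷ + 0 ∷ + 0 ∷ + 0 ∷ + 0 ∷ + 0 ∷ + 0 ∷ + 0 ∷ []) (
  row (+ 2) (-[1+ 0 ] ∷ + 0 ∷ + 0 ∷ + 0 ∷ + 0 ∷ + 0 ∷ + 0 ∷ + 0 ∷ + 0 ∷ []) (
  row (+ 3) (-[1+ 0 ] ∷ + 0 ∷ + 0 ∷ + 0 ∷ + 0 ∷ + 0 ∷ + 1 ∷ + 0 ∷ []) (
  row (+ 3) (+ 0 ∷ + 0 ∷ -[1+ 0 ] ∷ + 0 ∷ + 0 ∷ + 0 ∷ + 0 ∷ []) (
  row (+ 2) (-[1+ 0 ] ∷ + 0 ∷ + 0 ∷ + 0 ∷ + 0 ∷ + 0 ∷ []) (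
  row (+ 2) (-[1+ 0 ] ∷ + 0 ∷ + 0 ∷ + 0 ∷ + 0 ∷ []) (
  row (+ 2) (-[1+ 0 ] ∷ + 0 ∷ + 0 ∷ + 0 ∷ []) (
  row (+ 2) (-[1+ 0 ] ∷ + 0 ∷ + 0 ∷ []) (
  row (+ 2) (-[1+ 0 ] ∷ + 0 ∷ []) (
  row (+ 2) (-[1+ 0 ] ∷ []) (
  row (+ 2) [] (
  []))))))))))))

-- The frames are the Gram–Schmidt bases, scaled to be integral and primitive.
frame₁ : Frame 12
frame₁ =
  row (+ 15912) (+ 7 ∷ + 3 ∷ + 6 ∷ + 9 ∷ + 2 ∷ -[1+ 0 ] ∷ -[1+ 1 ] ∷ -[1+ 2 ] ∷ -[1+ 5 ] ∷ -[1+ 8 ] ∷ -[1+ 11 ] ∷ -[1+ 5 ] ∷ []) (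
  row (+ 1560) (+ 17 ∷ + 13 ∷ + 9 ∷ + 2 ∷ -[1+ 0 ] ∷ -[1+ 1 ] ∷ -[1+ 2 ] ∷ -[1+ 5 ] ∷ -[1+ 8 ] ∷ -[1+ 11 ] ∷ -[1+ 5 ] ∷ []) (
  row (+ 2520) (+ 13 ∷ + 9 ∷ + 2 ∷ -[1+ 0 ] ∷ -[1+ 1 ] ∷ -[1+ 2 ] ∷ -[1+ 5 ] ∷ -[1+ 8 ] ∷ -[1+ 11 ] ∷ -[1+ 5 ] ∷ []) (
  row (+ 4760) (+ 9 ∷ + 2 ∷ -[1+ 0 ] ∷ -[1+ 1 ] ∷ -[1+ 2 ] ∷ -[1+ 5 ] ∷ -[1+ 8 ] ∷ -[1+ 11 ] ∷ -[1+ 5 ] ∷ []) (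
  row (+ 7735) (+ 8 ∷ + 5 ∷ + 10 ∷ + 15 ∷ + 12 ∷ + 9 ∷ + 6 ∷ + 3 ∷ []) (
  row (+ 9945) (+ 7 ∷ + 6 ∷ + 5 ∷ + 4 ∷ + 3 ∷ + 2 ∷ + 1 ∷ []) (
  row (+ 13260) (+ 6 ∷ + 5 ∷ + 4 ∷ + 3 ∷ + 2 ∷ + 1 ∷ []) (
  row (+ 18564) (+ 5 ∷ + 4 ∷ + 3 ∷ + 2 ∷ + 1 ∷ []) (
  row (+ 27846) (+ 4 ∷ + 3 ∷ + 2 ∷ + 1 ∷ []) (
  row (+ 46410) (+ 3 ∷ + 2 ∷ + 1 ∷ []) (
  row (+ 92820) (+ 2 ∷ + 1 ∷ []) (
  row (+ 278460) (+ 1 ∷ []) (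
  []))))))))))))

-- Here the chains are A₂ (0, 1), A₁ (2) and A₈ (4 to 11), linked by the single vector 3 of norm 3.
gram₂ : Gram 12
gram₂ =
  row (+ 2) (-[1+ 0 ] ∷ + 0 ∷ + 0 ∷ + 0 ∷ + 0 ∷ + 0 ∷ + 0 ∷ + 0 ∷ + 0 ∷ + 0 ∷ + 0 ∷ []) (
  row (+ 2) (+ 0 ∷ -[1+ 0 ] ∷ + 0 ∷ + 0 ∷ + 0 ∷ + 0 ∷ + 0 ∷ + 0 ∷ + 0 ∷ + 0 ∷ []) (
  row (+ 2) (-[1+ 0 ] ∷ + 0 ∷ + 0 ∷ + 0 ∷ + 0 ∷ + 0 ∷ + 0 ∷ + 0 ∷ + 0 ∷ []) (
  row (+ 3) (+ 0 ∷ -[1+ 0 ] ∷ + 0 ∷ + 0 ∷ + 0 ∷ + 0 ∷ + 0 ∷ + 0 ∷ []) (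
  row (+ 2) (-[1+ 0 ] ∷ + 0 ∷ + 0 ∷ + 0 ∷ + 0 ∷ + 0 ∷ + 0 ∷ []) (
  row (+ 2) (-[1+ 0 ] ∷ + 0 ∷ + 0 ∷ + 0 ∷ + 0 ∷ + 0 ∷ []) (
  row (+ 2) (-[1+ 0 ] ∷ + 0 ∷ + 0 ∷ + 0 ∷ + 0 ∷ []) (
  row (+ 2) (-[1+ 0 ] ∷ + 0 ∷ + 0 ∷ + 0 ∷ []) (
  row (+ 2) (-[1+ 0 ] ∷ + 0 ∷ + 0 ∷ []) (
  row (+ 2) (-[1+ 0 ] ∷ + 0 ∷ []) (
  row (+ 2) (-[1+ 0 ] ∷ []) (
  row (+ 2) [] (
  []))))))))))))

frame₂ : Frame 12
frame₂ =
  row (+ 4641) (+ 16 ∷ + 17 ∷ + 9 ∷ + 18 ∷ + 14 ∷ + 28 ∷ + 24 ∷ + 20 ∷ + 16 ∷ + 12 ∷ + 8 ∷ + 4 ∷ []) (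
  row (+ 4095) (+ 17 ∷ + 9 ∷ + 18 ∷ + 14 ∷ + 28 ∷ + 24 ∷ + 20 ∷ + 16 ∷ + 12 ∷ + 8 ∷ + 4 ∷ []) (
  row (+ 5040) (+ 13 ∷ + 9 ∷ + 7 ∷ + 14 ∷ + 12 ∷ + 10 ∷ + 8 ∷ + 6 ∷ + 4 ∷ + 2 ∷ []) (
  row (+ 9520) (+ 9 ∷ + 7 ∷ + 14 ∷ + 12 ∷ + 10 ∷ + 8 ∷ + 6 ∷ + 4 ∷ + 2 ∷ []) (
  row (+ 15470) (+ 8 ∷ + 7 ∷ + 6 ∷ + 5 ∷ + 4 ∷ + 3 ∷ + 2 ∷ + 1 ∷ []) (
  row (+ 19890) (+ 7 ∷ + 6 ∷ + 5 ∷ + 4 ∷ + 3 ∷ + 2 ∷ + 1 ∷ []) (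
  row (+ 26520) (+ 6 ∷ + 5 ∷ + 4 ∷ + 3 ∷ + 2 ∷ + 1 ∷ []) (
  row (+ 37128) (+ 5 ∷ + 4 ∷ + 3 ∷ + 2 ∷ + 1 ∷ []) (
  row (+ 55692) (+ 4 ∷ + 3 ∷ + 2 ∷ + 1 ∷ []) (
  row (+ 92820) (+ 3 ∷ + 2 ∷ + 1 ∷ []) (
  row (+ 185640) (+ 2 ∷ + 1 ∷ []) (
  row (+ 556920) (+ 1 ∷ []) (
  []))))))))))))

-- `tailSum 12` is 0: label 12 stands for the end point of the chain, where no basis vector starts.
-- Differences of two tail sums are therefore defined for all pairs of labels, in either order.
tailSum : ℕ → Vec ℤ 12
tailSum s = tabulate (λ j → if s ℕ.≤ᵇ toℕ j then + 1 else + 0)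

-- The basis vectors numbered s, …, 11 form a chain of roots eᵢ − eᵢ₊₁, so this is eₛ − eₜ.
root : ℕ → ℕ → Vec ℤ 12
root s t = zipWith _-_ (tailSum s) (tailSum t)

basis : ℕ → Vec ℤ 12
basis i = root i (suc i)

-- With p, q, i, j distinct, (eᵢ − eⱼ , eᵢ − eⱼ) = 2 and (eₚ − eᵢ , e_q − eᵢ) = 1, so the trace is 3; the value on
-- the functional represented by eᵢ − eⱼ is 7 > 2 · 3.
exclude : ℕ → ℕ → List ℕ → Form 12
exclude i j (p ∷ q ∷ _) = (+ 2 , root i j , root i j) ∷ (-[1+ 0 ] , root p i , root q i) ∷ []
exclude i j _           = []

pairs : List ℕ → List (ℕ × ℕ)
pairs []       = []
pairs (i ∷ is) = map (i ,_) is ++ pairs is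

excludeAll : List ℕ → List (Form 12)
excludeAll is = map (λ (i , j) → exclude i j (filterᵇ (λ p → not (i ℕ.≡ᵇ p) ∧ not (j ℕ.≡ᵇ p)) is)) (pairs is)

-- Write y p for the value of a functional on `tailSum p`. The terms are x (y p - y q) (y p - y r)
-- over cyclically consecutive labels p, q, r. Products of neighbours cancel in the sum, leaving (x
-- / 2) Σ (y p - y r)² over second neighbours: a nonnegative form that has integral coefficients for
-- odd x too. Each term contributes x to the trace.
cyclic : ℤ → List ℕ → Form 12
cyclic x (i ∷ j ∷ is) = go (i ∷ j ∷ is)
  where
  go : List ℕ → Form 12
  go (p ∷ q ∷ r ∷ ps) = (x , root p q , root p r) ∷ go (q ∷ r ∷ ps)
  go (p ∷ q ∷ [])     = (x , root p q , root p i) ∷ (x , root q i , root q j) ∷ []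
  go _                = []
cyclic x _ = []

square : ℤ → Vec ℤ 12 → ℤ × Vec ℤ 12 × Vec ℤ 12
square x u = x , u , u

-- These solve the dual of the linear program that asks for nonnegative weights wᵤ with Σ wᵤ u² = 2 ( , ), over the
-- dual vectors u of norm at most 2 that are left after excludeAll.
form₁ form₂ : Form 12
form₁ =
  square -[1+ 8 ] (basis 0) ∷
  square -[1+ 1 ] (basis 1) ∷ square -[1+ 1 ] (basis 2) ∷ square -[1+ 1 ] (root 1 3) ∷
  -- Both vectors are orthogonal to all roots of the lattice: their inner products with the basis
  -- vanish except at the two vectors of norm 3. The other terms of the form live on the root
  -- components A₁, A₂ and A₇.
  (+ 1 ,
   (+ 3 ∷ + 2 ∷ + 4 ∷ + 6 ∷ -[1+ 11 ] ∷ -[1+ 8 ] ∷ -[1+ 17 ] ∷ -[1+ 26 ] ∷ -[1+ 23 ] ∷ -[1+ 20 ] ∷ -[1+ 17 ] ∷ -[1+ 8 ] ∷ []) ,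
   (+ 3 ∷ + 2 ∷ + 4 ∷ + 6 ∷ + 4 ∷ + 1 ∷ + 2 ∷ + 3 ∷ + 0 ∷ -[1+ 2 ] ∷ -[1+ 5 ] ∷ -[1+ 2 ] ∷ [])) ∷
  cyclic (+ 9) (5 ∷ 6 ∷ 7 ∷ 8 ∷ 9 ∷ 10 ∷ 11 ∷ 12 ∷ [])
form₂ =
  square -[1+ 5 ] (basis 0) ∷ square -[1+ 5 ] (basis 1) ∷ square -[1+ 5 ] (root 0 2) ∷
  -- A generator of the orthogonal complement of the roots, which has rank 1 here since A₈ + A₂ + A₁
  -- has rank 11. Its inner products with the basis vanish except at the vector of norm 3.
  square -[1+ 0 ] (+ 6 ∷ + 12 ∷ + 9 ∷ + 18 ∷ + 14 ∷ + 28 ∷ + 24 ∷ + 20 ∷ + 16 ∷ + 12 ∷ + 8 ∷ + 4 ∷ []) ∷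
  cyclic (+ 16) (4 ∷ 5 ∷ 6 ∷ 7 ∷ 8 ∷ 9 ∷ 10 ∷ 11 ∷ 12 ∷ [])

parent₁ : Fin 12 → Fin 12
parent₁ = lookup (# 3 ∷ # 2 ∷ # 3 ∷ # 4 ∷ # 7 ∷ # 6 ∷ # 7 ∷ # 8 ∷ # 9 ∷ # 10 ∷ # 11 ∷ # 11 ∷ [])

diagonal₁ : SmallDiagonal gram₁
diagonal₁ =
  inj₁ refl , inj₁ refl , inj₁ refl , inj₂ refl , inj₂ refl , inj₁ refl ,
  inj₁ refl , inj₁ refl , inj₁ refl , inj₁ refl , inj₁ refl , inj₁ refl , tt

certificate₁ : Certificate gram₁
certificate₁ = record
  -- The least common multiple of the norms K / m of the frame vectors.
  { K          = + 556920
  ; K≥0        = +≤+ z≤n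
  ; frame      = frame₁
  ; orthogonal = refl , refl , refl , refl , refl , refl , refl , refl , refl , refl , refl , refl ,
                 refl , refl , refl , refl , refl , refl , refl , refl , refl , refl , refl , refl , tt
  ; diagonal   = diagonal₁
  ; connected  = connected-by-parents (matrix gram₁) (matrix-sym gram₁) parent₁ (# 11) 12
      (from-yes (Fin.all? (λ i → ¬? (matrix gram₁ i (parent₁ i) ≟ + 0))))
      (from-yes (Fin.all? (λ i → iter parent₁ 12 i Fin.≟ # 11)))
  ; bound      = + 6
  ; Ds         = excludeAll (5 ∷ 6 ∷ 7 ∷ 8 ∷ 9 ∷ 10 ∷ 11 ∷ 12 ∷ [])
  ; Q          = form₁
  ; trace-Ds   = from-yes (All.all? (λ D → + 2 * trace gram₁ D ≟ + 6) (excludeAll (5 ∷ 6 ∷ 7 ∷ 8 ∷ 9 ∷ 10 ∷ 11 ∷ 12 ∷ [])))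
  ; trace-Q    = +<+ (s≤s z≤n)
  ; searched   = tt
  }

parent₂ : Fin 12 → Fin 12
parent₂ = lookup (# 1 ∷ # 3 ∷ # 3 ∷ # 5 ∷ # 5 ∷ # 6 ∷ # 7 ∷ # 8 ∷ # 9 ∷ # 10 ∷ # 11 ∷ # 11 ∷ [])

diagonal₂ : SmallDiagonal gram₂
diagonal₂ =
  inj₁ refl , inj₁ refl , inj₁ refl , inj₂ refl , inj₁ refl , inj₁ refl ,
  inj₁ refl , inj₁ refl , inj₁ refl , inj₁ refl , inj₁ refl , inj₁ refl , tt

certificate₂ : Certificate gram₂
certificate₂ = record
  { K          = + 1113840
  ; K≥0        = +≤+ z≤n
  ; frame      = frame₂
  ; orthogonal = refl , refl , refl , refl , refl , refl , refl , refl , refl , refl , refl , refl ,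
                 refl , refl , refl , refl , refl , refl , refl , refl , refl , refl , refl , refl , tt
  ; diagonal   = diagonal₂
  ; connected  = connected-by-parents (matrix gram₂) (matrix-sym gram₂) parent₂ (# 11) 12
      (from-yes (Fin.all? (λ i → ¬? (matrix gram₂ i (parent₂ i) ≟ + 0))))
      (from-yes (Fin.all? (λ i → iter parent₂ 12 i Fin.≟ # 11)))
  ; bound      = + 6
  ; Ds         = excludeAll (4 ∷ 5 ∷ 6 ∷ 7 ∷ 8 ∷ 9 ∷ 10 ∷ 11 ∷ 12 ∷ [])
  ; Q          = form₂
  ; trace-Ds   = from-yes (All.all? (λ D → + 2 * trace gram₂ D ≟ + 6) (excludeAll (4 ∷ 5 ∷ 6 ∷ 7 ∷ 8 ∷ 9 ∷ 10 ∷ 11 ∷ 12 ∷ [])))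
  ; trace-Q    = +<+ (s≤s z≤n)
  ; searched   = tt
  }

-- Minimality from a certificate

dot-nonneg : ∀ {n} (x : Vecℤ n) → + 0 ≤ dot x x
dot-nonneg x = sumF-nonneg (λ i → x i * x i) (λ i → 0≤i*i (x i))

dot-0ˡ : ∀ {n} {x : Vecℤ n} (y : Vecℤ n) → (∀ i → x i ≡ + 0) → dot x y ≡ + 0
dot-0ˡ {n} y x0 = trans (sumF-cong (λ i → trans (cong (_* y i) (x0 i)) (*-zeroˡ (y i)))) (sumF-0 {n})

dot-0ʳ : ∀ {n} (x : Vecℤ n) {y : Vecℤ n} → (∀ i → y i ≡ + 0) → dot x y ≡ + 0
dot-0ʳ x {y} y0 = trans (dot-comm x y) (dot-0ˡ x y0)

dot≡0⇒≡0 : ∀ {n} (x : Vecℤ n) → dot x x ≡ + 0 → ∀ i → x i ≡ + 0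
dot≡0⇒≡0 x e i = i*i≡0⇒i≡0 (x i) (sumF≡0⇒≡0 (λ i → x i * x i) (λ i → 0≤i*i (x i)) e i)

bil-sym : ∀ {k} (H : Matℤ k k) → Symmetric H → ∀ p q → bil H p q ≡ bil H q p
bil-sym H H-sym p q = trans (sumF-swap (λ i j → p i * (H i j * q j)))
  (sumF-cong (λ j → sumF-cong (λ i → trans (ring (p i) (H i j) (q j)) (cong (λ h → q j * (h * p i)) (H-sym i j)))))
  where
  ring : ∀ p h q → p * (h * q) ≡ q * (h * p)
  ring = solve-∀

latticeGram-psd : ∀ {k} (H : Matℤ k k) → IsLatticeGram H → PSD H
latticeGram-psd H (_ , pos) p with Fin.any? (λ i → ¬? (p i ≟ + 0))
... | yes ne  = <⇒≤ (pos p ne)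
... | no  all = ≤-reflexive (sym (trans (bil-dot H p p) (dot-0ˡ _ (λ i → decidable-stable (p i ≟ + 0) (λ ne → all (i , ne))))))

module _ {n} (L : Pred) (B : Fin (suc n) → V) (basis : IsBasis L B)
         (gram : Gram (suc n)) (hasGram : HasGram B (matrix gram)) (cert : Certificate gram) where
  private
    F = matrix gram

    B∈L : ∀ i → L (B i)
    B∈L = proj₁ basis

    cancel16 : ∀ {x y} → + 16 * x ≡ + 2 * (+ 16 * y) → x ≡ + 2 * y
    cancel16 {x} {y} e = *-cancelˡ-≡ (+ 16) x (+ 2 * y) (trans e (ring y))
      where
      ring : ∀ y → + 2 * (+ 16 * y) ≡ + 16 * (+ 2 * y)
      ring = solve-∀

  -- An embedding into ℤᵐ is a decomposition with A = 0, so `rigid` makes `f` vanish at the first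
  -- basis vector, whose norm is 2 or 3.
  non-integrable : ¬ Integrable 2 L
  non-integrable (m , f , _ , iso) = F₀₀≢0 (smallDiagonal gram (Certificate.diagonal cert) zero)
      (*-cancelˡ-≡ (+ 2) (F zero zero) (+ 0) (trans (sym (star zero zero))
        (dot-0ˡ (f (B zero)) (λ k → rigid gram cert (λ _ _ → + 0) (λ _ _ → refl) psd-0 (λ k i → f (B i) k)
          (λ i j → trans (+-identityˡ _) (star i j)) k zero))))
    where
    star : ∀ i j → dot (f (B i)) (f (B j)) ≡ + 2 * F i j
    star i j = cancel16 (trans (iso (B i) (B j) (B∈L i) (B∈L j)) (cong (+ 2 *_) (hasGram i j)))
    psd-0 : PSD {suc n} (λ _ _ → + 0)
    psd-0 t = ≤-reflexive (sym (trans (bil-dot (λ _ _ → + 0) t t) (dot-0ʳ t (λ i → dot-0ˡ t (λ _ → refl)))))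
    F₀₀≢0 : ∀ {x} → x ≡ + 2 ⊎ x ≡ + 3 → x ≢ + 0
    F₀₀≢0 (inj₁ refl) ()
    F₀₀≢0 (inj₂ refl) ()

  -- With the pull-back of `H` as A, `rigid` makes `f₂` vanish on the basis. To reach an arbitrary x
  -- a detour through norms is taken: x is only `_≈_` to its expansion in the basis, and `f₂` need
  -- not respect `_≈_`.
  minimal : Minimal 2 L
  minimal (k , H , lg , m , _ , f₁ , f₂ , _ , _ , iso , x , x∈L , j , ne) = ne f₂x≡0
    where
    H-psd = latticeGram-psd H lg

    norm : ∀ {r} (y : Fin r → V) → (∀ i → L (y i)) → ∀ t →
      + 16 * (+ 2 * bil H (comb t (λ i → f₁ (y i))) (comb t (λ i → f₁ (y i)))
              + dot (comb t (λ i → f₂ (y i))) (comb t (λ i → f₂ (y i))))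
      ≡ + 2 * dot (comb t y) (comb t y)
    norm y y∈L t = begin
      + 16 * (+ 2 * bil H (comb t p) (comb t p) + dot (comb t q) (comb t q))
        ≡⟨ cong₂ (λ u v → + 16 * (+ 2 * u + v)) (bil-gram H p t t) (dot-gram q t t) ⟩
      + 16 * (+ 2 * bil P t t + bil Q t t)
        ≡⟨ cong (+ 16 *_) (trans (cong (λ z → z + bil Q t t) (sym (bil-* (+ 2) P t t))) (sym (bil-+ (λ i j → + 2 * P i j) Q t t))) ⟩
      + 16 * bil (λ i j → + 2 * P i j + Q i j) t t
        ≡⟨ sym (bil-* (+ 16) (λ i j → + 2 * P i j + Q i j) t t) ⟩
      bil (λ i j → + 16 * (+ 2 * P i j + Q i j)) t t
        ≡⟨ bil-congᴹ t t (λ i j → iso (y i) (y j) (y∈L i) (y∈L j)) ⟩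
      bil (λ i j → + 2 * dot (y i) (y j)) t t
        ≡⟨ bil-* (+ 2) (λ i j → dot (y i) (y j)) t t ⟩
      + 2 * bil (λ i j → dot (y i) (y j)) t t
        ≡⟨ cong (+ 2 *_) (sym (dot-gram y t t)) ⟩
      + 2 * dot (comb t y) (comb t y) ∎
      where
      open ≡-Reasoning
      p = λ i → f₁ (y i)
      q = λ i → f₂ (y i)
      P = λ i j → bil H (p i) (p j)
      Q = λ i j → dot (q i) (q j)

    φ≡0 : ∀ l i → f₂ (B i) l ≡ + 0
    φ≡0 = rigid gram cert (λ i j → bil H (f₁ (B i)) (f₁ (B j)))
      (λ i j → bil-sym H (proj₁ lg) (f₁ (B i)) (f₁ (B j)))
      (λ t → subst (+ 0 ≤_) (bil-gram H (λ i → f₁ (B i)) t t) (H-psd (comb t (λ i → f₁ (B i)))))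
      (λ l i → f₂ (B i) l)
      (λ i j → cancel16 (trans (iso (B i) (B j) (B∈L i) (B∈L j)) (cong (+ 2 *_) (hasGram i j))))

    co : Vecℤ (suc n)
    co = proj₁ (proj₂ (proj₂ basis) x x∈L)

    -- The combination x − Σ coⱼ Bⱼ vanishes, so its image under the isometry (f₁ , f₂) has norm 0.
    y : Fin (suc (suc n)) → V
    y zero    = x
    y (suc i) = B i
    t : Vecℤ (suc (suc n))
    t zero    = -[1+ 0 ]
    t (suc i) = co i

    y∈L : ∀ i → L (y i)
    y∈L zero    = x∈L
    y∈L (suc i) = B∈L i

    vanish : ∀ i → comb t y i ≡ + 0
    vanish i = trans (cong (λ z → -[1+ 0 ] * x i + z) (sym (proj₂ (proj₂ (proj₂ basis) x x∈L) i))) (ring (x i))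
      where
      ring : ∀ z → -[1+ 0 ] * z + z ≡ + 0
      ring = solve-∀

    nonneg-sum : ∀ {u v} → + 0 ≤ u → + 0 ≤ v → + 16 * (+ 2 * u + v) ≡ + 0 → v ≡ + 0
    nonneg-sum {u} {v} 0≤u 0≤v e = ≤-antisym (≤-trans (≤-trans (≤-reflexive (sym (+-identityˡ v)))
      (+-monoˡ-≤ v (nonneg-* {+ 2} (+≤+ z≤n) 0≤u))) (≤-reflexive (*-cancelˡ-≡ (+ 16) (+ 2 * u + v) (+ 0) e))) 0≤v

    f₂-null : comb t (λ i → f₂ (y i)) j ≡ + 0
    f₂-null = dot≡0⇒≡0 (comb t (λ i → f₂ (y i))) (nonneg-sum (H-psd (comb t (λ i → f₁ (y i)))) (dot-nonneg (comb t (λ i → f₂ (y i))))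
      (trans (norm y y∈L t) (cong (+ 2 *_) (dot-0ˡ (comb t y) vanish)))) j

    f₂x≡0 : f₂ x j ≡ + 0
    f₂x≡0 = begin
      f₂ x j                                        ≡⟨ ring (f₂ x j) ⟩
      - (-[1+ 0 ] * f₂ x j + + 0)                   ≡⟨ cong (λ z → - (-[1+ 0 ] * f₂ x j + z)) (sym (dot-0ʳ co (φ≡0 j))) ⟩
      - comb t (λ i → f₂ (y i)) j                   ≡⟨ cong -_ f₂-null ⟩
      + 0 ∎
      where
      open ≡-Reasoning
      ring : ∀ z → z ≡ - (-[1+ 0 ] * z + + 0)
      ring = solve-∀

-- The lattice A₁₅⁺

Glued : V → Set
Glued x = sumF x ≡ + 0 × Σ ℤ λ r → Σ V λ u → ∀ i → x i ≡ r + + 4 * u i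

private
  γ : V
  γ = vec (+ 0 ∷ + 0 ∷ + 0 ∷ + 0 ∷ + 0 ∷ + 0 ∷ + 0 ∷ + 0 ∷ + 0 ∷ + 0 ∷ + 0 ∷ + 0 ∷ + 1 ∷ + 1 ∷ + 1 ∷ + 1 ∷ [])

  g4-γ : ∀ i → g4 i ≡ + 1 - + 4 * γ i
  g4-γ = from-yes (Fin.all? (λ i → g4 i ≟ + 1 - + 4 * γ i))

  sum-glue : ∀ (y : V) k → sumF (λ i → + 4 * y i + k * g4 i) ≡ + 4 * sumF y
  sum-glue y k = trans (sumF-+ (λ i → + 4 * y i) (λ i → k * g4 i))
    (trans (cong₂ _+_ (sumF-*ˡ (+ 4) y) (trans (sumF-*ˡ k g4) (*-zeroʳ k))) (+-identityʳ _))

glued : ∀ {x} → InA15p x → Glued x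
glued {x} (y , k , Σy , e) =
  trans (sumF-cong e) (trans (sum-glue y k) (cong (+ 4 *_) Σy)) ,
  k , (λ i → y i - k * γ i) , λ i → trans (e i) (trans (cong (λ g → + 4 * y i + k * g) (g4-γ i)) (ring (y i) k (γ i)))
  where
  ring : ∀ y k γ → + 4 * y + k * (+ 1 - + 4 * γ) ≡ k + + 4 * (y - k * γ)
  ring = solve-∀

unglued : ∀ {x} → Glued x → InA15p x
unglued {x} (Σx , r , u , e) = y , r , *-cancelˡ-≡ (+ 4) (sumF y) (+ 0) (trans (sym (sum-glue y r)) (trans (sumF-cong (λ i → sym (e' i))) Σx)) , e'
  where
  y : V
  y i = u i + r * γ i
  ring : ∀ u r γ → r + + 4 * u ≡ + 4 * (u + r * γ) + r * (+ 1 - + 4 * γ)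
  ring = solve-∀
  e' : ∀ i → x i ≡ + 4 * y i + r * g4 i
  e' i = trans (e i) (trans (ring (u i) r (γ i)) (cong (λ g → + 4 * y i + r * g) (sym (g4-γ i))))

-- Bases and determinants of the orthogonal complements

Orth : (Fin 3 → V) → V → Set
Orth v x = ∀ l → dot x (v l) ≡ + 0

orth⇒perp : ∀ v {x} → InA15p x → Orth v x → Perp (Span v) x
orth⇒perp v {x} x∈ o = x∈ , λ y (co , e) → trans (dot-congʳ x e) (trans (dot-combʳ co v x) (dot-0ʳ co o))

span-gen : ∀ {r} (v : Fin r → V) l → Span v (v l)
span-gen v l = unit l , λ i → sym (dot-unitˡ l (λ j → v j i))

perp⇒orth : ∀ v {x} → Perp (Span v) x → Orth v x
perp⇒orth v (_ , o) l = o (v l) (span-gen v l)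

-- E gives 4 times the coordinates with respect to B; Λ expresses the difference of 4 xᵢ and the i-th entry of
-- Σ (Eⱼ · x) Bⱼ as a combination of Σ x and the (x , v l), which vanish on the orthogonal complement of v.
basis-of-perp : ∀ {r} (v : Fin 3 → V) (B E : Fin r → V) (e₀ : Vecℤ r) (Λ : Matℤ 16 4) →
  (∀ j → InA15p (B j)) → (∀ j → Orth v (B j)) →
  (∀ i j → dot (E i) (B j) ≡ + 4 * unit i j) →
  (∀ j → sumF (E j) ≡ + 4 * e₀ j) →
  (∀ i m → + 4 * unit i m ≡ sumF (λ j → B j i * E j m) + (Λ i zero + sumF (λ l → Λ i (suc l) * v l m))) →
  IsBasis (Perp (Span v)) B
basis-of-perp {r} v B E e₀ Λ B∈ B⊥ dual sumE resolve = (λ j → orth⇒perp v (B∈ j) (B⊥ j)) , independent , spanning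
  where
  open ≡-Reasoning
  independent : ∀ (co : Vecℤ r) → (∀ k → comb co B k ≡ + 0) → ∀ j → co j ≡ + 0
  independent co z j = *-cancelˡ-≡ (+ 4) (co j) (+ 0) (begin
    + 4 * co j                            ≡⟨ cong (+ 4 *_) (sym (dot-unitʳ co j)) ⟩
    + 4 * dot co (unit j)                 ≡⟨ sym (sumF-*ˡ (+ 4) (λ i → co i * unit j i)) ⟩
    sumF (λ i → + 4 * (co i * unit j i))  ≡⟨ sumF-cong (λ i → trans (ring (co i) (unit j i)) (cong (co i *_) (sym (dual j i)))) ⟩
    dot co (λ i → dot (E j) (B i))        ≡⟨ sym (dot-combʳ co B (E j)) ⟩
    dot (E j) (comb co B)                 ≡⟨ dot-0ʳ (E j) z ⟩
    + 0 ∎)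
    where
    ring : ∀ c u → + 4 * (c * u) ≡ c * (+ 4 * u)
    ring = solve-∀

  spanning : ∀ x → Perp (Span v) x → Span B x
  spanning x x∈ with glued (proj₁ x∈)
  ... | Σx , r , u , e = co , λ i → *-cancelˡ-≡ (+ 4) (x i) (comb co B i) (begin
      + 4 * x i
        ≡⟨ cong (+ 4 *_) (sym (dot-unitˡ i x)) ⟩
      + 4 * dot (unit i) x
        ≡⟨ sym (sumF-*ˡ (+ 4) (λ m → unit i m * x m)) ⟩
      sumF (λ m → + 4 * (unit i m * x m))
        ≡⟨ sumF-cong (λ m → trans (sym (*-assoc (+ 4) (unit i m) (x m))) (trans (cong (_* x m) (resolve i m))
             (*-distribʳ-+ (x m) (comb (λ j → B j i) E m) (Λ i zero + comb (λ l → Λ i (suc l)) v m)))) ⟩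
      sumF (λ m → comb (λ j → B j i) E m * x m + (Λ i zero + comb (λ l → Λ i (suc l)) v m) * x m)
        ≡⟨ sumF-+ (λ m → comb (λ j → B j i) E m * x m) (λ m → (Λ i zero + comb (λ l → Λ i (suc l)) v m) * x m) ⟩
      dot (comb (λ j → B j i) E) x + dot (λ m → Λ i zero + comb (λ l → Λ i (suc l)) v m) x
        ≡⟨ cong₂ _+_ (dot-combˡ (λ j → B j i) E x) (rest i) ⟩
      dot (λ j → B j i) (λ j → dot (E j) x) + + 0
        ≡⟨ +-identityʳ _ ⟩
      dot (λ j → B j i) (λ j → dot (E j) x)
        ≡⟨ sumF-cong (λ j → trans (cong (B j i *_) (Ex j)) (ring (B j i) (co j))) ⟩
      sumF (λ j → + 4 * (co j * B j i))
        ≡⟨ sumF-*ˡ (+ 4) (λ j → co j * B j i) ⟩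
      + 4 * comb co B i ∎)
    where
    -- The coordinate (Eⱼ · x) / 4 is an integer because x = r + 4 u and the entries of Eⱼ sum to 4
    -- e₀ⱼ.
    co : Vecℤ _
    co j = r * e₀ j + dot (E j) u
    ring : ∀ b c → b * (+ 4 * c) ≡ + 4 * (c * b)
    ring = solve-∀
    Ex : ∀ j → dot (E j) x ≡ + 4 * co j
    Ex j = begin
      dot (E j) x                                             ≡⟨ dot-congʳ (E j) e ⟩
      sumF (λ m → E j m * (r + + 4 * u m))                    ≡⟨ sumF-cong (λ m → ring₁ (E j m) r (u m)) ⟩
      sumF (λ m → r * E j m + + 4 * (E j m * u m))            ≡⟨ sumF-+ (λ m → r * E j m) (λ m → + 4 * (E j m * u m)) ⟩
      sumF (λ m → r * E j m) + sumF (λ m → + 4 * (E j m * u m))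
        ≡⟨ cong₂ _+_ (trans (sumF-*ˡ r (E j)) (cong (r *_) (sumE j))) (sumF-*ˡ (+ 4) (λ m → E j m * u m)) ⟩
      r * (+ 4 * e₀ j) + + 4 * dot (E j) u                    ≡⟨ ring₂ r (e₀ j) (dot (E j) u) ⟩
      + 4 * (r * e₀ j + dot (E j) u) ∎
      where
      ring₁ : ∀ e r u → e * (r + + 4 * u) ≡ r * e + + 4 * (e * u)
      ring₁ = solve-∀
      ring₂ : ∀ r e d → r * (+ 4 * e) + + 4 * d ≡ + 4 * (r * e + d)
      ring₂ = solve-∀
    rest : ∀ i → dot (λ m → Λ i zero + comb (λ l → Λ i (suc l)) v m) x ≡ + 0
    rest i = begin
      sumF (λ m → (Λ i zero + comb (λ l → Λ i (suc l)) v m) * x m)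
        ≡⟨ sumF-cong (λ m → *-distribʳ-+ (x m) (Λ i zero) (comb (λ l → Λ i (suc l)) v m)) ⟩
      sumF (λ m → Λ i zero * x m + comb (λ l → Λ i (suc l)) v m * x m)
        ≡⟨ sumF-+ (λ m → Λ i zero * x m) (λ m → comb (λ l → Λ i (suc l)) v m * x m) ⟩
      sumF (λ m → Λ i zero * x m) + dot (comb (λ l → Λ i (suc l)) v) x
        ≡⟨ cong₂ _+_ (trans (sumF-*ˡ (Λ i zero) x) (trans (cong (Λ i zero *_) Σx) (*-zeroʳ (Λ i zero))))
             (trans (dot-combˡ (λ l → Λ i (suc l)) v x) (dot-0ʳ (λ l → Λ i (suc l)) (λ l → trans (dot-comm (v l) x) (perp⇒orth v x∈ l)))) ⟩
      + 0 ∎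

private
  -- Matching on the entry first leaves the minor d unevaluated when the entry is 0.
  sparseTerm : ∀ {n} → Fin n → ℤ → ℤ → ℤ
  sparseTerm j (+ 0) d = + 0
  sparseTerm j x     d = sgnℕ (toℕ j) * (x * d)

-- Expanding det itself for a 12 × 12 matrix would take 12! products.
sparseDet : ∀ {n} → Matℤ n n → ℤ
sparseDet {zero}  M = + 1
sparseDet {suc n} M = sumF (λ j → sparseTerm j (M zero j) (sparseDet (λ r s → M (suc r) (punchIn j s))))

det≡sparseDet : ∀ {n} (M : Matℤ n n) → det M ≡ sparseDet M
det≡sparseDet {zero}  M = refl
det≡sparseDet {suc n} M = sumF-cong (λ j → trans
  (cong (λ d → sgnℕ (toℕ j) * (M zero j * d)) (det≡sparseDet (λ r s → M (suc r) (punchIn j s))))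
  (skip j (M zero j) _))
  where
  skip : ∀ {n} (j : Fin n) x d → sgnℕ (toℕ j) * (x * d) ≡ sparseTerm j x d
  skip j (+ 0)      d = trans (cong (sgnℕ (toℕ j) *_) (*-zeroˡ d)) (*-zeroʳ (sgnℕ (toℕ j)))
  skip j (+ suc _)  d = refl
  skip j (-[1+ _ ]) d = refl

rootVector : Fin 16 → Fin 16 → V
rootVector i j k = + 4 * (unit i k - unit j k)

sumF-unit : ∀ {n} (i : Fin n) → sumF (unit i) ≡ + 1
sumF-unit i = trans (sumF-cong (λ j → sym (*-identityʳ (unit i j)))) (dot-unitˡ i (λ _ → + 1))

rootVector∈ : ∀ i j → InA15p (rootVector i j)
rootVector∈ i j = unglued (sum , + 0 , (λ k → unit i k - unit j k) , λ k → sym (+-identityˡ _))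
  where
  sum : sumF (rootVector i j) ≡ + 0
  sum = trans (sumF-*ˡ (+ 4) (λ k → unit i k - unit j k)) (cong (+ 4 *_)
    (trans (sumF-+ (unit i) (λ k → - unit j k)) (cong₂ _+_ (sumF-unit i) (trans (sumF-neg (unit j)) (cong -_ (sumF-unit j))))))

quadVector : Fin 16 → Fin 16 → Fin 16 → Fin 16 → V
quadVector p q r s k = + 1 + + 4 * - (unit p k + (unit q k + (unit r k + unit s k)))

quadVector∈ : ∀ p q r s → InA15p (quadVector p q r s)
quadVector∈ p q r s = unglued (sum , + 1 , (λ k → - u k) , λ k → refl)
  where
  u : V
  u k = unit p k + (unit q k + (unit r k + unit s k))
  Σu : sumF u ≡ + 4
  Σu = trans (sumF-+ (unit p) (λ k → unit q k + (unit r k + unit s k))) 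
    (cong₂ _+_ (sumF-unit p) (trans (sumF-+ (unit q) (λ k → unit r k + unit s k)) (cong₂ _+_ (sumF-unit q)
    (trans (sumF-+ (unit r) (unit s)) (cong₂ _+_ (sumF-unit r) (sumF-unit s))))))
  sum : sumF (quadVector p q r s) ≡ + 0
  sum = trans (sumF-+ (λ _ → + 1) (λ k → + 4 * - u k))
    (cong (λ x → + 16 + x) (trans (sumF-*ˡ (+ 4) (λ k → - u k)) (cong (+ 4 *_) (trans (sumF-neg u) (cong -_ Σu)))))

basis₁ : Fin 12 → V
basis₁ = lookup (
  rootVector (# 1) (# 2) ∷
  rootVector (# 6) (# 7) ∷
  rootVector (# 5) (# 6) ∷
  quadVector (# 1) (# 5) (# 14) (# 15) ∷
  quadVector (# 0) (# 8) (# 9) (# 10) ∷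
  rootVector (# 8) (# 9) ∷
  rootVector (# 9) (# 10) ∷
  rootVector (# 10) (# 11) ∷
  rootVector (# 11) (# 12) ∷
  rootVector (# 12) (# 13) ∷
  rootVector (# 13) (# 14) ∷
  rootVector (# 14) (# 15) ∷ [])

basis₁∈ : ∀ j → InA15p (basis₁ j)
basis₁∈ j = lookup⁺ {P = InA15p} (
  rootVector∈ (# 1) (# 2) ∷
  rootVector∈ (# 6) (# 7) ∷
  rootVector∈ (# 5) (# 6) ∷
  quadVector∈ (# 1) (# 5) (# 14) (# 15) ∷
  quadVector∈ (# 0) (# 8) (# 9) (# 10) ∷
  rootVector∈ (# 8) (# 9) ∷
  rootVector∈ (# 9) (# 10) ∷
  rootVector∈ (# 10) (# 11) ∷
  rootVector∈ (# 11) (# 12) ∷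
  rootVector∈ (# 12) (# 13) ∷
  rootVector∈ (# 13) (# 14) ∷
  rootVector∈ (# 14) (# 15) ∷ []) j

-- The functionals avoid positions 2, 4, 7 and 15. On the complement the entries there are
-- determined by the remaining ones through the four linear conditions, and exactly these rows of
-- `relations₁` are nonzero. For the second lattice the positions are 2, 4, 6 and 15.
coordinates₁ : Fin 12 → V
coordinates₁ j = lookup (lookup (
  (+ 1 ∷ + 1 ∷ + 0 ∷ + 2 ∷ + 0 ∷ + 0 ∷ + 0 ∷ + 0 ∷ + 0 ∷ + 0 ∷ + 0 ∷ + 0 ∷ + 0 ∷ + 0 ∷ + 0 ∷ + 0 ∷ []) ∷
  (+ 1 ∷ + 0 ∷ + 0 ∷ + 1 ∷ + 0 ∷ + 1 ∷ + 1 ∷ + 0 ∷ + 0 ∷ + 0 ∷ + 0 ∷ + 0 ∷ + 0 ∷ + 0 ∷ + 0 ∷ + 0 ∷ []) ∷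
  (+ 1 ∷ + 0 ∷ + 0 ∷ + 2 ∷ + 0 ∷ + 1 ∷ + 0 ∷ + 0 ∷ + 0 ∷ + 0 ∷ + 0 ∷ + 0 ∷ + 0 ∷ + 0 ∷ + 0 ∷ + 0 ∷ []) ∷
  (+ 1 ∷ + 0 ∷ + 0 ∷ + 3 ∷ + 0 ∷ + 0 ∷ + 0 ∷ + 0 ∷ + 0 ∷ + 0 ∷ + 0 ∷ + 0 ∷ + 0 ∷ + 0 ∷ + 0 ∷ + 0 ∷ []) ∷
  (-[1+ 0 ] ∷ + 0 ∷ + 0 ∷ + 1 ∷ + 0 ∷ + 0 ∷ + 0 ∷ + 0 ∷ + 0 ∷ + 0 ∷ + 0 ∷ + 0 ∷ + 0 ∷ + 0 ∷ + 0 ∷ + 0 ∷ []) ∷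
  (-[1+ 0 ] ∷ + 0 ∷ + 0 ∷ + 0 ∷ + 0 ∷ + 0 ∷ + 0 ∷ + 0 ∷ + 1 ∷ + 0 ∷ + 0 ∷ + 0 ∷ + 0 ∷ + 0 ∷ + 0 ∷ + 0 ∷ []) ∷
  (-[1+ 1 ] ∷ + 0 ∷ + 0 ∷ + 0 ∷ + 0 ∷ + 0 ∷ + 0 ∷ + 0 ∷ + 1 ∷ + 1 ∷ + 0 ∷ + 0 ∷ + 0 ∷ + 0 ∷ + 0 ∷ + 0 ∷ []) ∷
  (-[1+ 2 ] ∷ + 0 ∷ + 0 ∷ + 0 ∷ + 0 ∷ + 0 ∷ + 0 ∷ + 0 ∷ + 1 ∷ + 1 ∷ + 1 ∷ + 0 ∷ + 0 ∷ + 0 ∷ + 0 ∷ + 0 ∷ []) ∷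
  (-[1+ 2 ] ∷ + 0 ∷ + 0 ∷ -[1+ 0 ] ∷ + 0 ∷ + 0 ∷ + 0 ∷ + 0 ∷ + 1 ∷ + 1 ∷ + 1 ∷ + 1 ∷ + 0 ∷ + 0 ∷ + 0 ∷ + 0 ∷ []) ∷
  (-[1+ 2 ] ∷ + 0 ∷ + 0 ∷ -[1+ 1 ] ∷ + 0 ∷ + 0 ∷ + 0 ∷ + 0 ∷ + 1 ∷ + 1 ∷ + 1 ∷ + 1 ∷ + 1 ∷ + 0 ∷ + 0 ∷ + 0 ∷ []) ∷
  (-[1+ 2 ] ∷ + 0 ∷ + 0 ∷ -[1+ 2 ] ∷ + 0 ∷ + 0 ∷ + 0 ∷ + 0 ∷ + 1 ∷ + 1 ∷ + 1 ∷ + 1 ∷ + 1 ∷ + 1 ∷ + 0 ∷ + 0 ∷ []) ∷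
  (-[1+ 1 ] ∷ + 0 ∷ + 0 ∷ -[1+ 0 ] ∷ + 0 ∷ + 0 ∷ + 0 ∷ + 0 ∷ + 1 ∷ + 1 ∷ + 1 ∷ + 1 ∷ + 1 ∷ + 1 ∷ + 1 ∷ + 0 ∷ []) ∷ []) j)

coordinateSums₁ : Vecℤ 12
coordinateSums₁ = lookup (+ 1 ∷ + 1 ∷ + 1 ∷ + 1 ∷ + 0 ∷ + 0 ∷ + 0 ∷ + 0 ∷ + 0 ∷ + 0 ∷ + 0 ∷ + 1 ∷ [])

relations₁ : Matℤ 16 4
relations₁ i = lookup (lookup (
  (+ 0 ∷ + 0 ∷ + 0 ∷ + 0 ∷ []) ∷
  (+ 0 ∷ + 0 ∷ + 0 ∷ + 0 ∷ []) ∷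
  (+ 1 ∷ -[1+ 0 ] ∷ + 0 ∷ + 0 ∷ []) ∷
  (+ 0 ∷ + 0 ∷ + 0 ∷ + 0 ∷ []) ∷
  (+ 0 ∷ + 1 ∷ -[1+ 0 ] ∷ + 0 ∷ []) ∷
  (+ 0 ∷ + 0 ∷ + 0 ∷ + 0 ∷ []) ∷
  (+ 0 ∷ + 0 ∷ + 0 ∷ + 0 ∷ []) ∷
  (+ 1 ∷ + 0 ∷ + 0 ∷ -[1+ 0 ] ∷ []) ∷
  (+ 0 ∷ + 0 ∷ + 0 ∷ + 0 ∷ []) ∷
  (+ 0 ∷ + 0 ∷ + 0 ∷ + 0 ∷ []) ∷
  (+ 0 ∷ + 0 ∷ + 0 ∷ + 0 ∷ []) ∷
  (+ 0 ∷ + 0 ∷ + 0 ∷ + 0 ∷ []) ∷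
  (+ 0 ∷ + 0 ∷ + 0 ∷ + 0 ∷ []) ∷
  (+ 0 ∷ + 0 ∷ + 0 ∷ + 0 ∷ []) ∷
  (+ 0 ∷ + 0 ∷ + 0 ∷ + 0 ∷ []) ∷
  (+ 2 ∷ + 0 ∷ + 1 ∷ + 1 ∷ []) ∷ []) i)

hasGram₁ : HasGram basis₁ (matrix gram₁)
hasGram₁ = from-yes (Fin.all? (λ i → Fin.all? (λ j → dot (basis₁ i) (basis₁ j) ≟ + 16 * matrix gram₁ i j)))

isBasis₁ : IsBasis (Perp (Span abc)) basis₁
isBasis₁ = basis-of-perp abc basis₁ coordinates₁ coordinateSums₁ relations₁ basis₁∈
  (from-yes (Fin.all? (λ j → Fin.all? (λ l → dot (basis₁ j) (abc l) ≟ + 0))))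
  (from-yes (Fin.all? (λ i → Fin.all? (λ j → dot (coordinates₁ i) (basis₁ j) ≟ + 4 * unit i j))))
  (from-yes (Fin.all? (λ j → sumF (coordinates₁ j) ≟ + 4 * coordinateSums₁ j)))
  (from-yes (Fin.all? (λ i → Fin.all? (λ m → + 4 * unit i m ≟
    sumF (λ j → basis₁ j i * coordinates₁ j m) + (relations₁ i zero + sumF (λ l → relations₁ i (suc l) * abc l m))))))

rankDet₁ : RankDet (Perp (Span abc)) 12 (+ 15)
rankDet₁ = basis₁ , matrix gram₁ , isBasis₁ , hasGram₁ , trans (det≡sparseDet (matrix gram₁)) refl

minimalNonIntegrable₁ : MinimalNonIntegrable 2 (Perp (Span abc))
minimalNonIntegrable₁ =
  non-integrable (Perp (Span abc)) basis₁ isBasis₁ gram₁ hasGram₁ certificate₁ ,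
  minimal (Perp (Span abc)) basis₁ isBasis₁ gram₁ hasGram₁ certificate₁

basis₂ : Fin 12 → V
basis₂ = lookup (
  rootVector (# 1) (# 2) ∷
  rootVector (# 0) (# 1) ∷
  rootVector (# 5) (# 6) ∷
  quadVector (# 0) (# 5) (# 7) (# 8) ∷
  rootVector (# 7) (# 8) ∷
  rootVector (# 8) (# 9) ∷
  rootVector (# 9) (# 10) ∷
  rootVector (# 10) (# 11) ∷
  rootVector (# 11) (# 12) ∷
  rootVector (# 12) (# 13) ∷
  rootVector (# 13) (# 14) ∷
  rootVector (# 14) (# 15) ∷ [])

basis₂∈ : ∀ j → InA15p (basis₂ j)
basis₂∈ j = lookup⁺ {P = InA15p} (
  rootVector∈ (# 1) (# 2) ∷
  rootVector∈ (# 0) (# 1) ∷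
  rootVector∈ (# 5) (# 6) ∷
  quadVector∈ (# 0) (# 5) (# 7) (# 8) ∷
  rootVector∈ (# 7) (# 8) ∷
  rootVector∈ (# 8) (# 9) ∷
  rootVector∈ (# 9) (# 10) ∷
  rootVector∈ (# 10) (# 11) ∷
  rootVector∈ (# 11) (# 12) ∷
  rootVector∈ (# 12) (# 13) ∷
  rootVector∈ (# 13) (# 14) ∷
  rootVector∈ (# 14) (# 15) ∷ []) j

coordinates₂ : Fin 12 → V
coordinates₂ j = lookup (lookup (
  (+ 1 ∷ + 1 ∷ + 0 ∷ + 2 ∷ + 0 ∷ + 0 ∷ + 0 ∷ + 0 ∷ + 0 ∷ + 0 ∷ + 0 ∷ + 0 ∷ + 0 ∷ + 0 ∷ + 0 ∷ + 0 ∷ []) ∷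
  (+ 1 ∷ + 0 ∷ + 0 ∷ + 3 ∷ + 0 ∷ + 0 ∷ + 0 ∷ + 0 ∷ + 0 ∷ + 0 ∷ + 0 ∷ + 0 ∷ + 0 ∷ + 0 ∷ + 0 ∷ + 0 ∷ []) ∷
  (+ 0 ∷ + 0 ∷ + 0 ∷ + 3 ∷ + 0 ∷ + 1 ∷ + 0 ∷ + 0 ∷ + 0 ∷ + 0 ∷ + 0 ∷ + 0 ∷ + 0 ∷ + 0 ∷ + 0 ∷ + 0 ∷ []) ∷
  (+ 0 ∷ + 0 ∷ + 0 ∷ + 4 ∷ + 0 ∷ + 0 ∷ + 0 ∷ + 0 ∷ + 0 ∷ + 0 ∷ + 0 ∷ + 0 ∷ + 0 ∷ + 0 ∷ + 0 ∷ + 0 ∷ []) ∷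
  (+ 0 ∷ + 0 ∷ + 0 ∷ + 3 ∷ + 0 ∷ + 0 ∷ + 0 ∷ + 1 ∷ + 0 ∷ + 0 ∷ + 0 ∷ + 0 ∷ + 0 ∷ + 0 ∷ + 0 ∷ + 0 ∷ []) ∷
  (+ 0 ∷ + 0 ∷ + 0 ∷ + 6 ∷ + 0 ∷ + 0 ∷ + 0 ∷ + 1 ∷ + 1 ∷ + 0 ∷ + 0 ∷ + 0 ∷ + 0 ∷ + 0 ∷ + 0 ∷ + 0 ∷ []) ∷
  (+ 0 ∷ + 0 ∷ + 0 ∷ + 5 ∷ + 0 ∷ + 0 ∷ + 0 ∷ + 1 ∷ + 1 ∷ + 1 ∷ + 0 ∷ + 0 ∷ + 0 ∷ + 0 ∷ + 0 ∷ + 0 ∷ []) ∷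
  (+ 0 ∷ + 0 ∷ + 0 ∷ + 4 ∷ + 0 ∷ + 0 ∷ + 0 ∷ + 1 ∷ + 1 ∷ + 1 ∷ + 1 ∷ + 0 ∷ + 0 ∷ + 0 ∷ + 0 ∷ + 0 ∷ []) ∷
  (+ 0 ∷ + 0 ∷ + 0 ∷ + 3 ∷ + 0 ∷ + 0 ∷ + 0 ∷ + 1 ∷ + 1 ∷ + 1 ∷ + 1 ∷ + 1 ∷ + 0 ∷ + 0 ∷ + 0 ∷ + 0 ∷ []) ∷
  (+ 0 ∷ + 0 ∷ + 0 ∷ + 2 ∷ + 0 ∷ + 0 ∷ + 0 ∷ + 1 ∷ + 1 ∷ + 1 ∷ + 1 ∷ + 1 ∷ + 1 ∷ + 0 ∷ + 0 ∷ + 0 ∷ []) ∷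
  (+ 0 ∷ + 0 ∷ + 0 ∷ + 1 ∷ + 0 ∷ + 0 ∷ + 0 ∷ + 1 ∷ + 1 ∷ + 1 ∷ + 1 ∷ + 1 ∷ + 1 ∷ + 1 ∷ + 0 ∷ + 0 ∷ []) ∷
  (+ 0 ∷ + 0 ∷ + 0 ∷ + 0 ∷ + 0 ∷ + 0 ∷ + 0 ∷ + 1 ∷ + 1 ∷ + 1 ∷ + 1 ∷ + 1 ∷ + 1 ∷ + 1 ∷ + 1 ∷ + 0 ∷ []) ∷ []) j)

coordinateSums₂ : Vecℤ 12
coordinateSums₂ = lookup (+ 1 ∷ + 1 ∷ + 1 ∷ + 1 ∷ + 1 ∷ + 2 ∷ + 2 ∷ + 2 ∷ + 2 ∷ + 2 ∷ + 2 ∷ + 2 ∷ [])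

relations₂ : Matℤ 16 4
relations₂ i = lookup (lookup (
  (+ 0 ∷ + 0 ∷ + 0 ∷ + 0 ∷ []) ∷
  (+ 0 ∷ + 0 ∷ + 0 ∷ + 0 ∷ []) ∷
  (+ 1 ∷ -[1+ 0 ] ∷ + 0 ∷ + 0 ∷ []) ∷
  (+ 0 ∷ + 0 ∷ + 0 ∷ + 0 ∷ []) ∷
  (+ 0 ∷ + 1 ∷ -[1+ 0 ] ∷ + 0 ∷ []) ∷
  (+ 0 ∷ + 0 ∷ + 0 ∷ + 0 ∷ []) ∷
  (+ 1 ∷ -[1+ 0 ] ∷ + 1 ∷ -[1+ 0 ] ∷ []) ∷
  (+ 0 ∷ + 0 ∷ + 0 ∷ + 0 ∷ []) ∷
  (+ 0 ∷ + 0 ∷ + 0 ∷ + 0 ∷ []) ∷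
  (+ 0 ∷ + 0 ∷ + 0 ∷ + 0 ∷ []) ∷
  (+ 0 ∷ + 0 ∷ + 0 ∷ + 0 ∷ []) ∷
  (+ 0 ∷ + 0 ∷ + 0 ∷ + 0 ∷ []) ∷
  (+ 0 ∷ + 0 ∷ + 0 ∷ + 0 ∷ []) ∷
  (+ 0 ∷ + 0 ∷ + 0 ∷ + 0 ∷ []) ∷
  (+ 0 ∷ + 0 ∷ + 0 ∷ + 0 ∷ []) ∷
  (+ 2 ∷ + 1 ∷ + 0 ∷ + 1 ∷ []) ∷ []) i)

hasGram₂ : HasGram basis₂ (matrix gram₂)
hasGram₂ = from-yes (Fin.all? (λ i → Fin.all? (λ j → dot (basis₂ i) (basis₂ j) ≟ + 16 * matrix gram₂ i j)))

isBasis₂ : IsBasis (Perp (Span abc')) basis₂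
isBasis₂ = basis-of-perp abc' basis₂ coordinates₂ coordinateSums₂ relations₂ basis₂∈
  (from-yes (Fin.all? (λ j → Fin.all? (λ l → dot (basis₂ j) (abc' l) ≟ + 0))))
  (from-yes (Fin.all? (λ i → Fin.all? (λ j → dot (coordinates₂ i) (basis₂ j) ≟ + 4 * unit i j))))
  (from-yes (Fin.all? (λ j → sumF (coordinates₂ j) ≟ + 4 * coordinateSums₂ j)))
  (from-yes (Fin.all? (λ i → Fin.all? (λ m → + 4 * unit i m ≟
    sumF (λ j → basis₂ j i * coordinates₂ j m) + (relations₂ i zero + sumF (λ l → relations₂ i (suc l) * abc' l m))))))

rankDet₂ : RankDet (Perp (Span abc')) 12 (+ 15)
rankDet₂ = basis₂ , matrix gram₂ , isBasis₂ , hasGram₂ , trans (det≡sparseDet (matrix gram₂)) refl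

minimalNonIntegrable₂ : MinimalNonIntegrable 2 (Perp (Span abc'))
minimalNonIntegrable₂ =
  non-integrable (Perp (Span abc')) basis₂ isBasis₂ gram₂ hasGram₂ certificate₂ ,
  minimal (Perp (Span abc')) basis₂ isBasis₂ gram₂ hasGram₂ certificate₂

-- Norms in the four cosets of A₁₅

pronic-nonneg : ∀ u → + 0 ≤ u * (u + + 1)
pronic-nonneg (+ n) = nonneg-* {+ n} {+ n + + 1} (+≤+ z≤n) (+≤+ z≤n)
pronic-nonneg -[1+ 0 ] = ≤-refl
pronic-nonneg -[1+ suc n ] = +≤+ z≤n

pronic-even : ∀ u → Σ ℤ λ w → u * (u + + 1) ≡ + 2 * w
pronic-even u with u %ℕ 2 | n%ℕd<d u 2 | a≡a%ℕn+[a/ℕn]*n u 2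
... | 0 | _ | e = _ , trans (cong (λ z → z * (z + + 1)) e) (ring (u /ℕ 2))
  where
  ring : ∀ q → (+ 0 + q * + 2) * (+ 0 + q * + 2 + + 1) ≡ + 2 * (q * (q * + 2 + + 1))
  ring = solve-∀
... | 1 | _ | e = _ , trans (cong (λ z → z * (z + + 1)) e) (ring (u /ℕ 2))
  where
  ring : ∀ q → (+ 1 + q * + 2) * (+ 1 + q * + 2 + + 1) ≡ + 2 * ((+ 1 + q * + 2) * (q + + 1))
  ring = solve-∀
... | suc (suc _) | s≤s (s≤s ()) | _

pronic-root : ∀ u → u * (u + + 1) ≡ + 0 → u ≡ + 0 ⊎ u ≡ -[1+ 0 ]
pronic-root u e with i*j≡0⇒i≡0∨j≡0 u e
... | inj₁ p = inj₁ p
... | inj₂ p = inj₂ (trans (ring u) (cong (λ z → z - + 1) p))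
  where
  ring : ∀ u → u ≡ u + + 1 - + 1
  ring = solve-∀

data Residue (x : V) : Set where
  0mod4  : ∀ (u : V) → (∀ i → x i ≡ + 4 * u i) → Residue x
  1mod4  : ∀ (u : V) → (∀ i → x i ≡ + 1 + + 4 * u i) → Residue x
  2mod4  : ∀ (u : V) → (∀ i → x i ≡ + 2 + + 4 * u i) → Residue x
  -1mod4 : ∀ (u : V) → (∀ i → x i ≡ - (+ 1 + + 4 * u i)) → Residue x

residue : ∀ {x} → Glued x → Residue x
residue {x} (_ , r , u , e) with r %ℕ 4 | n%ℕd<d r 4 | a≡a%ℕn+[a/ℕn]*n r 4
... | 0 | _ | e' = 0mod4 (λ i → q + u i) (λ i → trans (e i) (trans (cong (λ z → z + + 4 * u i) e') (ring q (u i))))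
  where
  q = r /ℕ 4
  ring : ∀ q u → + 0 + q * + 4 + + 4 * u ≡ + 4 * (q + u)
  ring = solve-∀
... | 1 | _ | e' = 1mod4 (λ i → q + u i) (λ i → trans (e i) (trans (cong (λ z → z + + 4 * u i) e') (ring q (u i))))
  where
  q = r /ℕ 4
  ring : ∀ q u → + 1 + q * + 4 + + 4 * u ≡ + 1 + + 4 * (q + u)
  ring = solve-∀
... | 2 | _ | e' = 2mod4 (λ i → q + u i) (λ i → trans (e i) (trans (cong (λ z → z + + 4 * u i) e') (ring q (u i))))
  where
  q = r /ℕ 4
  ring : ∀ q u → + 2 + q * + 4 + + 4 * u ≡ + 2 + + 4 * (q + u)
  ring = solve-∀
... | 3 | _ | e' = -1mod4 (λ i → - (q + u i + + 1)) (λ i → trans (e i) (trans (cong (λ z → z + + 4 * u i) e') (ring q (u i))))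
  where
  q = r /ℕ 4
  ring : ∀ q u → + 3 + q * + 4 + + 4 * u ≡ - (+ 1 + + 4 * - (q + u + + 1))
  ring = solve-∀
... | suc (suc (suc (suc _))) | s≤s (s≤s (s≤s (s≤s ()))) | _

pronicSum : ∀ {n} → Vecℤ n → ℤ
pronicSum u = sumF (λ i → u i * (u i + + 1))

pronicSum-nonneg : ∀ {n} (u : Vecℤ n) → + 0 ≤ pronicSum u
pronicSum-nonneg u = sumF-nonneg (λ i → u i * (u i + + 1)) (λ i → pronic-nonneg (u i))

norm-0mod4 : ∀ {x u : V} → (∀ i → x i ≡ + 4 * u i) → dot x x ≡ + 16 * dot u u
norm-0mod4 {x} {u} e = trans (sumF-cong (λ i → trans (cong₂ _*_ (e i) (e i)) (ring (u i)))) (sumF-*ˡ (+ 16) (λ i → u i * u i))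
  where
  ring : ∀ u → + 4 * u * (+ 4 * u) ≡ + 16 * (u * u)
  ring = solve-∀

-- Each xᵢ² is 3 - 2 xᵢ + 16 uᵢ (uᵢ + 1), and the linear terms cancel because Σ x = 0. So the true
-- norm in this coset is at least 48 / 16 = 3, with equality only when all entries are 1 or -3.
norm-1mod4 : ∀ {x u : V} → sumF x ≡ + 0 → (∀ i → x i ≡ + 1 + + 4 * u i) → dot x x ≡ + 48 + + 16 * pronicSum u
norm-1mod4 {x} {u} Σx e = begin
  dot x x
    ≡⟨ sumF-cong (λ i → trans (cong₂ _*_ (e i) (e i)) (trans (ring (u i))
         (cong (λ z → + 3 + (-[1+ 1 ] * z + + 16 * (u i * (u i + + 1)))) (sym (e i))))) ⟩
  sumF (λ i → + 3 + (-[1+ 1 ] * x i + + 16 * (u i * (u i + + 1))))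
    ≡⟨ sumF-+ (λ _ → + 3) (λ i → -[1+ 1 ] * x i + + 16 * (u i * (u i + + 1))) ⟩
  + 48 + sumF (λ i → -[1+ 1 ] * x i + + 16 * (u i * (u i + + 1)))
    ≡⟨ cong (λ z → + 48 + z) (sumF-+ (λ i → -[1+ 1 ] * x i) (λ i → + 16 * (u i * (u i + + 1)))) ⟩
  + 48 + (sumF (λ i → -[1+ 1 ] * x i) + sumF (λ i → + 16 * (u i * (u i + + 1))))
    ≡⟨ cong₂ (λ p q → + 48 + (p + q)) (trans (sumF-*ˡ -[1+ 1 ] x) (cong (-[1+ 1 ] *_) Σx)) (sumF-*ˡ (+ 16) (λ i → u i * (u i + + 1))) ⟩
  + 48 + (+ 0 + + 16 * pronicSum u)
    ≡⟨ cong (λ z → + 48 + z) (+-identityˡ (+ 16 * pronicSum u)) ⟩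
  + 48 + + 16 * pronicSum u ∎
  where
  open ≡-Reasoning
  ring : ∀ u → (+ 1 + + 4 * u) * (+ 1 + + 4 * u) ≡ + 3 + (-[1+ 1 ] * (+ 1 + + 4 * u) + + 16 * (u * (u + + 1)))
  ring = solve-∀

norm-2mod4 : ∀ {x u : V} → (∀ i → x i ≡ + 2 + + 4 * u i) → dot x x ≡ + 64 + + 16 * pronicSum u
norm-2mod4 {x} {u} e = trans (sumF-cong (λ i → trans (cong₂ _*_ (e i) (e i)) (ring (u i))))
  (trans (sumF-+ (λ _ → + 4) (λ i → + 16 * (u i * (u i + + 1)))) (cong (λ z → + 64 + z) (sumF-*ˡ (+ 16) (λ i → u i * (u i + + 1)))))
  where
  ring : ∀ u → (+ 2 + + 4 * u) * (+ 2 + + 4 * u) ≡ + 4 + + 16 * (u * (u + + 1))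
  ring = solve-∀

neg-vec : ∀ {x u : V} → (∀ i → x i ≡ - (+ 1 + + 4 * u i)) → ∀ i → - x i ≡ + 1 + + 4 * u i
neg-vec {x} {u} e i = trans (cong -_ (e i)) (neg-involutive _)

dot-neg : ∀ {n} (x : Vecℤ n) → dot (λ i → - x i) (λ i → - x i) ≡ dot x x
dot-neg x = sumF-cong (λ i → ring (x i))
  where
  ring : ∀ x → - x * - x ≡ x * x
  ring = solve-∀

sum-neg≡0 : ∀ {x : V} → sumF x ≡ + 0 → sumF (λ i → - x i) ≡ + 0
sum-neg≡0 {x} Σx = trans (sumF-neg x) (cong -_ Σx)

offset-≤ : ∀ (u : V) k → k ≤ k + + 16 * pronicSum u
offset-≤ u k = subst (_≤ k + + 16 * pronicSum u) (+-identityʳ k) (+-monoʳ-≤ k (nonneg-* {+ 16} (+≤+ z≤n) (pronicSum-nonneg u)))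

private
  too-big : ∀ {m n} {u : V} → + n ≡ + m + + 16 * pronicSum u → ¬ (+ m ≤ + n) → ⊥
  too-big {m} {n} {u} e m≰n = m≰n (subst (+ m ≤_) (sym e) (offset-≤ u (+ m)))

-- Vectors of norm 3

offset-0 : ∀ (u : V) → + 48 ≡ + 48 + + 16 * pronicSum u → ∀ i → u i ≡ + 0 ⊎ u i ≡ -[1+ 0 ]
offset-0 u e i = pronic-root (u i) (sumF≡0⇒≡0 (λ i → u i * (u i + + 1)) (λ i → pronic-nonneg (u i))
  (*-cancelˡ-≡ (+ 16) (pronicSum u) (+ 0) (trans (ring (+ 16 * pronicSum u)) (cong (λ z → z - + 48) (sym e)))) i)
  where
  ring : ∀ z → z ≡ + 48 + z - + 48
  ring = solve-∀

Sign± : ℤ → Set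
Sign± ε = ε ≡ + 1 ⊎ ε ≡ -[1+ 0 ]

Binary : V → Set
Binary s = ∀ i → s i ≡ + 0 ⊎ s i ≡ + 1

norm3 : ∀ {x} → InA15p x → dot x x ≡ + 48 →
  Σ ℤ λ ε → Σ V λ s → Sign± ε × Binary s × (∀ i → x i ≡ ε * (+ 1 - + 4 * s i))
norm3 {x} x∈ n = by (residue (glued x∈))
  where
  Σx = proj₁ (glued x∈)
  flip : ∀ (u : V) → (∀ i → u i ≡ + 0 ⊎ u i ≡ -[1+ 0 ]) → Binary (λ i → - u i)
  flip u h i with h i
  ... | inj₁ p = inj₁ (cong -_ p)
  ... | inj₂ p = inj₂ (cong -_ p)
  by : Residue x → Σ ℤ λ ε → Σ V λ s → Sign± ε × Binary s × (∀ i → x i ≡ ε * (+ 1 - + 4 * s i))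
  -- From u · u = 3 and Σ u = 0 follows Σ uᵢ (uᵢ + 1) = 3, a sum of even numbers.
  by (0mod4 u e) = ⊥-elim (odd (proj₁ half) (trans (sym Σpronic) (proj₂ half)))
    where
    Σu : sumF u ≡ + 0
    Σu = *-cancelˡ-≡ (+ 4) (sumF u) (+ 0) (trans (sym (sumF-*ˡ (+ 4) u)) (trans (sumF-cong (λ i → sym (e i))) Σx))
    uu : dot u u ≡ + 3
    uu = *-cancelˡ-≡ (+ 16) (dot u u) (+ 3) (trans (sym (norm-0mod4 {x} {u} e)) n)
    Σpronic : pronicSum u ≡ + 3
    Σpronic = trans (sumF-cong (λ i → trans (*-distribˡ-+ (u i) (u i) (+ 1)) (cong (λ z → u i * u i + z) (*-identityʳ (u i)))))
      (trans (sumF-+ (λ i → u i * u i) u) (cong₂ _+_ uu Σu))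
    half : Σ ℤ λ w → pronicSum u ≡ + 2 * w
    half = sumF (λ i → proj₁ (pronic-even (u i))) ,
      trans (sumF-cong (λ i → proj₂ (pronic-even (u i)))) (sumF-*ˡ (+ 2) (λ i → proj₁ (pronic-even (u i))))
    odd : ∀ w → + 3 ≢ + 2 * w
    odd (+ 0) ()
    odd (+ 1) ()
    odd (+ suc (suc w)) p = ≤⇒≯ (≤-reflexive (sym p)) 
      (<-≤-trans (+<+ (s≤s (s≤s (s≤s (s≤s z≤n))))) (*-monoˡ-≤-nonNeg (+ 2) (+≤+ {2} {suc (suc w)} (s≤s (s≤s z≤n)))))
    odd -[1+ w ] ()
  by (1mod4 u e) = + 1 , (λ i → - u i) , inj₁ refl ,
    flip u (offset-0 u (trans (sym n) (norm-1mod4 {x} {u} Σx e))) , λ i → trans (e i) (ring (u i))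
    where
    ring : ∀ u → + 1 + + 4 * u ≡ + 1 * (+ 1 - + 4 * - u)
    ring = solve-∀
  by (2mod4 u e) = ⊥-elim (too-big {64} {48} {u} (trans (sym n) (norm-2mod4 {x} {u} e)) (<⇒≱ (+<+ (ℕ.<ᵇ⇒< 48 64 _))))
  by (-1mod4 u e) = -[1+ 0 ] , (λ i → - u i) , inj₂ refl ,
    flip u (offset-0 u (trans (sym (trans (dot-neg x) n)) (norm-1mod4 {λ i → - x i} {u} (sum-neg≡0 {x} Σx) (neg-vec {x} {u} e)))) ,
    λ i → trans (e i) (ring (u i))
    where
    ring : ∀ u → - (+ 1 + + 4 * u) ≡ -[1+ 0 ] * (+ 1 - + 4 * - u)
    ring = solve-∀

-- Vectors of norm 2

small-square : ∀ x → x * x ≤ + 3 → x ≡ + 0 ⊎ x ≡ + 1 ⊎ x ≡ -[1+ 0 ]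
small-square (+ 0) _ = inj₁ refl
small-square (+ 1) _ = inj₂ (inj₁ refl)
small-square (+ suc (suc n)) (+≤+ le) = ⊥-elim (ℕ.<⇒≱ (ℕ.*-mono-≤ (2≤ n) (2≤ n)) le)
  where
  2≤ : ∀ n → 2 ℕ.≤ suc (suc n)
  2≤ n = s≤s (s≤s z≤n)
small-square -[1+ 0 ] _ = inj₂ (inj₂ refl)
small-square -[1+ suc n ] (+≤+ le) = ⊥-elim (ℕ.<⇒≱ (ℕ.*-mono-≤ (2≤ n) (2≤ n)) le)
  where
  2≤ : ∀ n → 2 ℕ.≤ suc (suc n)
  2≤ n = s≤s (s≤s z≤n)

private
  head-square : ∀ {n k} (u : Vecℤ (suc n)) → k ≤ + 3 → dot u u ≡ k →
    u zero ≡ + 0 ⊎ u zero ≡ + 1 ⊎ u zero ≡ -[1+ 0 ]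
  head-square u k≤3 e = small-square (u zero)
    (≤-trans (term≤sumF (λ i → u i * u i) (λ i → 0≤i*i (u i)) zero) (≤-trans (≤-reflexive e) k≤3))

  rest≡ : ∀ {x y z} (w : ℤ) → x ≡ w → x * x + y ≡ z → y ≡ z - w * w
  rest≡ {x} {y} w refl e = trans (ring x y) (cong (λ s → s - x * x) e)
    where
    ring : ∀ x y → y ≡ x * x + y - x * x
    ring = solve-∀

norm1-unit : ∀ {n} (u : Vecℤ n) → dot u u ≡ + 1 → Σ (Fin n) λ i → (∀ k → u k ≡ unit i k) ⊎ (∀ k → u k ≡ - unit i k)
norm1-unit {suc n} u e with head-square u (+≤+ (s≤s z≤n)) e
... | inj₁ p = extend (norm1-unit (λ i → u (suc i)) (rest≡ (+ 0) p e))
  where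
  extend : Σ (Fin n) (λ i → (∀ k → u (suc k) ≡ unit i k) ⊎ (∀ k → u (suc k) ≡ - unit i k)) → _
  extend (i , inj₁ h) = suc i , inj₁ λ { zero → p ; (suc k) → h k }
  extend (i , inj₂ h) = suc i , inj₂ λ { zero → p ; (suc k) → h k }
... | inj₂ (inj₁ p) = zero , inj₁ λ { zero → p ; (suc k) → dot≡0⇒≡0 (λ i → u (suc i)) (rest≡ (+ 1) p e) k }
... | inj₂ (inj₂ p) = zero , inj₂ λ { zero → p ; (suc k) → dot≡0⇒≡0 (λ i → u (suc i)) (rest≡ -[1+ 0 ] p e) k }

norm2-difference : ∀ {n} (u : Vecℤ n) → dot u u ≡ + 2 → sumF u ≡ + 0 →
  Σ (Fin n) λ i → Σ (Fin n) λ j → ∀ k → u k ≡ unit i k - unit j k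
norm2-difference {suc n} u e s with head-square u (+≤+ (s≤s (s≤s z≤n))) e
... | inj₁ p = extend (norm2-difference (λ i → u (suc i)) (rest≡ (+ 0) p e)
                 (trans (sym (+-identityˡ _)) (trans (cong (λ z → z + sumF (λ i → u (suc i))) (sym p)) s)))
  where
  extend : Σ (Fin n) (λ i → Σ (Fin n) λ j → ∀ k → u (suc k) ≡ unit i k - unit j k) → _
  extend (i , j , h) = suc i , suc j , λ { zero → p ; (suc k) → h k }
... | inj₂ (inj₁ p) = extend (norm1-unit (λ i → u (suc i)) (rest≡ (+ 1) p e))
  where
  extend : Σ (Fin n) (λ i → (∀ k → u (suc k) ≡ unit i k) ⊎ (∀ k → u (suc k) ≡ - unit i k)) → _
  extend (i , inj₁ h) = ⊥-elim (2≢0 (trans (sym (cong₂ _+_ p (trans (sumF-cong h) (sumF-unit i)))) s))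
    where
    2≢0 : + 2 ≢ + 0
    2≢0 ()
  extend (i , inj₂ h) = zero , suc i , λ { zero → p ; (suc k) → trans (h k) (sym (+-identityˡ _)) }
... | inj₂ (inj₂ p) = extend (norm1-unit (λ i → u (suc i)) (rest≡ -[1+ 0 ] p e))
  where
  extend : Σ (Fin n) (λ i → (∀ k → u (suc k) ≡ unit i k) ⊎ (∀ k → u (suc k) ≡ - unit i k)) → _
  extend (i , inj₁ h) = suc i , zero , λ { zero → p ; (suc k) → trans (h k) (sym (+-identityʳ _)) }
  extend (i , inj₂ h) = ⊥-elim (-2≢0 (trans (sym (cong₂ _+_ p
      (trans (sumF-cong h) (trans (sumF-neg (unit i)) (cong -_ (sumF-unit i)))))) s))
    where
    -2≢0 : -[1+ 1 ] ≢ + 0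
    -2≢0 ()

norm2-root : ∀ {x} → InA15p x → dot x x ≡ + 32 → Σ (Fin 16) λ i → Σ (Fin 16) λ j → x ≈ rootVector i j
norm2-root {x} x∈ n = by (residue (glued x∈))
  where
  Σx = proj₁ (glued x∈)
  by : Residue x → Σ (Fin 16) λ i → Σ (Fin 16) λ j → x ≈ rootVector i j
  by (0mod4 u e) = widen (norm2-difference u
      (*-cancelˡ-≡ (+ 16) (dot u u) (+ 2) (trans (sym (norm-0mod4 {x} {u} e)) n))
      (*-cancelˡ-≡ (+ 4) (sumF u) (+ 0) (trans (sym (sumF-*ˡ (+ 4) u)) (trans (sumF-cong (λ i → sym (e i))) Σx))))
    where
    widen : Σ (Fin 16) (λ i → Σ (Fin 16) λ j → ∀ k → u k ≡ unit i k - unit j k) → Σ (Fin 16) λ i → Σ (Fin 16) λ j → x ≈ rootVector i j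
    widen (i , j , h) = i , j , λ k → trans (e k) (cong (+ 4 *_) (h k))
  by (1mod4 u e) = ⊥-elim (too-big {48} {32} {u} (trans (sym n) (norm-1mod4 {x} {u} Σx e)) (<⇒≱ (+<+ (ℕ.<ᵇ⇒< 32 48 _))))
  by (2mod4 u e) = ⊥-elim (too-big {64} {32} {u} (trans (sym n) (norm-2mod4 {x} {u} e)) (<⇒≱ (+<+ (ℕ.<ᵇ⇒< 32 64 _))))
  by (-1mod4 u e) = ⊥-elim (too-big {48} {32} {u}
    (trans (sym (trans (dot-neg x) n)) (norm-1mod4 {λ i → - x i} {u} (sum-neg≡0 {x} Σx) (neg-vec {x} {u} e)))
    (<⇒≱ (+<+ (ℕ.<ᵇ⇒< 32 48 _))))

unit-refl : ∀ {n} (i : Fin n) → unit i i ≡ + 1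
unit-refl zero    = refl
unit-refl (suc i) = unit-refl i

unit-≢ : ∀ {n} {i j : Fin n} → i ≢ j → unit i j ≡ + 0
unit-≢ {i = zero}  {zero}  ne = ⊥-elim (ne refl)
unit-≢ {i = zero}  {suc j} ne = refl
unit-≢ {i = suc i} {zero}  ne = refl
unit-≢ {i = suc i} {suc j} ne = unit-≢ (λ e → ne (cong suc e))

difference-1 : ∀ {n} (i j k : Fin n) → unit i k - unit j k ≡ + 1 → i ≡ k
difference-1 i j k e with i Fin.≟ k | j Fin.≟ k
... | yes p | _        = p
... | no p  | yes refl = ⊥-elim (-1≢1 (trans (sym (cong₂ _-_ (unit-≢ p) (unit-refl k))) e))
  where
  -1≢1 : -[1+ 0 ] ≢ + 1
  -1≢1 ()
... | no p  | no q     = ⊥-elim (0≢1 (trans (sym (cong₂ _-_ (unit-≢ p) (unit-≢ q))) e))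
  where
  0≢1 : + 0 ≢ + 1
  0≢1 ()

difference-injective : ∀ {n} {i j i' j' : Fin n} → i ≢ j → (∀ k → unit i k - unit j k ≡ unit i' k - unit j' k) → i ≡ i' × j ≡ j'
difference-injective {i = i} {j} {i'} {j'} i≢j h =
  sym (difference-1 i' j' i (trans (sym (h i)) (cong₂ _-_ (unit-refl i) (unit-≢ (λ e → i≢j (sym e)))))) ,
  sym (difference-1 j' i' j (trans (ring (unit j' j) (unit i' j)) (cong -_ (trans (sym (h j)) (cong₂ _-_ (unit-≢ i≢j) (unit-refl j))))))
  where
  ring : ∀ p q → p - q ≡ - (q - p)
  ring = solve-∀

dot-rootVector : ∀ i j (y : V) → dot (rootVector i j) y ≡ + 4 * (y i - y j)
dot-rootVector i j y = begin
  sumF (λ k → + 4 * (unit i k - unit j k) * y k)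
    ≡⟨ sumF-cong (λ k → ring (unit i k) (unit j k) (y k)) ⟩
  sumF (λ k → + 4 * (unit i k * y k + - (unit j k * y k)))
    ≡⟨ sumF-*ˡ (+ 4) (λ k → unit i k * y k + - (unit j k * y k)) ⟩
  + 4 * sumF (λ k → unit i k * y k + - (unit j k * y k))
    ≡⟨ cong (+ 4 *_) (trans (sumF-+ (λ k → unit i k * y k) (λ k → - (unit j k * y k)))
         (cong₂ _+_ (dot-unitˡ i y) (trans (sumF-neg (λ k → unit j k * y k)) (cong -_ (dot-unitˡ j y))))) ⟩
  + 4 * (y i - y j) ∎
  where
  open ≡-Reasoning
  ring : ∀ p q y → + 4 * (p - q) * y ≡ + 4 * (p * y + - (q * y))
  ring = solve-∀

norm-rootVector : ∀ {i j} → i ≢ j → dot (rootVector i j) (rootVector i j) ≡ + 32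
norm-rootVector {i} {j} i≢j = trans (dot-rootVector i j (rootVector i j)) (cong (+ 4 *_)
  (cong₂ (λ p q → + 4 * p - + 4 * q) (cong₂ _-_ (unit-refl i) (unit-≢ (λ e → i≢j (sym e)))) (cong₂ _-_ (unit-≢ i≢j) (unit-refl j))))

-- Root counts and non-isometry

IsRoot : (Fin 3 → V) → Fin 16 × Fin 16 → Set
IsRoot v (i , j) = i ≢ j × (∀ l → v l i ≡ v l j)

isRoot? : ∀ v p → Dec (IsRoot v p)
isRoot? v (i , j) = ¬? (i Fin.≟ j) ×-dec Fin.all? (λ l → v l i ≟ v l j)

allPairs : List (Fin 16 × Fin 16)
allPairs = cartesianProduct (allFin 16) (allFin 16)

roots : (Fin 3 → V) → List (Fin 16 × Fin 16)
roots v = filter (isRoot? v) allPairs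

roots-unique : ∀ v → Unique (roots v)
roots-unique v = filter⁺ (isRoot? v) (cartesianProduct⁺ (allFin⁺ 16) (allFin⁺ 16))

lookup-injective : ∀ {A : Set} {xs : List A} → Unique xs → ∀ p q → List.lookup xs p ≡ List.lookup xs q → p ≡ q
lookup-injective {xs = x ∷ xs} (_ ∷ _)   zero    zero    _ = refl
lookup-injective {xs = x ∷ xs} (ne ∷ _)  zero    (suc q) e = ⊥-elim (All.lookup ne (∈-lookup q) e)
lookup-injective {xs = x ∷ xs} (ne ∷ _)  (suc p) zero    e = ⊥-elim (All.lookup ne (∈-lookup p) (sym e))
lookup-injective {xs = x ∷ xs} (_ ∷ un)  (suc p) (suc q) e = cong suc (lookup-injective un p q e)

root⇒perp : ∀ v i j → IsRoot v (i , j) → Perp (Span v) (rootVector i j)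
root⇒perp v i j (_ , same) = orth⇒perp v (rootVector∈ i j) λ l →
  trans (dot-rootVector i j (v l)) (cong (+ 4 *_) (trans (cong (λ z → z - v l j) (same l)) (+-inverseʳ (v l j))))

perp⇒root : ∀ v {x} → Perp (Span v) x → dot x x ≡ + 32 →
  Σ (Fin 16 × Fin 16) λ p → p ∈ roots v × x ≈ rootVector (proj₁ p) (proj₂ p)
perp⇒root v {x} x∈ n with norm2-root (proj₁ x∈) n
... | i , j , e = (i , j) , ∈-filter⁺ (isRoot? v) (∈-cartesianProduct⁺ (∈-allFin i) (∈-allFin j)) (i≢j , same) , e
  where
  i≢j : i ≢ j
  i≢j refl = 0≢32 (trans (sym (dot-0ˡ x (λ k → trans (e k) (cong (+ 4 *_) (+-inverseʳ (unit i k)))))) n)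
    where
    0≢32 : + 0 ≢ + 32
    0≢32 ()
  same : ∀ l → v l i ≡ v l j
  same l = i-j≡0⇒i≡j (v l i) (v l j) (*-cancelˡ-≡ (+ 4) (v l i - v l j) (+ 0)
    (trans (sym (dot-rootVector i j (v l))) (trans (sym (dot-congˡ (v l) e)) (perp⇒orth v x∈ l))))

dot-difference : ∀ {n} (x y : Vecℤ n) → dot (λ i → x i - y i) (λ i → x i - y i) ≡ dot x x - + 2 * dot x y + dot y y
dot-difference x y = begin
  sumF (λ i → (x i - y i) * (x i - y i))
    ≡⟨ sumF-cong (λ i → ring (x i) (y i)) ⟩
  sumF (λ i → (x i * x i + -[1+ 1 ] * (x i * y i)) + y i * y i)
    ≡⟨ sumF-+ (λ i → x i * x i + -[1+ 1 ] * (x i * y i)) (λ i → y i * y i) ⟩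
  sumF (λ i → x i * x i + -[1+ 1 ] * (x i * y i)) + dot y y
    ≡⟨ cong (λ z → z + dot y y) (trans (sumF-+ (λ i → x i * x i) (λ i → -[1+ 1 ] * (x i * y i)))
         (cong (λ z → dot x x + z) (sumF-*ˡ -[1+ 1 ] (λ i → x i * y i)))) ⟩
  dot x x + -[1+ 1 ] * dot x y + dot y y
    ≡⟨ ring₂ (dot x x) (dot x y) (dot y y) ⟩
  dot x x - + 2 * dot x y + dot y y ∎
  where
  open ≡-Reasoning
  ring : ∀ x y → (x - y) * (x - y) ≡ (x * x + -[1+ 1 ] * (x * y)) + y * y
  ring = solve-∀
  ring₂ : ∀ p q r → p + -[1+ 1 ] * q + r ≡ p - + 2 * q + r
  ring₂ = solve-∀

-- Every root of the second complement has a preimage of norm 2, which is a root of the first. By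
-- the pigeonhole principle two different roots share a preimage up to `_≈_`.
more-roots⇒non-isometric : ∀ v v' → length (roots v) ℕ.< length (roots v') → ¬ Isometric (Perp (Span v)) (Perp (Span v'))
more-roots⇒non-isometric v v' fewer (f , _ , _ , iso , onto) = collide (Fin.pigeonhole fewer code)
  where
  pair : Fin (length (roots v')) → Fin 16 × Fin 16
  pair p = List.lookup (roots v') p
  isRoot : ∀ p → IsRoot v' (pair p)
  isRoot p = proj₂ (∈-filter⁻ (isRoot? v') {xs = allPairs} (∈-lookup {xs = roots v'} p))
  y : Fin (length (roots v')) → V
  y p = rootVector (proj₁ (pair p)) (proj₂ (pair p))
  preimage : ∀ p → Σ V λ x → Perp (Span v) x × f x ≈ y p
  preimage p = onto (y p) (root⇒perp v' _ _ (isRoot p))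
  x : Fin (length (roots v')) → V
  x p = proj₁ (preimage p)
  dot-x : ∀ p q → dot (x p) (x q) ≡ dot (y p) (y q)
  dot-x p q = trans (sym (iso (x p) (x q) (proj₁ (proj₂ (preimage p))) (proj₁ (proj₂ (preimage q)))))
    (trans (dot-congˡ (f (x q)) (proj₂ (proj₂ (preimage p)))) (dot-congʳ (y p) (proj₂ (proj₂ (preimage q)))))
  norm-y : ∀ p → dot (y p) (y p) ≡ + 32
  norm-y p = norm-rootVector (proj₁ (isRoot p))
  root-x : ∀ p → Σ (Fin 16 × Fin 16) λ r → r ∈ roots v × x p ≈ rootVector (proj₁ r) (proj₂ r)
  root-x p = perp⇒root v (proj₁ (proj₂ (preimage p))) (trans (dot-x p p) (norm-y p))
  code : Fin (length (roots v')) → Fin (length (roots v))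
  code p = index {xs = roots v} (proj₁ (proj₂ (root-x p)))
  collide : Σ _ (λ p → Σ _ λ q → p Fin.< q × code p ≡ code q) → ⊥
  collide (p , q , p<q , e) = Fin.<⇒≢ p<q (lookup-injective (roots-unique v') p q
      (cong₂ _,_ (proj₁ same-pair) (proj₂ same-pair)))
    where
    same-root : proj₁ (root-x p) ≡ proj₁ (root-x q)
    same-root = trans (lookup-index {xs = roots v} (proj₁ (proj₂ (root-x p))))
      (trans (cong (List.lookup (roots v)) e) (sym (lookup-index {xs = roots v} (proj₁ (proj₂ (root-x q))))))
    x≈ : x p ≈ x q
    x≈ k = trans (proj₂ (proj₂ (root-x p)) k)
      (trans (cong (λ r → rootVector (proj₁ r) (proj₂ r) k) same-root) (sym (proj₂ (proj₂ (root-x q)) k)))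
    -- Since `f` need not respect `_≈_`, x p ≈ x q does not yield y p ≈ y q at once. Inner products
    -- do: (y p , y q) equals both norms, so the difference has norm 0.
    cross : dot (y p) (y q) ≡ + 32
    cross = trans (sym (dot-x p q)) (trans (sym (dot-congʳ (x p) x≈)) (trans (dot-x p p) (norm-y p)))
    y≈ : ∀ k → y p k - y q k ≡ + 0
    y≈ = dot≡0⇒≡0 (λ k → y p k - y q k) (trans (dot-difference (y p) (y q))
      (cong₂ _+_ (cong₂ (λ u v → u - + 2 * v) (norm-y p) cross) (norm-y q)))
    same-pair = difference-injective (proj₁ (isRoot p)) λ k → *-cancelˡ-≡ (+ 4) _ _ (i-j≡0⇒i≡j (y p k) (y q k) (y≈ k))

-- The first complement has 64 roots (A₇ + A₂ + A₁), the second 80 (A₈ + A₂ + A₁).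
non-isometric : ¬ Isometric (Perp (Span abc)) (Perp (Span abc'))
non-isometric = more-roots⇒non-isometric abc abc' (ℕ.<ᵇ⇒< 64 80 _)

-- Inequivalence of the two spans

InA15p-resp : ∀ {x y} → y ≈ x → InA15p x → InA15p y
InA15p-resp e (w , k , Σw , h) = w , k , Σw , λ i → trans (e i) (h i)

span⊆ : ∀ {n} (v : Fin n → V) → (∀ l → InA15p (v l)) → ∀ x → Span v x → InA15p x
span⊆ v v∈ x (co , e) = unglued (Σx , dot co r , (λ i → dot co (λ l → u l i)) , coset)
  where
  r = λ l → proj₁ (proj₂ (glued (v∈ l)))
  u = λ l → proj₁ (proj₂ (proj₂ (glued (v∈ l))))
  open ≡-Reasoning
  Σx : sumF x ≡ + 0
  Σx = begin
    sumF x                                    ≡⟨ sumF-cong e ⟩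
    sumF (λ i → sumF (λ l → co l * v l i))    ≡⟨ sumF-swap (λ i l → co l * v l i) ⟩
    sumF (λ l → sumF (λ i → co l * v l i))    ≡⟨ sumF-cong (λ l → sumF-*ˡ (co l) (v l)) ⟩
    dot co (λ l → sumF (v l))                 ≡⟨ dot-0ʳ co (λ l → proj₁ (glued (v∈ l))) ⟩
    + 0 ∎
  ring : ∀ c r u → c * (r + + 4 * u) ≡ c * r + + 4 * (c * u)
  ring = solve-∀
  coset : ∀ i → x i ≡ dot co r + + 4 * dot co (λ l → u l i)
  coset i = begin
    x i                                                             ≡⟨ e i ⟩
    sumF (λ l → co l * v l i)                                       
      ≡⟨ sumF-cong (λ l → trans (cong (co l *_) (proj₂ (proj₂ (proj₂ (glued (v∈ l)))) i)) (ring (co l) (r l) (u l i))) ⟩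
    sumF (λ l → co l * r l + + 4 * (co l * u l i))                  ≡⟨ sumF-+ (λ l → co l * r l) (λ l → + 4 * (co l * u l i)) ⟩
    dot co r + sumF (λ l → + 4 * (co l * u l i))                    ≡⟨ cong (λ z → dot co r + z) (sumF-*ˡ (+ 4) (λ l → co l * u l i)) ⟩
    dot co r + + 4 * dot co (λ l → u l i) ∎

a∈ : InA15p a
a∈ = InA15p-resp (from-yes (Fin.all? (λ i → a i ≟ quadVector (# 0) (# 1) (# 2) (# 3) i))) (quadVector∈ (# 0) (# 1) (# 2) (# 3))

b∈ : InA15p b
b∈ = InA15p-resp (from-yes (Fin.all? (λ i → b i ≟ quadVector (# 0) (# 1) (# 2) (# 4) i))) (quadVector∈ (# 0) (# 1) (# 2) (# 4))

c∈ : InA15p c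
c∈ = InA15p-resp (from-yes (Fin.all? (λ i → c i ≟ quadVector (# 0) (# 5) (# 6) (# 7) i))) (quadVector∈ (# 0) (# 5) (# 6) (# 7))

c'∈ : InA15p c'
c'∈ = InA15p-resp (from-yes (Fin.all? (λ i → c' i ≟ quadVector (# 3) (# 4) (# 5) (# 6) i))) (quadVector∈ (# 3) (# 4) (# 5) (# 6))

abc∈ : ∀ l → InA15p (abc l)
abc∈ zero             = a∈
abc∈ (suc zero)       = b∈
abc∈ (suc (suc zero)) = c∈

-- An automorphism carrying one span onto the other carries their orthogonal complements onto each other.
inequivalent : ¬ AutEquiv (Span abc) (Span abc')
inequivalent (σ , (σ∈ , σ+ , iso , onto) , to , from) = non-isometric
  (σ , (λ x (x∈ , o) → σ∈ x x∈ , λ y y∈ → perp x x∈ o (from y y∈)) ,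
       (λ x y (x∈ , _) (y∈ , _) → σ+ x y x∈ y∈) ,
       (λ x y (x∈ , _) (y∈ , _) → iso x y x∈ y∈) ,
       λ y (y∈ , o) → back y o (onto y y∈))
  where
  span∈ : ∀ z → Span abc z → InA15p z
  span∈ = span⊆ abc abc∈
  perp : ∀ x → InA15p x → (∀ z → Span abc z → dot x z ≡ + 0) → ∀ {y} → Σ V (λ z → Span abc z × σ z ≈ y) → dot (σ x) y ≡ + 0
  perp x x∈ o (z , z∈ , e) = trans (sym (dot-congʳ (σ x) e)) (trans (iso x z x∈ (span∈ z z∈)) (o z z∈))
  back : ∀ y → (∀ z → Span abc' z → dot y z ≡ + 0) → Σ V (λ x → InA15p x × σ x ≈ y) → Σ V (λ x → Perp (Span abc) x × σ x ≈ y)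
  back y o (x , x∈ , e) = x , (x∈ , λ z z∈ → trans (sym (iso x z x∈ (span∈ z z∈))) (trans (dot-congˡ (σ z) e) (o (σ z) (to z z∈)))) , e

sumF-remove : ∀ {n} (f : Vecℤ (suc n)) i → sumF f ≡ f i + sumF (λ j → f (punchIn i j))
sumF-remove f zero = refl
sumF-remove {suc n} f (suc i) = trans (cong (λ z → f zero + z) (sumF-remove (λ j → f (suc j)) i)) (ring (f zero) (f (suc i)) _)
  where
  ring : ∀ x y z → x + (y + z) ≡ y + (x + z)
  ring = solve-∀

sumF-permute : ∀ {n} (π : Permutation n n) (f : Vecℤ n) → sumF (λ i → f (π ⟨$⟩ʳ i)) ≡ sumF f
sumF-permute π f = trans (sumF≡sum (λ i → f (π ⟨$⟩ʳ i))) (trans (sym (MonoidSum.sum-permute +-0-commutativeMonoid f π)) (sym (sumF≡sum f)))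
  where
  sumF≡sum : ∀ {n} (f : Vecℤ n) → sumF f ≡ MonoidSum.sum +-0-commutativeMonoid f
  sumF≡sum {zero}  f = refl
  sumF≡sum {suc n} f = cong (λ z → f zero + z) (sumF≡sum (λ i → f (suc i)))

-- Coordinate permutations

module _ {C : Set} (δ : C → C → ℤ) (δ-refl : ∀ x → δ x x ≡ + 1) (δ-nonneg : ∀ x y → + 0 ≤ δ x y)
         (δ-sound : ∀ x y → δ x y ≢ + 0 → x ≡ y) where

  -- Greedy matching: as the counts agree, some position of f has the colour of `g zero`; removing
  -- this position and `zero` keeps the counts equal.
  equal-counts⇒permutation : ∀ {n} (f g : Fin n → C) →
    (∀ x → sumF (λ i → δ x (f i)) ≡ sumF (λ i → δ x (g i))) →
    Σ (Permutation n n) λ π → ∀ i → f (π ⟨$⟩ʳ i) ≡ g i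
  equal-counts⇒permutation {zero}  f g h = Perm.id , λ ()
  equal-counts⇒permutation {suc n} f g h with Fin.any? (λ i → ¬? (δ (g zero) (f i) ≟ + 0))
  ... | no none = ⊥-elim (<⇒≱ (+<+ {0} {1} (s≤s z≤n)) (subst₂ _≤_ (δ-refl (g zero)) Σ≡0
          (term≤sumF (λ i → δ (g zero) (g i)) (λ i → δ-nonneg (g zero) (g i)) zero)))
    where
    Σ≡0 : sumF (λ i → δ (g zero) (g i)) ≡ + 0
    Σ≡0 = trans (sym (h (g zero))) (trans
      (sumF-cong (λ i → decidable-stable (δ (g zero) (f i) ≟ + 0) (λ ne → none (i , ne)))) (sumF-0 {suc n}))
  ... | yes (i , ne) = Perm.insert zero i (proj₁ rest) , matches
    where
    g₀≡fᵢ : g zero ≡ f i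
    g₀≡fᵢ = δ-sound (g zero) (f i) ne
    counts : ∀ x → sumF (λ j → δ x (f (punchIn i j))) ≡ sumF (λ j → δ x (g (suc j)))
    counts x = +-cancelˡ (δ x (f i)) _ _ (trans (sym (sumF-remove (λ j → δ x (f j)) i))
      (trans (h x) (cong (λ y → δ x y + sumF (λ j → δ x (g (suc j)))) g₀≡fᵢ)))
      where
      +-cancelˡ : ∀ x y z → x + y ≡ x + z → y ≡ z
      +-cancelˡ x y z e = trans (ring x y) (trans (cong (λ w → w - x) e) (sym (ring x z)))
        where
        ring : ∀ x y → y ≡ x + y - x
        ring = solve-∀
    rest : Σ (Permutation n n) λ π → ∀ j → f (punchIn i (π ⟨$⟩ʳ j)) ≡ g (suc j)
    rest = equal-counts⇒permutation (λ j → f (punchIn i j)) (λ j → g (suc j)) counts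
    matches : ∀ j → f (Perm.insert zero i (proj₁ rest) ⟨$⟩ʳ j) ≡ g j
    matches zero    = sym g₀≡fᵢ
    matches (suc j) = trans (cong f (Perm.insert-punchIn zero i (proj₁ rest) j)) (proj₂ rest j)

val : Bool → ℤ
val false = + 0
val true  = + 1

-- The indicator of x = β is an affine function of val x.
χ₀ χ₁ : Bool → ℤ
χ₀ false = + 1
χ₀ true  = + 0
χ₁ false = -[1+ 0 ]
χ₁ true  = + 1

χ : Bool → Bool → ℤ
χ β x = χ₀ β + χ₁ β * val x

χ-refl : ∀ x → χ x x ≡ + 1
χ-refl false = refl
χ-refl true  = refl

χ-nonneg : ∀ β x → + 0 ≤ χ β x
χ-nonneg false false = +≤+ z≤n
χ-nonneg false true  = +≤+ z≤n
χ-nonneg true  false = +≤+ z≤n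
χ-nonneg true  true  = +≤+ z≤n

χ-sound : ∀ β x → χ β x ≢ + 0 → β ≡ x
χ-sound false false _  = refl
χ-sound false true  ne = ⊥-elim (ne refl)
χ-sound true  false ne = ⊥-elim (ne refl)
χ-sound true  true  _  = refl

Color : Set
Color = Bool × Bool × Bool

δ : Color → Color → ℤ
δ (α , β , γ) (x , y , z) = χ α x * (χ β y * χ γ z)

δ-refl : ∀ x → δ x x ≡ + 1
δ-refl (x , y , z) = cong₂ _*_ (χ-refl x) (cong₂ _*_ (χ-refl y) (χ-refl z))

δ-nonneg : ∀ x y → + 0 ≤ δ x y
δ-nonneg (α , β , γ) (x , y , z) = nonneg-* (χ-nonneg α x) (nonneg-* (χ-nonneg β y) (χ-nonneg γ z))

δ-sound : ∀ x y → δ x y ≢ + 0 → x ≡ y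
δ-sound (α , β , γ) (x , y , z) ne = cong₂ _,_
  (χ-sound α x (λ e → ne (trans (cong (_* (χ β y * χ γ z)) e) (*-zeroˡ (χ β y * χ γ z)))))
  (cong₂ _,_ (χ-sound β y (λ e → ne (trans (cong (χ α x *_) (trans (cong (_* χ γ z) e) (*-zeroˡ (χ γ z)))) (*-zeroʳ (χ α x)))))
             (χ-sound γ z (λ e → ne (trans (cong (χ α x *_) (trans (cong (χ β y *_) e) (*-zeroʳ (χ β y)))) (*-zeroʳ (χ α x))))))

-- The squarefree monomials in three bits. Summed over the coordinates they give 16, the sizes of
-- the three sets, of their pairwise intersections and of the triple intersection.
monomial : Color → Fin 8 → ℤ
monomial (x , y , z) = go (val x) (val y) (val z)
  where
  go : ℤ → ℤ → ℤ → Fin 8 → ℤ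
  go x y z zero = + 1
  go x y z (suc zero) = x
  go x y z (suc (suc zero)) = y
  go x y z (suc (suc (suc zero))) = z
  go x y z (suc (suc (suc (suc zero)))) = x * y
  go x y z (suc (suc (suc (suc (suc zero))))) = x * z
  go x y z (suc (suc (suc (suc (suc (suc zero)))))) = y * z
  go x y z (suc (suc (suc (suc (suc (suc (suc zero))))))) = x * (y * z)

moment : (Fin 16 → Color) → Fin 8 → ℤ
moment f j = sumF (λ i → monomial (f i) j)

-- Inclusion-exclusion: the indicator of a colour is a product of three affine functions of the
-- bits, whose expansion has coefficients depending on the colour alone.
count-moment : ∀ x → Σ (Vecℤ 8) λ k → ∀ f → sumF (λ i → δ x (f i)) ≡ dot k (moment f)
count-moment (α , β , γ) = k , λ f → begin
  sumF (λ i → δ (α , β , γ) (f i))                       ≡⟨ sumF-cong (λ i → expand (f i)) ⟩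
  sumF (λ i → sumF (λ j → k j * monomial (f i) j))       ≡⟨ sumF-swap (λ i j → k j * monomial (f i) j) ⟩
  sumF (λ j → sumF (λ i → k j * monomial (f i) j))       ≡⟨ sumF-cong (λ j → sumF-*ˡ (k j) (λ i → monomial (f i) j)) ⟩
  dot k (moment f) ∎
  where
  open ≡-Reasoning
  a₀ = χ₀ α
  a₁ = χ₁ α
  b₀ = χ₀ β
  b₁ = χ₁ β
  c₀ = χ₀ γ
  c₁ = χ₁ γ
  k : Vecℤ 8
  k zero = a₀ * (b₀ * c₀)
  k (suc zero) = a₁ * (b₀ * c₀)
  k (suc (suc zero)) = a₀ * (b₁ * c₀)
  k (suc (suc (suc zero))) = a₀ * (b₀ * c₁)
  k (suc (suc (suc (suc zero)))) = a₁ * (b₁ * c₀)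
  k (suc (suc (suc (suc (suc zero))))) = a₁ * (b₀ * c₁)
  k (suc (suc (suc (suc (suc (suc zero)))))) = a₀ * (b₁ * c₁)
  k (suc (suc (suc (suc (suc (suc (suc zero))))))) = a₁ * (b₁ * c₁)
  ring : ∀ a₀ a₁ b₀ b₁ c₀ c₁ x y z → (a₀ + a₁ * x) * ((b₀ + b₁ * y) * (c₀ + c₁ * z)) ≡
    a₀ * (b₀ * c₀) * + 1 + (a₁ * (b₀ * c₀) * x + (a₀ * (b₁ * c₀) * y + (a₀ * (b₀ * c₁) * z +
    (a₁ * (b₁ * c₀) * (x * y) + (a₁ * (b₀ * c₁) * (x * z) + (a₀ * (b₁ * c₁) * (y * z) + (a₁ * (b₁ * c₁) * (x * (y * z)) + + 0)))))))
  ring = solve-∀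
  expand : ∀ x → δ (α , β , γ) x ≡ sumF (λ j → k j * monomial x j)
  expand (x , y , z) = ring a₀ a₁ b₀ b₁ c₀ c₁ (val x) (val y) (val z)

equal-moments⇒permutation : ∀ (f g : Fin 16 → Color) → (∀ j → moment f j ≡ moment g j) →
  Σ (Permutation 16 16) λ π → ∀ i → f (π ⟨$⟩ʳ i) ≡ g i
equal-moments⇒permutation f g h = equal-counts⇒permutation δ δ-refl δ-nonneg δ-sound f g λ x →
  trans (proj₂ (count-moment x) f) (trans (dot-congʳ (proj₁ (count-moment x)) h) (sym (proj₂ (count-moment x) g)))

module _ (π : Permutation 16 16) where
  permute : V → V
  permute x i = x (π ⟨$⟩ʳ i)

  permute∈ : ∀ x → InA15p x → InA15p (permute x)
  permute∈ x x∈ with glued x∈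
  ... | Σx , r , u , e = unglued (trans (sumF-permute π x) Σx , r , permute u , λ i → e (π ⟨$⟩ʳ i))

permute-aut : ∀ π → IsAut (permute π)
permute-aut π = permute∈ π , (λ _ _ _ _ _ → refl) , (λ x y _ _ → sumF-permute π (λ i → x i * y i)) ,
  λ y y∈ → permute (Perm.flip π) y , permute∈ (Perm.flip π) y y∈ , λ i → cong y (Perm.inverseˡ π)

-- Classification of the triples

sign-square : ∀ {ε} → Sign± ε → ε * ε ≡ + 1
sign-square (inj₁ refl) = refl
sign-square (inj₂ refl) = refl

-- Spans do not see signs: `ε l` is absorbed into the coefficients, and its square is 1.
permutation⇒equivalent : ∀ {n} (v w : Fin n → V) (ε : Vecℤ n) → (∀ l → Sign± (ε l)) → (π : Permutation 16 16) →
  (∀ l i → v l (π ⟨$⟩ʳ i) ≡ ε l * w l i) → AutEquiv (Span v) (Span w)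
permutation⇒equivalent v w ε sign π h = permute π , permute-aut π ,
  (λ x (co , e) → (λ l → co l * ε l) , λ i → trans (e (π ⟨$⟩ʳ i))
     (sumF-cong (λ l → trans (cong (co l *_) (h l i)) (sym (*-assoc (co l) (ε l) (w l i)))))) ,
  λ y (co , e) → comb (λ l → co l * ε l) v , ((λ l → co l * ε l) , λ i → refl) ,
     λ i → trans (sumF-cong (λ l → trans (cong (co l * ε l *_) (h l i)) (unsign l (co l) (w l i)))) (sym (e i))
  where
  ring : ∀ c e w → c * e * (e * w) ≡ c * (e * e * w)
  ring = solve-∀
  unsign : ∀ l c w → c * ε l * (ε l * w) ≡ c * w
  unsign l c w = trans (ring c (ε l) w) (cong (c *_) (trans (cong (_* w) (sign-square (sign l))) (*-identityˡ w)))

signed-dot : ∀ ε ε' (s t : V) → sumF s ≡ + 4 → sumF t ≡ + 4 →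
  dot (λ i → ε * (+ 1 - + 4 * s i)) (λ i → ε' * (+ 1 - + 4 * t i)) ≡ + 16 * (ε * ε' * (dot s t - + 1))
signed-dot ε ε' s t Σs Σt = begin
  dot (λ i → ε * (+ 1 - + 4 * s i)) (λ i → ε' * (+ 1 - + 4 * t i))
    ≡⟨ sumF-cong (λ i → ring ε ε' (s i) (t i)) ⟩
  sumF (λ i → ε * ε' * (+ 1 + (-[1+ 3 ] * s i + (-[1+ 3 ] * t i + + 16 * (s i * t i)))))
    ≡⟨ sumF-*ˡ (ε * ε') (λ i → + 1 + (-[1+ 3 ] * s i + (-[1+ 3 ] * t i + + 16 * (s i * t i)))) ⟩
  ε * ε' * sumF (λ i → + 1 + (-[1+ 3 ] * s i + (-[1+ 3 ] * t i + + 16 * (s i * t i))))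
    ≡⟨ cong (ε * ε' *_) (begin
       sumF (λ i → + 1 + (-[1+ 3 ] * s i + (-[1+ 3 ] * t i + + 16 * (s i * t i))))
         ≡⟨ sumF-+ (λ _ → + 1) (λ i → -[1+ 3 ] * s i + (-[1+ 3 ] * t i + + 16 * (s i * t i))) ⟩
       + 16 + sumF (λ i → -[1+ 3 ] * s i + (-[1+ 3 ] * t i + + 16 * (s i * t i)))
         ≡⟨ cong (λ z → + 16 + z) (sumF-+ (λ i → -[1+ 3 ] * s i) (λ i → -[1+ 3 ] * t i + + 16 * (s i * t i))) ⟩
       + 16 + (sumF (λ i → -[1+ 3 ] * s i) + sumF (λ i → -[1+ 3 ] * t i + + 16 * (s i * t i)))
         ≡⟨ cong₂ (λ p q → + 16 + (p + q)) (trans (sumF-*ˡ -[1+ 3 ] s) (cong (-[1+ 3 ] *_) Σs))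
              (trans (sumF-+ (λ i → -[1+ 3 ] * t i) (λ i → + 16 * (s i * t i)))
                (cong₂ _+_ (trans (sumF-*ˡ -[1+ 3 ] t) (cong (-[1+ 3 ] *_) Σt)) (sumF-*ˡ (+ 16) (λ i → s i * t i)))) ⟩
       + 16 + (-[1+ 3 ] * + 4 + (-[1+ 3 ] * + 4 + + 16 * dot s t)) ∎) ⟩
  ε * ε' * (+ 16 + (-[1+ 3 ] * + 4 + (-[1+ 3 ] * + 4 + + 16 * dot s t)))
    ≡⟨ ring₂ (ε * ε') (dot s t) ⟩
  + 16 * (ε * ε' * (dot s t - + 1)) ∎
  where
  open ≡-Reasoning
  ring : ∀ ε ε' s t → ε * (+ 1 - + 4 * s) * (ε' * (+ 1 - + 4 * t)) ≡
    ε * ε' * (+ 1 + (-[1+ 3 ] * s + (-[1+ 3 ] * t + + 16 * (s * t))))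
  ring = solve-∀
  ring₂ : ∀ e d → e * (+ 16 + (-[1+ 3 ] * + 4 + (-[1+ 3 ] * + 4 + + 16 * d))) ≡ + 16 * (e * (d - + 1))
  ring₂ = solve-∀

record Quad (x : V) : Set where
  field
    ε    : ℤ
    sign : Sign± ε
    set  : Fin 16 → Bool
    form : ∀ i → x i ≡ ε * (+ 1 - + 4 * val (set i))
    size : sumF (λ i → val (set i)) ≡ + 4

quad-vector : ∀ {x} → InA15p x → dot x x ≡ + 48 → Quad x
quad-vector {x} x∈ n with norm3 x∈ n
... | ε , s , sgn , bin , e = record { ε = ε ; sign = sgn ; set = set ; form = form ; size = size }
  where
  bit : ∀ {y} → y ≡ + 0 ⊎ y ≡ + 1 → Bool
  bit (inj₁ _) = false
  bit (inj₂ _) = true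
  val-bit : ∀ {y} (p : y ≡ + 0 ⊎ y ≡ + 1) → y ≡ val (bit p)
  val-bit (inj₁ p) = p
  val-bit (inj₂ p) = p
  set : Fin 16 → Bool
  set i = bit (bin i)
  form : ∀ i → x i ≡ ε * (+ 1 - + 4 * val (set i))
  form i = trans (e i) (cong (λ z → ε * (+ 1 - + 4 * z)) (val-bit (bin i)))
  S = sumF (λ i → val (set i))
  sum-x : sumF x ≡ ε * (+ 16 + -[1+ 3 ] * S)
  sum-x = trans (sumF-cong form) (trans (sumF-*ˡ ε (λ i → + 1 - + 4 * val (set i))) (cong (ε *_)
    (trans (sumF-cong (λ i → cong (λ z → + 1 + z) (neg-distribˡ-* (+ 4) (val (set i)))))
      (trans (sumF-+ (λ _ → + 1) (λ i → -[1+ 3 ] * val (set i))) (cong (λ z → + 16 + z) (sumF-*ˡ -[1+ 3 ] (λ i → val (set i))))))))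
  solve : ∀ {ε S} → Sign± ε → ε * (+ 16 + -[1+ 3 ] * S) ≡ + 0 → S ≡ + 4
  solve {_} {S} (inj₁ refl) h = *-cancelˡ-≡ (+ 4) S (+ 4) (trans (ring S) (cong (λ z → + 16 - z) h))
    where
    ring : ∀ S → + 4 * S ≡ + 16 - + 1 * (+ 16 + -[1+ 3 ] * S)
    ring = solve-∀
  solve {_} {S} (inj₂ refl) h = *-cancelˡ-≡ (+ 4) S (+ 4) (trans (ring S) (cong (λ z → + 16 + z) h))
    where
    ring : ∀ S → + 4 * S ≡ + 16 + -[1+ 0 ] * (+ 16 + -[1+ 3 ] * S)
    ring = solve-∀
  size : S ≡ + 4
  size = solve sgn (trans (sym sum-x) (proj₁ (glued x∈)))

val-nonneg : ∀ x → + 0 ≤ val x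
val-nonneg false = +≤+ z≤n
val-nonneg true  = +≤+ z≤n

val≤1 : ∀ x → val x ≤ + 1
val≤1 false = +≤+ z≤n
val≤1 true  = +≤+ (s≤s z≤n)

private
  sign±-* : ∀ {x y} → Sign± x → Sign± y → Sign± (x * y)
  sign±-* (inj₁ refl) (inj₁ refl) = inj₁ refl
  sign±-* (inj₁ refl) (inj₂ refl) = inj₂ refl
  sign±-* (inj₂ refl) (inj₁ refl) = inj₂ refl
  sign±-* (inj₂ refl) (inj₂ refl) = inj₁ refl

  shift : ∀ d → d ≡ + 1 * (d - + 1) + + 1
  shift = solve-∀

  shift⁻ : ∀ d → d ≡ - (-[1+ 0 ] * (d - + 1)) + + 1
  shift⁻ = solve-∀

  solve-0 : ∀ {e d} → Sign± e → e * (d - + 1) ≡ + 0 → d ≡ + 1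
  solve-0 {_} {d} (inj₁ refl) h = trans (shift d) (cong (λ z → z + + 1) h)
  solve-0 {_} {d} (inj₂ refl) h = trans (shift⁻ d) (cong (λ z → - z + + 1) h)

  solve-2 : ∀ {e d} → Sign± e → + 0 ≤ d → e * (d - + 1) ≡ + 2 → d ≡ + 3
  solve-2 {_} {d} (inj₁ refl) _  h = trans (shift d) (cong (λ z → z + + 1) h)
  -- The sign -1 would force d = -1, which no intersection size can be.
  solve-2 {_} {d} (inj₂ refl) 0≤d h with subst (+ 0 ≤_) (trans (shift⁻ d) (cong (λ z → - z + + 1) h)) 0≤d
  ... | ()

module _ (v : Fin 3 → V) (q : ∀ l → Quad (v l)) (gram : HasGram v G) where
  private
    ε : Vecℤ 3
    ε l = Quad.ε (q l)

    s : Fin 3 → V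
    s l i = val (Quad.set (q l) i)

    meet : ∀ l m → ε l * ε m * (dot (s l) (s m) - + 1) ≡ G l m
    meet l m = *-cancelˡ-≡ (+ 16) (ε l * ε m * (dot (s l) (s m) - + 1)) (G l m)
      (trans (sym (signed-dot (ε l) (ε m) (s l) (s m) (Quad.size (q l)) (Quad.size (q m))))
      (trans (sym (trans (dot-congˡ (v m) (Quad.form (q l))) (dot-congʳ (λ i → ε l * (+ 1 - + 4 * s l i)) (Quad.form (q m))))) (gram l m)))

    s-nonneg : ∀ l i → + 0 ≤ s l i
    s-nonneg l i = val-nonneg (Quad.set (q l) i)

    sign : ∀ l m → Sign± (ε l * ε m)
    sign l m = sign±-* (Quad.sign (q l)) (Quad.sign (q m))

    color : Fin 16 → Color
    color i = Quad.set (q zero) i , Quad.set (q (suc zero)) i , Quad.set (q (suc (suc zero))) i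

    triple : ℤ
    triple = sumF (λ i → s zero i * (s (suc zero) i * s (suc (suc zero)) i))

    s₀s₁≡3 : dot (s zero) (s (suc zero)) ≡ + 3
    s₀s₁≡3 = solve-2 (sign zero (suc zero))
      (sumF-nonneg (λ i → s zero i * s (suc zero) i) (λ i → nonneg-* (s-nonneg zero i) (s-nonneg (suc zero) i)))
      (meet zero (suc zero))

    s₁s₂≡1 : dot (s (suc zero)) (s (suc (suc zero))) ≡ + 1
    s₁s₂≡1 = solve-0 (sign (suc zero) (suc (suc zero))) (meet (suc zero) (suc (suc zero)))

    -- The moments forced by the Gram matrix: 16 coordinates, three sets of size 4, intersections of
    -- sizes 3, 1 and 1. Only the triple intersection τ stays free.
    μ : ℤ → Vecℤ 8
    μ τ zero = + 16
    μ τ (suc zero) = + 4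
    μ τ (suc (suc zero)) = + 4
    μ τ (suc (suc (suc zero))) = + 4
    μ τ (suc (suc (suc (suc zero)))) = + 3
    μ τ (suc (suc (suc (suc (suc zero))))) = + 1
    μ τ (suc (suc (suc (suc (suc (suc zero)))))) = + 1
    μ τ (suc (suc (suc (suc (suc (suc (suc zero))))))) = τ

    moments : ∀ j → moment color j ≡ μ triple j
    moments zero = refl
    moments (suc zero) = Quad.size (q zero)
    moments (suc (suc zero)) = Quad.size (q (suc zero))
    moments (suc (suc (suc zero))) = Quad.size (q (suc (suc zero)))
    moments (suc (suc (suc (suc zero)))) = s₀s₁≡3
    moments (suc (suc (suc (suc (suc zero))))) = solve-0 (sign zero (suc (suc zero))) (meet zero (suc (suc zero)))
    moments (suc (suc (suc (suc (suc (suc zero)))))) = s₁s₂≡1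
    moments (suc (suc (suc (suc (suc (suc (suc zero))))))) = refl

    triple-cases : triple ≡ + 1 ⊎ triple ≡ + 0
    triple-cases = pick triple
      (sumF-nonneg (λ i → s zero i * (s (suc zero) i * s (suc (suc zero)) i)) (λ i → nonneg-* (s-nonneg zero i) (s₁₂ i)))
      (≤-trans (sumF-mono (λ i → s zero i * (s (suc zero) i * s (suc (suc zero)) i)) (λ i → s (suc zero) i * s (suc (suc zero)) i)
                 (λ i → below (s zero i) (val≤1 (Quad.set (q zero) i)) (s₁₂ i)))
               (≤-reflexive s₁s₂≡1))
      where
      s₁₂ : ∀ i → + 0 ≤ s (suc zero) i * s (suc (suc zero)) i
      s₁₂ i = nonneg-* (s-nonneg (suc zero) i) (s-nonneg (suc (suc zero)) i)
      below : ∀ x {y} → x ≤ + 1 → + 0 ≤ y → x * y ≤ y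
      below x {y} x≤1 0≤y = 0≤i-j⇒j≤i (subst (+ 0 ≤_) (ring x y) (nonneg-* (i≤j⇒0≤j-i x≤1) 0≤y))
        where
        ring : ∀ x y → (+ 1 - x) * y ≡ y - x * y
        ring = solve-∀
      pick : ∀ t → + 0 ≤ t → t ≤ + 1 → t ≡ + 1 ⊎ t ≡ + 0
      pick (+ 0) _ _ = inj₂ refl
      pick (+ 1) _ _ = inj₁ refl
      pick (+ suc (suc n)) _ (+≤+ (s≤s ()))

    -- Recovers the 4-set of a vector with sign +1, whose members carry the entry 1 - 4 = -3.
    hit : V → Fin 16 → Bool
    hit x i = does (x i ≟ m3)

    colors : (Fin 3 → V) → Fin 16 → Color
    colors w i = hit (w zero) i , hit (w (suc zero)) i , hit (w (suc (suc zero))) i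

    conclude : (w : Fin 3 → V) → (∀ l i → w l i ≡ + 1 - + 4 * val (hit (w l) i)) →
      (∀ j → moment (colors w) j ≡ moment color j) → AutEquiv (Span v) (Span w)
    conclude w w-form h = permutation⇒equivalent v w ε (λ l → Quad.sign (q l)) π λ l i →
        trans (Quad.form (q l) (π ⟨$⟩ʳ i)) (cong (ε l *_)
          (trans (cong (λ z → + 1 - + 4 * val z) (bits l i)) (sym (w-form l i))))
      where
      matching : Σ (Permutation 16 16) λ π → ∀ i → color (π ⟨$⟩ʳ i) ≡ colors w i
      matching = equal-moments⇒permutation color (colors w) (λ j → sym (h j))
      π = proj₁ matching
      bits : ∀ l i → Quad.set (q l) (π ⟨$⟩ʳ i) ≡ hit (w l) i
      bits zero             i = cong proj₁ (proj₂ matching i)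
      bits (suc zero)       i = cong (λ x → proj₁ (proj₂ x)) (proj₂ matching i)
      bits (suc (suc zero)) i = cong (λ x → proj₂ (proj₂ x)) (proj₂ matching i)

  classify : AutEquiv (Span v) (Span abc) ⊎ AutEquiv (Span v) (Span abc')
  classify = by triple-cases
    where
    by : triple ≡ + 1 ⊎ triple ≡ + 0 → AutEquiv (Span v) (Span abc) ⊎ AutEquiv (Span v) (Span abc')
    by (inj₁ e) = inj₁ (conclude abc (from-yes (Fin.all? (λ l → Fin.all? (λ i → abc l i ≟ + 1 - + 4 * val (hit (abc l) i)))))
      (λ j → trans (from-yes (Fin.all? (λ j → moment (colors abc) j ≟ μ (+ 1) j)) j)
        (trans (cong (λ τ → μ τ j) (sym e)) (sym (moments j)))))
    by (inj₂ e) = inj₂ (conclude abc' (from-yes (Fin.all? (λ l → Fin.all? (λ i → abc' l i ≟ + 1 - + 4 * val (hit (abc' l) i)))))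
      (λ j → trans (from-yes (Fin.all? (λ j → moment (colors abc') j ≟ μ (+ 0) j)) j)
        (trans (cong (λ τ → μ τ j) (sym e)) (sym (moments j)))))

classification : ∀ (v : Fin 3 → V) → (∀ i → InA15p (v i)) → HasGram v G →
  AutEquiv (Span v) (Span abc) ⊎ AutEquiv (Span v) (Span abc')
classification v v∈ gram = classify v q gram
  where
  q : ∀ l → Quad (v l)
  q zero             = quad-vector (v∈ zero) (gram zero zero)
  q (suc zero)       = quad-vector (v∈ (suc zero)) (gram (suc zero) (suc zero))
  q (suc (suc zero)) = quad-vector (v∈ (suc (suc zero))) (gram (suc (suc zero)) (suc (suc zero)))

hasGram-abc : HasGram abc G
hasGram-abc = from-yes (Fin.all? (λ i → Fin.all? (λ j → dot (abc i) (abc j) ≟ + 16 * G i j)))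

hasGram-abc' : HasGram abc' G
hasGram-abc' = from-yes (Fin.all? (λ i → Fin.all? (λ j → dot (abc' i) (abc' j) ≟ + 16 * G i j)))

theorem1p3 : (InA15p a × InA15p b × InA15p c × InA15p c') ×
    (HasGram abc G × HasGram abc' G) ×
    ¬ AutEquiv (Span abc) (Span abc') ×
    (∀ (v : Fin 3 → V) → (∀ i → InA15p (v i)) → HasGram v G →
    AutEquiv (Span v) (Span abc) ⊎ AutEquiv (Span v) (Span abc')) ×
    ¬ Isometric (Perp (Span abc)) (Perp (Span abc')) ×
    (MinimalNonIntegrable 2 (Perp (Span abc)) × RankDet (Perp (Span abc)) 12 (+ 15)) ×
    (MinimalNonIntegrable 2 (Perp (Span abc')) × RankDet (Perp (Span abc')) 12 (+ 15))
theorem1p3 =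
  (a∈ , b∈ , c∈ , c'∈) ,
  (hasGram-abc , hasGram-abc') ,
  inequivalent ,
  classification ,
  non-isometric ,
  (minimalNonIntegrable₁ , rankDet₁) ,
  (minimalNonIntegrable₂ , rankDet₂)
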